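{- The number of antichains in $\{0,1,2\}^n$ is $2^{\left(1+O\left(\sqrt{\log{n}/n}\right)\right)\ell_n(n)}$ as $n\to\infty$.
   Context: $\{0,1,2\}^n$ is the poset in which $x\leq y$ if and only if $x_j\leq y_j$ for all $1\leq j\leq n$. For $0\leq i\leq 2n$, $\ell_i(n)$ denotes the number of vectors in $\{0,1,2\}^n$ whose coordinates sum to $i$. An antichain is a set of pairwise incomparable elements. -}

module Defs where

open import Data.Nat.Base as ℕ using (ℕ; zero; suc; NonZero; z≤n; s≤s)
import Data.Nat.Properties as ℕP
import Data.Nat.Solver as ℕS
open import Data.Integer.Base as ℤ using (+_; -[1+_]; +<+; -<+)
import Data.Integer.Properties as ℤP
open import Data.Rational.Unnormalised.Base
  using (ℚᵘ; mkℚᵘ; 0ℚᵘ; 1ℚᵘ; _≃_; _<_; _≤_; *<*; _+_; _-_; _*_; -_; 1/_;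
         Positive; positive; nonNegative)
import Data.Rational.Unnormalised.Base as ℚ
import Data.Rational.Unnormalised.Properties as ℚP
import Data.Rational.Unnormalised.Solver as ℚS
open import Data.Fin.Base as Fin using (Fin; toℕ)
import Data.Fin.Properties as FinP
open import Data.List.Base as List
  using (List; []; _∷_; [_]; _++_; map; filter; length; allFin; cartesianProductWith)
open import Data.List.Relation.Unary.AllPairs using (allPairs?)
open import Data.Vec.Base as Vec using (Vec; []; _∷_)
open import Data.Vec.Relation.Binary.Pointwise.Inductive as Pointwise using (Pointwise)
open import Data.Product using (∃-syntax; _×_; _,_)
open import Data.Sum using (_⊎_; inj₁; inj₂)
open import Function.Bundles using (_⇔_)
open import Relation.Binary.Definitions using (Decidable)
open import Relation.Binary.PropositionalEquality
  using (_≡_; refl; sym; trans; cong; subst; subst₂)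
open import Relation.Nullary using (¬_; yes; no; contradiction; ¬?; _×-dec_)

------------------------------------------------------------------------
-- The poset {0,1,2}ⁿ and its antichains

Point : ℕ → Set
Point n = Vec (Fin 3) n

infix 4 _≼_ _≼?_

_≼_ : ∀ {n} → Point n → Point n → Set
_≼_ = Pointwise Fin._≤_

_≼?_ : ∀ {n} → Decidable (_≼_ {n})
_≼?_ = Pointwise.decidable FinP._≤?_

Incomparable : ∀ {n} → Point n → Point n → Set
Incomparable x y = ¬ (x ≼ y) × ¬ (y ≼ x)

incomparable? : ∀ {n} → Decidable (Incomparable {n})
incomparable? x y = ¬? (x ≼? y) ×-dec ¬? (y ≼? x)

-- Every point of {0,1,2}ⁿ, listed exactly once.
points : (n : ℕ) → List (Point n)
points zero    = [ [] ]
points (suc n) = cartesianProductWith _∷_ (allFin 3) (points n)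

weight : ∀ {n} → Point n → ℕ
weight x = Vec.sum (Vec.map toℕ x)

-- ℓ i n is ℓᵢ(n).
ℓ : ℕ → ℕ → ℕ
ℓ i n = length (filter (λ x → weight x ℕP.≟ i) (points n))

-- All sublists. When xs has no repetitions these list each subset of xs
-- exactly once (with its elements in the order of xs).
subsets : ∀ {A : Set} → List A → List (List A)
subsets []       = [ [] ]
subsets (x ∷ xs) = subsets xs ++ map (x ∷_) (subsets xs)

-- A set, listed without repetition, is an antichain when the entries at
-- distinct positions are incomparable.
antichains : (n : ℕ) → List (List (Point n))
antichains n = filter (allPairs? incomparable?) (subsets (points n))

#antichains : ℕ → ℕ
#antichains n = length (antichains n)

------------------------------------------------------------------------
-- Dedekind reals

record ℝ : Set₁ where
  field
    Lower Upper      : ℚᵘ → Set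
    lower-inhabited  : ∃[ q ] Lower q
    upper-inhabited  : ∃[ q ] Upper q
    lower-closed     : ∀ {q r} → q < r → Lower r → Lower q
    upper-closed     : ∀ {q r} → q < r → Upper q → Upper r
    lower-open       : ∀ {q} → Lower q → ∃[ r ] (q < r × Lower r)
    upper-open       : ∀ {q} → Upper q → ∃[ r ] (r < q × Upper r)
    disjoint         : ∀ {q} → Lower q → ¬ Upper q
    located          : ∀ {q r} → q < r → Lower q ⊎ Upper r

  lower-resp-≃ : ∀ {q r} → q ≃ r → Lower q → Lower r
  lower-resp-≃ q≃r l with lower-open l
  ... | s , q<s , ls = lower-closed (ℚP.<-respˡ-≃ q≃r q<s) ls

  upper-resp-≃ : ∀ {q r} → q ≃ r → Upper q → Upper r
  upper-resp-≃ q≃r u with upper-open u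
  ... | s , s<q , us = upper-closed (ℚP.<-respʳ-≃ q≃r s<q) us

open ℝ public using (Lower; Upper)

infix 4 _≤ℝ_

_≤ℝ_ : ℝ → ℝ → Set
x ≤ℝ y = ∀ q → Lower x q → Lower y q

fromℚ : ℚᵘ → ℝ
fromℚ c = record
  { Lower           = λ q → q < c
  ; Upper           = λ q → c < q
  ; lower-inhabited = c - 1ℚᵘ ,
      ℚP.<-respʳ-≃ (ℚP.+-identityʳ c) (ℚP.+-monoʳ-< c (*<* -<+))
  ; upper-inhabited = c + 1ℚᵘ ,
      ℚP.<-respˡ-≃ (ℚP.+-identityʳ c) (ℚP.+-monoʳ-< c (*<* (+<+ (s≤s z≤n))))
  ; lower-closed    = ℚP.<-trans
  ; upper-closed    = λ q<r c<q → ℚP.<-trans c<q q<r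
  ; lower-open      = λ q<c → let s , q<s , s<c = ℚP.<-dense q<c in s , q<s , s<c
  ; upper-open      = λ c<q → let s , c<s , s<q = ℚP.<-dense c<q in s , s<q , c<s
  ; disjoint        = ℚP.<-asym
  ; located         = loc
  }
  where
  loc : ∀ {q r} → q < r → q < c ⊎ c < r
  loc {q} q<r with q ℚP.<? c
  ... | yes q<c = inj₁ q<c
  ... | no  q≮c = inj₂ (ℚP.≤-<-trans (ℚP.≮⇒≥ q≮c) q<r)

infix 8 -ℝ_

-ℝ_ : ℝ → ℝ
-ℝ x = record
  { Lower           = λ q → Upper x (- q)
  ; Upper           = λ q → Lower x (- q)
  ; lower-inhabited = let q , u = X.upper-inhabited in - q , flipU u
  ; upper-inhabited = let q , l = X.lower-inhabited in - q , flipL l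
  ; lower-closed    = λ q<r → X.upper-closed (ℚP.neg-mono-< q<r)
  ; upper-closed    = λ q<r → X.lower-closed (ℚP.neg-mono-< q<r)
  ; lower-open      = λ {q} u → let r , r<-q , ur = X.upper-open u in
      - r , subst (_< - r) (ℚP.neg-involutive-≡ q) (ℚP.neg-mono-< r<-q) , flipU ur
  ; upper-open      = λ {q} l → let r , -q<r , lr = X.lower-open l in
      - r , subst (- r <_) (ℚP.neg-involutive-≡ q) (ℚP.neg-mono-< -q<r) , flipL lr
  ; disjoint        = λ u l → X.disjoint l u
  ; located         = λ q<r → swap (X.located (ℚP.neg-mono-< q<r))
  }
  where
  module X = ℝ x
  flipU : ∀ {q} → Upper x q → Upper x (- (- q))
  flipU {q} = subst (Upper x) (sym (ℚP.neg-involutive-≡ q))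
  flipL : ∀ {q} → Lower x q → Lower x (- (- q))
  flipL {q} = subst (Lower x) (sym (ℚP.neg-involutive-≡ q))
  swap : ∀ {A B : Set} → A ⊎ B → B ⊎ A
  swap (inj₁ a) = inj₂ a
  swap (inj₂ b) = inj₁ b

-- The real f⁻¹(x), for f an increasing bijection of the rationals with
-- inverse g.
pullback : (f g : ℚᵘ → ℚᵘ) →
           (∀ {q r} → q < r → f q < f r) → (∀ {q r} → q < r → g q < g r) →
           (∀ q → f (g q) ≃ q) → (∀ q → g (f q) ≃ q) → ℝ → ℝ
pullback f g f-mono g-mono fg gf x = record
  { Lower           = λ q → Lower x (f q)
  ; Upper           = λ q → Upper x (f q)
  ; lower-inhabited = let q , l = X.lower-inhabited in
      g q , X.lower-resp-≃ (ℚP.≃-sym (fg q)) l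
  ; upper-inhabited = let q , u = X.upper-inhabited in
      g q , X.upper-resp-≃ (ℚP.≃-sym (fg q)) u
  ; lower-closed    = λ q<r → X.lower-closed (f-mono q<r)
  ; upper-closed    = λ q<r → X.upper-closed (f-mono q<r)
  ; lower-open      = λ {q} l → let r , fq<r , lr = X.lower-open l in
      g r , ℚP.<-respˡ-≃ (gf q) (g-mono fq<r) , X.lower-resp-≃ (ℚP.≃-sym (fg r)) lr
  ; upper-open      = λ {q} u → let r , r<fq , ur = X.upper-open u in
      g r , ℚP.<-respʳ-≃ (gf q) (g-mono r<fq) , X.upper-resp-≃ (ℚP.≃-sym (fg r)) ur
  ; disjoint        = X.disjoint
  ; located         = λ q<r → X.located (f-mono q<r)
  }
  where module X = ℝ x

infixr 6 _⊕_

-- c + x: q < c + x iff q - c < x.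
_⊕_ : ℚᵘ → ℝ → ℝ
c ⊕ x = pullback (_- c) (_+ c) (ℚP.+-monoˡ-< (- c)) (ℚP.+-monoˡ-< c) fg gf x
  where
  open ℚS.+-*-Solver
  fg : ∀ q → (q + c) - c ≃ q
  fg q = solve 2 (λ q c → (q :+ c) :- c := q) ℚP.≃-refl q c
  gf : ∀ q → (q - c) + c ≃ q
  gf q = solve 2 (λ q c → (q :- c) :+ c := q) ℚP.≃-refl q c

-- x / c: q < x / c iff c q < x.
divide : (c : ℚᵘ) .{{_ : Positive c}} → ℝ → ℝ
divide c x = pullback (c *_) (c⁻¹ *_)
  (ℚP.*-monoʳ-<-pos c) (ℚP.*-monoʳ-<-pos c⁻¹ {{ℚP.1/pos⇒pos c}})
  (λ q → cancel c c⁻¹ q (ℚP.*-inverseʳ c)) (λ q → cancel c⁻¹ c q (ℚP.*-inverseˡ c)) x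
  where
  instance _ = ℚP.pos⇒nonZero c
  c⁻¹ : ℚᵘ
  c⁻¹ = 1/ c
  cancel : ∀ a b q → a * b ≃ 1ℚᵘ → a * (b * q) ≃ q
  cancel a b q ab = ℚP.≃-trans (ℚP.≃-sym (ℚP.*-assoc a b q))
    (ℚP.≃-trans (ℚP.*-congʳ {q} ab) (ℚP.*-identityˡ q))

infixl 7 _÷ℕ_
infixr 7 _·_

_÷ℕ_ : ℝ → (n : ℕ) .{{_ : NonZero n}} → ℝ
x ÷ℕ suc n = divide (+ suc n ℚ./ 1) x

_·_ : ℕ → ℝ → ℝ
zero  · x = fromℚ 0ℚᵘ
suc n · x = divide (+ 1 ℚ./ suc n) x

0<1 : 0ℚᵘ < 1ℚᵘ
0<1 = *<* (+<+ (s≤s z≤n))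

-- If q² lies on one side of s then r = (q t + s) / (q + t), t = s + 1, lies
-- strictly between q and √s, because
--   r - q = (s - q²) / (q + t)  and  s - r² = (t² - s) (s - q²) / (q + t)².
module √-step (q s : ℚᵘ) (0≤q : 0ℚᵘ ≤ q) (0<s : 0ℚᵘ < s) where
  private
    open ℚS.+-*-Solver

    t D E : ℚᵘ
    t = s + 1ℚᵘ
    D = q + t
    E = t * t - s

    0<t : 0ℚᵘ < t
    0<t = ℚP.+-mono-< 0<s 0<1

    0<D : 0ℚᵘ < D
    0<D = ℚP.+-mono-≤-< 0≤q 0<t

    instance
      D-pos : Positive D
      D-pos = positive 0<D
      D-nonZero : ℚ.NonZero D
      D-nonZero = ℚP.pos⇒nonZero D

    0<E : 0ℚᵘ < E
    0<E = ℚP.<-respʳ-≃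
      (solve 1 (λ s → s :* s :+ (s :+ con 1ℚᵘ) := (s :+ con 1ℚᵘ) :* (s :+ con 1ℚᵘ) :- s) ℚP.≃-refl s)
      (ℚP.+-mono-< (ℚP.positive⁻¹ (s * s) {{ℚP.pos*pos⇒pos s {{positive 0<s}} s {{positive 0<s}}}}) 0<t)

    instance
      E-pos : Positive E
      E-pos = positive 0<E
      DD-pos : Positive (D * D)
      DD-pos = ℚP.pos*pos⇒pos D D
      DD-nonNeg : ℚ.NonNegative (D * D)
      DD-nonNeg = ℚP.pos⇒nonNeg (D * D)
      D-nonNeg : ℚ.NonNegative D
      D-nonNeg = ℚP.pos⇒nonNeg D

  r : ℚᵘ
  r = (q * t + s) * 1/ D

  private
    rD : r * D ≃ q * t + s
    rD = ℚP.≃-trans (ℚP.*-assoc (q * t + s) (1/ D) D)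
      (ℚP.≃-trans (ℚP.*-congˡ {q * t + s} (ℚP.*-inverseˡ D)) (ℚP.*-identityʳ (q * t + s)))

    qD : q * q + q * t ≃ q * D
    qD = ℚP.≃-sym (ℚP.*-distribˡ-+ q q t)

    rD′ : s + q * t ≃ r * D
    rD′ = ℚP.≃-trans (ℚP.+-comm s (q * t)) (ℚP.≃-sym rD)

    rr : (q * t + s) * (q * t + s) ≃ r * r * (D * D)
    rr = ℚP.≃-trans (ℚP.≃-sym (ℚP.*-cong rD rD))
      (solve 2 (λ r D → (r :* D) :* (r :* D) := r :* r :* (D :* D)) ℚP.≃-refl r D)

    identity : s * (D * D) + E * (q * q) ≃ (q * t + s) * (q * t + s) + E * s
    identity = solve 3
      (λ q s t → s :* ((q :+ t) :* (q :+ t)) :+ (t :* t :- s) :* (q :* q)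
              := (q :* t :+ s) :* (q :* t :+ s) :+ (t :* t :- s) :* s)
      ℚP.≃-refl q s t

    cancel-sum : ∀ {a b c d} → a + c ≃ b + d → c < d → b < a
    cancel-sum {a} {b} {c} {d} eq c<d with b ℚP.<? a
    ... | yes b<a = b<a
    ... | no  b≮a = contradiction (ℚP.+-mono-≤-< (ℚP.≮⇒≥ b≮a) c<d) (ℚP.<-irrefl eq)

  module Up (q²<s : q * q < s) where
    q<r : q < r
    q<r = ℚP.*-cancelʳ-<-nonNeg D
      (ℚP.<-respʳ-≃ rD′ (ℚP.<-respˡ-≃ qD (ℚP.+-monoˡ-< (q * t) q²<s)))

    r²<s : r * r < s
    r²<s = ℚP.*-cancelʳ-<-nonNeg (D * D)
      (ℚP.<-respˡ-≃ rr (cancel-sum identity (ℚP.*-monoʳ-<-pos E q²<s)))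

  module Down (s<q² : s < q * q) where
    r<q : r < q
    r<q = ℚP.*-cancelʳ-<-nonNeg D
      (ℚP.<-respʳ-≃ qD (ℚP.<-respˡ-≃ rD′ (ℚP.+-monoˡ-< (q * t) s<q²)))

    s<r² : s < r * r
    s<r² = ℚP.*-cancelʳ-<-nonNeg (D * D)
      (ℚP.<-respʳ-≃ rr (cancel-sum (ℚP.≃-sym identity) (ℚP.*-monoʳ-<-pos E s<q²)))

    0<r : 0ℚᵘ < r
    0<r = ℚP.*-cancelʳ-<-nonNeg D
      (ℚP.<-respʳ-≃ rD′ (ℚP.<-respˡ-≃ (ℚP.≃-sym (ℚP.*-zeroˡ D))
        (ℚP.+-mono-<-≤ 0<s (ℚP.nonNegative⁻¹ (q * t)
          {{ℚP.nonNeg*nonNeg⇒nonNeg q {{nonNegative 0≤q}} t {{nonNegative (ℚP.<⇒≤ 0<t)}}}}))))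

square-mono-< : ∀ {q r} → 0ℚᵘ ≤ q → q < r → q * q < r * r
square-mono-< {q} {r} 0≤q q<r = ℚP.*-mono-<-nonNeg q<r q<r
  where instance _ = nonNegative 0≤q

square-pos : ∀ {q} → 0ℚᵘ < q → 0ℚᵘ < q * q
square-pos {q} 0<q = ℚP.positive⁻¹ (q * q) {{ℚP.pos*pos⇒pos q q}}
  where instance _ = positive 0<q

-- The square root (of the positive part of x, if x is negative).
√ : ℝ → ℝ
√ x = record
  { Lower           = L
  ; Upper           = U
  ; lower-inhabited = - 1ℚᵘ , inj₁ (*<* -<+)
  ; upper-inhabited = U-inh
  ; lower-closed    = L-closed
  ; upper-closed    = U-closed
  ; lower-open      = L-open
  ; upper-open      = U-open
  ; disjoint        = disj
  ; located         = loc
  }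
  where
  module X = ℝ x

  L U : ℚᵘ → Set
  L q = q < 0ℚᵘ ⊎ Lower x (q * q)
  U q = 0ℚᵘ < q × Upper x (q * q)

  U-inh : ∃[ q ] U q
  U-inh with X.upper-inhabited
  ... | u , ux with 0ℚᵘ ℚP.<? u
  ...   | no  0≮u = 1ℚᵘ , 0<1 ,
          X.upper-closed (ℚP.≤-<-trans (ℚP.≮⇒≥ 0≮u) (square-pos 0<1)) ux
  ...   | yes 0<u = u + 1ℚᵘ , 0<w , X.upper-closed u<w² ux
    where
    open ℚS.+-*-Solver
    0<w : 0ℚᵘ < u + 1ℚᵘ
    0<w = ℚP.+-mono-< 0<u 0<1
    u<w² : u < (u + 1ℚᵘ) * (u + 1ℚᵘ)
    u<w² = ℚP.<-respʳ-≃
      (solve 1 (λ u → u :+ (u :* u :+ (u :+ con 1ℚᵘ)) := (u :+ con 1ℚᵘ) :* (u :+ con 1ℚᵘ)) ℚP.≃-refl u)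
      (ℚP.<-respˡ-≃ (ℚP.+-identityʳ u)
        (ℚP.+-monoʳ-< u (ℚP.+-mono-< (square-pos 0<u) 0<w)))

  L-closed : ∀ {q r} → q < r → L r → L q
  L-closed {q} q<r (inj₁ r<0) = inj₁ (ℚP.<-trans q<r r<0)
  L-closed {q} q<r (inj₂ l) with q ℚP.<? 0ℚᵘ
  ... | yes q<0 = inj₁ q<0
  ... | no  q≮0 = inj₂ (X.lower-closed (square-mono-< (ℚP.≮⇒≥ q≮0) q<r) l)

  U-closed : ∀ {q r} → q < r → U q → U r
  U-closed q<r (0<q , u) =
    ℚP.<-trans 0<q q<r , X.upper-closed (square-mono-< (ℚP.<⇒≤ 0<q) q<r) u

  L-open : ∀ {q} → L q → ∃[ r ] (q < r × L r)
  L-open {q} l with q ℚP.<? 0ℚᵘ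
  L-open {q} l        | yes q<0 with ℚP.<-dense q<0
  ... | r , q<r , r<0 = r , q<r , inj₁ r<0
  L-open {q} (inj₁ q<0) | no q≮0 = contradiction q<0 q≮0
  L-open {q} (inj₂ l)   | no q≮0 with X.lower-open l
  ... | s , q²<s , ls = S.r , S.Up.q<r q²<s , inj₂ (X.lower-closed (S.Up.r²<s q²<s) ls)
    where
    0≤q² : 0ℚᵘ ≤ q * q
    0≤q² = ℚP.nonNegative⁻¹ (q * q)
      {{ℚP.nonNeg*nonNeg⇒nonNeg q {{nonNegative (ℚP.≮⇒≥ q≮0)}} q {{nonNegative (ℚP.≮⇒≥ q≮0)}}}}
    module S = √-step q s (ℚP.≮⇒≥ q≮0) (ℚP.≤-<-trans 0≤q² q²<s)

  positive-upper : ∀ {q} → 0ℚᵘ < q → Upper x q → ∃[ s ] (0ℚᵘ < s × s < q × Upper x s)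
  positive-upper 0<q u with X.upper-open u
  ... | s , s<q , us with 0ℚᵘ ℚP.<? s
  ...   | yes 0<s = s , 0<s , s<q , us
  ...   | no  0≮s with ℚP.<-dense 0<q
  ...     | v , 0<v , v<q = v , 0<v , v<q , X.upper-closed (ℚP.≤-<-trans (ℚP.≮⇒≥ 0≮s) 0<v) us

  U-open : ∀ {q} → U q → ∃[ r ] (r < q × U r)
  U-open {q} (0<q , u) with positive-upper (square-pos 0<q) u
  ... | s , 0<s , s<q² , us =
      S.r , S.Down.r<q s<q² , S.Down.0<r s<q² , X.upper-closed (S.Down.s<r² s<q²) us
    where module S = √-step q s (ℚP.<⇒≤ 0<q) 0<s

  disj : ∀ {q} → L q → ¬ U q
  disj (inj₁ q<0) (0<q , _) = ℚP.<-asym q<0 0<q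
  disj (inj₂ l)   (_ , u)   = X.disjoint l u

  loc : ∀ {q r} → q < r → L q ⊎ U r
  loc {q} {r} q<r with q ℚP.<? 0ℚᵘ
  ... | yes q<0 = inj₁ (inj₁ q<0)
  ... | no  q≮0 with X.located (square-mono-< (ℚP.≮⇒≥ q≮0) q<r)
  ...   | inj₁ l = inj₁ (inj₂ l)
  ...   | inj₂ u = inj₂ (ℚP.≤-<-trans (ℚP.≮⇒≥ q≮0) q<r , u)

------------------------------------------------------------------------
-- Powers of 2 and logarithms to base 2

-- Comparison of 2 ^ (p / d) with N, after raising both sides to the power d.
2^_<ℕ_ : ℚᵘ → ℕ → Set
2^ mkℚᵘ (+ p)    d <ℕ N = 2 ℕ.^ p ℕ.< N ℕ.^ suc d
2^ mkℚᵘ -[1+ p ] d <ℕ N = 1 ℕ.< N ℕ.^ suc d ℕ.* 2 ℕ.^ suc p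

_<2^_ : ℕ → ℚᵘ → Set
N <2^ mkℚᵘ (+ p)    d = N ℕ.^ suc d ℕ.< 2 ℕ.^ p
N <2^ mkℚᵘ -[1+ p ] d = N ℕ.^ suc d ℕ.* 2 ℕ.^ suc p ℕ.< 1

infix 4 _=2^_

-- N = 2 ^ x for a real exponent x: the rationals below (above) x are exactly
-- those q for which 2 ^ q is below (above) N.
_=2^_ : ℕ → ℝ → Set
N =2^ x = ∀ q → (Lower x q ⇔ 2^ q <ℕ N) × (Upper x q ⇔ N <2^ q)

bernoulli : ∀ a k → a ℕ.^ suc k ℕ.+ suc k ℕ.* a ℕ.^ k ℕ.≤ suc a ℕ.^ suc k
bernoulli a zero    = ℕP.≤-reflexive
  (solve 1 (λ a → a :* con 1 :+ con 1 := (con 1 :+ a) :* con 1) refl a)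
  where open ℕS.+-*-Solver
bernoulli a (suc k) = begin
  a ℕ.* (a ℕ.* b) ℕ.+ suc (suc k) ℕ.* (a ℕ.* b)
    ≤⟨ ℕP.m≤m+n _ (suc k ℕ.* b) ⟩
  a ℕ.* (a ℕ.* b) ℕ.+ suc (suc k) ℕ.* (a ℕ.* b) ℕ.+ suc k ℕ.* b
    ≡⟨ solve 3 (λ a b k → a :* (a :* b) :+ (con 2 :+ k) :* (a :* b) :+ (con 1 :+ k) :* b
                       := (con 1 :+ a) :* (a :* b :+ (con 1 :+ k) :* b)) refl a b k ⟩
  suc a ℕ.* (a ℕ.* b ℕ.+ suc k ℕ.* b)
    ≤⟨ ℕP.*-monoʳ-≤ (suc a) (bernoulli a k) ⟩
  suc a ℕ.* suc a ℕ.^ suc k ∎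
  where
  open ℕS.+-*-Solver
  open ℕP.≤-Reasoning
  b = a ℕ.^ k

amplify : ∀ {a b} → a ℕ.< b → 2 ℕ.* a ℕ.^ suc a ℕ.< b ℕ.^ suc a
amplify {a} {b} a<b = begin-strict
  2 ℕ.* a ℕ.^ suc a
    ≡⟨ cong (a ℕ.^ suc a ℕ.+_) (ℕP.+-identityʳ (a ℕ.^ suc a)) ⟩
  a ℕ.^ suc a ℕ.+ a ℕ.^ suc a
    <⟨ ℕP.+-monoʳ-< (a ℕ.^ suc a) (ℕP.m<n+m (a ℕ.^ suc a) (0<aᵃ a)) ⟩
  a ℕ.^ suc a ℕ.+ suc a ℕ.* a ℕ.^ a
    ≤⟨ bernoulli a a ⟩
  suc a ℕ.^ suc a
    ≤⟨ ℕP.^-monoˡ-≤ (suc a) a<b ⟩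
  b ℕ.^ suc a ∎
  where
  open ℕP.≤-Reasoning
  0<aᵃ : ∀ a → 0 ℕ.< a ℕ.^ a
  0<aᵃ zero    = s≤s z≤n
  0<aᵃ (suc a) = ℕP.m^n>0 (suc a) (suc a)

^-cancel-< : ∀ {a b} k → a ℕ.^ k ℕ.< b ℕ.^ k → a ℕ.< b
^-cancel-< k aᵏ<bᵏ = ℕP.≰⇒> λ b≤a → ℕP.<⇒≱ aᵏ<bᵏ (ℕP.^-monoˡ-≤ k b≤a)

^-swap : ∀ a m n → (a ℕ.^ m) ℕ.^ n ≡ (a ℕ.^ n) ℕ.^ m
^-swap a m n = trans (ℕP.^-*-assoc a m n)
  (trans (cong (a ℕ.^_) (ℕP.*-comm m n)) (sym (ℕP.^-*-assoc a n m)))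

+/+<+/+ : ∀ {p d p′ d′} → mkℚᵘ (+ p) d < mkℚᵘ (+ p′) d′ → p ℕ.* suc d′ ℕ.< p′ ℕ.* suc d
+/+<+/+ {p} {d} {p′} {d′} (*<* lt) = ℤP.drop‿+<+
  (subst₂ ℤ._<_ (sym (ℤP.pos-* p (suc d′))) (sym (ℤP.pos-* p′ (suc d))) lt)

mk+/+< : ∀ {p d p′ d′} → p ℕ.* suc d′ ℕ.< p′ ℕ.* suc d → mkℚᵘ (+ p) d < mkℚᵘ (+ p′) d′
mk+/+< {p} {d} {p′} {d′} lt = *<*
  (subst₂ ℤ._<_ (ℤP.pos-* p (suc d′)) (ℤP.pos-* p′ (suc d)) (+<+ lt))

+/≮-/ : ∀ {p d p′ d′} → ¬ (mkℚᵘ (+ p) d < mkℚᵘ -[1+ p′ ] d′)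
+/≮-/ {p} {d} {p′} {d′} (*<* lt) with subst (ℤ._< _) (sym (ℤP.pos-* p (suc d′))) lt
... | ()

n<2^n : ∀ n → n ℕ.< 2 ℕ.^ n
n<2^n zero    = s≤s z≤n
n<2^n (suc n) = begin-strict
  suc n                     ≤⟨ n<2^n n ⟩
  2 ℕ.^ n                   <⟨ ℕP.m<m+n (2 ℕ.^ n) (ℕP.m^n>0 2 n) ⟩
  2 ℕ.^ n ℕ.+ 2 ℕ.^ n       ≡⟨ cong (2 ℕ.^ n ℕ.+_) (sym (ℕP.+-identityʳ (2 ℕ.^ n))) ⟩
  2 ℕ.* 2 ℕ.^ n             ∎
  where open ℕP.≤-Reasoning

log₂ : (N : ℕ) .{{_ : NonZero N}} → ℝ
log₂ N = record
  { Lower           = 2^_<ℕ N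
  ; Upper           = N <2^_
  ; lower-inhabited = - 1ℚᵘ , 1<neg 0 0
  ; upper-inhabited = mkℚᵘ (+ N) 0 , subst (ℕ._< 2 ℕ.^ N) (sym (ℕP.*-identityʳ N)) (n<2^n N)
  ; lower-closed    = λ {q} {r} → L-closed q r
  ; upper-closed    = λ {q} {r} → U-closed q r
  ; lower-open      = λ {q} → L-open q
  ; upper-open      = λ {q} → U-open q
  ; disjoint        = λ {q} → disj q
  ; located         = λ {q} {r} → loc q r
  }
  where
  open ℕP.≤-Reasoning

  1<neg : ∀ p d → 1 ℕ.< N ℕ.^ suc d ℕ.* 2 ℕ.^ suc p
  1<neg p d = ℕP.*-mono-≤ (ℕP.m^n>0 N (suc d)) (ℕP.^-monoʳ-≤ 2 {1} {suc p} (s≤s z≤n))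

  neg-lower : ∀ {q} → q < 0ℚᵘ → 2^ q <ℕ N
  neg-lower {mkℚᵘ (+ p) d}    lt with +/+<+/+ lt
  ... | ()
  neg-lower {mkℚᵘ -[1+ p ] d} lt = 1<neg p d

  -- (2 ^ p) ^ d′ against (2 ^ p′) ^ d, for p / d < p′ / d′
  2-mono : ∀ {p d p′ d′} → mkℚᵘ (+ p) d < mkℚᵘ (+ p′) d′ →
           (2 ℕ.^ p) ℕ.^ suc d′ ℕ.< (2 ℕ.^ p′) ℕ.^ suc d
  2-mono {p} {d} {p′} {d′} lt = subst₂ ℕ._<_
    (sym (ℕP.^-*-assoc 2 p (suc d′))) (sym (ℕP.^-*-assoc 2 p′ (suc d)))
    (ℕP.^-monoʳ-< 2 (s≤s (s≤s z≤n)) (+/+<+/+ lt))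

  L-closed : ∀ q r → q < r → 2^ r <ℕ N → 2^ q <ℕ N
  L-closed (mkℚᵘ -[1+ p ] d) r _ _ = 1<neg p d
  L-closed (mkℚᵘ (+ p) d) (mkℚᵘ -[1+ _ ] _) lt _ = contradiction lt +/≮-/
  L-closed (mkℚᵘ (+ p) d) (mkℚᵘ (+ p′) d′) lt l = ^-cancel-< (suc d′) (begin-strict
    (2 ℕ.^ p) ℕ.^ suc d′      <⟨ 2-mono lt ⟩
    (2 ℕ.^ p′) ℕ.^ suc d      <⟨ ℕP.^-monoˡ-< (suc d) l ⟩
    (N ℕ.^ suc d′) ℕ.^ suc d  ≡⟨ ^-swap N (suc d′) (suc d) ⟩
    (N ℕ.^ suc d) ℕ.^ suc d′  ∎)

  U-closed′ : ∀ {p d p′ d′} → mkℚᵘ (+ p) d < mkℚᵘ (+ p′) d′ →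
              N ℕ.^ suc d ℕ.≤ 2 ℕ.^ p → N ℕ.^ suc d′ ℕ.< 2 ℕ.^ p′
  U-closed′ {p} {d} {p′} {d′} lt u = ^-cancel-< (suc d) (begin-strict
    (N ℕ.^ suc d′) ℕ.^ suc d  ≡⟨ ^-swap N (suc d′) (suc d) ⟩
    (N ℕ.^ suc d) ℕ.^ suc d′  ≤⟨ ℕP.^-monoˡ-≤ (suc d′) u ⟩
    (2 ℕ.^ p) ℕ.^ suc d′      <⟨ 2-mono lt ⟩
    (2 ℕ.^ p′) ℕ.^ suc d      ∎)

  U-closed : ∀ q r → q < r → N <2^ q → N <2^ r
  U-closed (mkℚᵘ -[1+ p ] d) r _ u = contradiction u (ℕP.<-asym (1<neg p d))
  U-closed (mkℚᵘ (+ p) d) (mkℚᵘ -[1+ _ ] _) lt _ = contradiction lt +/≮-/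
  U-closed (mkℚᵘ (+ p) d) (mkℚᵘ (+ p′) d′) lt u = U-closed′ lt (ℕP.<⇒≤ u)

  L-open : ∀ q → 2^ q <ℕ N → ∃[ r ] (q < r × 2^ r <ℕ N)
  L-open (mkℚᵘ -[1+ p ] d) _ with ℚP.<-dense {mkℚᵘ -[1+ p ] d} {0ℚᵘ} (*<* -<+)
  ... | r , q<r , r<0 = r , q<r , neg-lower r<0
  L-open (mkℚᵘ (+ p) d) l = mkℚᵘ (+ suc (p ℕ.* suc a)) (a ℕ.+ d ℕ.* suc a) , mk+/+< q<r , (begin-strict
    2 ℕ.* 2 ℕ.^ (p ℕ.* suc a)     ≡⟨ cong (2 ℕ.*_) (sym (ℕP.^-*-assoc 2 p (suc a))) ⟩
    2 ℕ.* a ℕ.^ suc a             <⟨ amplify l ⟩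
    (N ℕ.^ suc d) ℕ.^ suc a       ≡⟨ ℕP.^-*-assoc N (suc d) (suc a) ⟩
    N ℕ.^ (suc d ℕ.* suc a)       ∎)
    where
    open ℕS.+-*-Solver
    a = 2 ℕ.^ p
    q<r : p ℕ.* (suc d ℕ.* suc a) ℕ.< suc (p ℕ.* suc a) ℕ.* suc d
    q<r = ℕP.≤-<-trans
      (ℕP.≤-reflexive (solve 3 (λ p d a → p :* (d :* a) := p :* a :* d) refl p (suc d) (suc a)))
      (ℕP.m<n+m (p ℕ.* suc a ℕ.* suc d) (s≤s z≤n))

  U-open : ∀ q → N <2^ q → ∃[ r ] (r < q × N <2^ r)
  U-open (mkℚᵘ -[1+ p ] d) u = contradiction u (ℕP.<-asym (1<neg p d))
  U-open (mkℚᵘ (+ zero) d) u = contradiction u (ℕP.≤⇒≯ (ℕP.m^n>0 N (suc d)))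
  U-open (mkℚᵘ (+ suc p) d) u = mkℚᵘ (+ (a ℕ.+ p ℕ.* suc a)) (a ℕ.+ d ℕ.* suc a) , mk+/+< r<q ,
    ℕP.*-cancelˡ-< 2 _ _ (begin-strict
      2 ℕ.* N ℕ.^ (suc d ℕ.* suc a)   ≡⟨ cong (2 ℕ.*_) (sym (ℕP.^-*-assoc N (suc d) (suc a))) ⟩
      2 ℕ.* a ℕ.^ suc a               <⟨ amplify u ⟩
      (2 ℕ.^ suc p) ℕ.^ suc a         ≡⟨ ℕP.^-*-assoc 2 (suc p) (suc a) ⟩
      2 ℕ.^ (suc p ℕ.* suc a)         ∎)
    where
    open ℕS.+-*-Solver
    a = N ℕ.^ suc d
    r<q : (a ℕ.+ p ℕ.* suc a) ℕ.* suc d ℕ.< suc p ℕ.* (suc d ℕ.* suc a)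
    r<q = ℕP.<-≤-trans
      (ℕP.m<n+m ((a ℕ.+ p ℕ.* suc a) ℕ.* suc d) (s≤s z≤n))
      (ℕP.≤-reflexive (solve 3 (λ p d a → p :* a :* d := p :* (d :* a)) refl (suc p) (suc d) (suc a)))

  disj : ∀ q → 2^ q <ℕ N → ¬ (N <2^ q)
  disj (mkℚᵘ (+ p) d)    = ℕP.<-asym
  disj (mkℚᵘ -[1+ p ] d) = ℕP.<-asym

  loc : ∀ q r → q < r → 2^ q <ℕ N ⊎ N <2^ r
  loc (mkℚᵘ -[1+ p ] d) r _ = inj₁ (1<neg p d)
  loc (mkℚᵘ (+ p) d) (mkℚᵘ -[1+ _ ] _) lt = contradiction lt +/≮-/
  loc (mkℚᵘ (+ p) d) (mkℚᵘ (+ p′) d′) lt with 2 ℕ.^ p ℕP.<? N ℕ.^ suc d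
  ... | yes l = inj₁ l
  ... | no  ≮ = inj₂ (U-closed′ lt (ℕP.≮⇒≥ ≮))

------------------------------------------------------------------------
-- Big-O as n → ∞

infix 4 _=O_

-- |f n| ≤ C g(n) for all large n, with |f n| ≤ y spelt - y ≤ f n ≤ y.
-- The bounding function g need only be defined for n ≥ 1.
_=O_ : (ℕ → ℝ) → ((n : ℕ) .{{_ : NonZero n}} → ℝ) → Set
f =O g = ∃[ C ] ∃[ n₀ ] ∀ n .{{_ : NonZero n}} → n₀ ℕ.≤ n →
           (-ℝ (C · g n) ≤ℝ f n) × (f n ≤ℝ C · g n)

{-# OPTIONS --safe #-}

-- The poset splits into ℓₙ(n) chains, each with one point of weight n.
-- Permuting the coordinates moves this decomposition around; for comparable
-- points x ≺ y with many zeros and ones in y, only a proportion O(1/n) of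
-- the permutations puts x and y into a common chain.  Averaging over the
-- permutations, a set of more than (k + 1) ℓₙ(n) such points contains a point
-- below a constant times k n others, and a set of more than (1 + δ) ℓₙ(n)
-- points one below a constant times δ n others.  Deleting such points one
-- after another bounds the number of antichains: choosing a point of degree
-- Δ for the antichain excludes Δ others, so each deletion costs a factor of
-- 1 + O(log n / Δ) only.  Passing through k = a², a, 1 and δ = 1/a with a of
-- order √(n / log n) gives the bound 2 ^ ((1 + O(1/a)) ℓₙ(n)).

module Submission where

open import Defs
open import Data.Bool.Base using (true; false; if_then_else_)
open import Data.Nat.Base
  using (ℕ; zero; suc; _+_; _*_; _∸_; _^_; _/_; _%_; _≤_; _<_; z≤n; s≤s; s≤s⁻¹; NonZero; >-nonZero; >-nonZero⁻¹)
open import Data.Nat.DivMod using (m≡m%n+[m/n]*n; m%n<n; m/n*n≤m; m/n≤m)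
open import Data.Nat.Properties
open import Data.Nat.Solver using (module +-*-Solver)
import Data.Integer.Base as ℤ
import Data.Integer.Properties as ℤ
open import Data.Rational.Unnormalised.Base as ℚ using (ℚᵘ; mkℚᵘ; 0ℚᵘ; 1ℚᵘ; _≃_; *≡*; *<*; *≤*)
import Data.Rational.Unnormalised.Properties as ℚ
open import Data.Rational.Unnormalised.Solver using () renaming (module +-*-Solver to ℚ-Solver)
open import Data.Fin.Base as Fin using (Fin; zero; suc; toℕ)
import Data.Fin.Properties as Fin
open import Data.Fin.Permutation.Components using (transpose; transpose-inverse)
open import Data.List.Base using (List; []; _∷_; _++_; map; length; filter; allFin; cartesianProductWith; upTo)
open import Data.List.Properties using (length-filter; length-upTo; map-tabulate)
open import Data.List.Membership.Propositional using (_∈_; find; lose)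
open import Data.List.Membership.Propositional.Properties
  using (∈-++⁻; ∈-map⁻; ∈-∃++; ∈-cartesianProductWith⁺; ∈-allFin; ∈-filter⁺; ∈-upTo⁺)
open import Data.List.Relation.Unary.All as All using (All; []; _∷_)
import Data.List.Relation.Unary.All.Properties as All
open import Data.List.Relation.Unary.Any using (here; there; any?)
open import Data.List.Relation.Unary.AllPairs as AllPairs using (AllPairs; []; _∷_; allPairs?)
open import Data.List.Relation.Unary.Unique.Propositional using (Unique)
import Data.List.Relation.Unary.Unique.Propositional.Properties as Unique
open import Data.List.Relation.Binary.Permutation.Propositional as ↭ using (_↭_; ↭-sym)
open import Data.List.Relation.Binary.Permutation.Propositional.Properties using (All-resp-↭; ↭-length; shift)
open import Data.List.Relation.Binary.Sublist.Propositional using (_⊆_; []; _∷_; _∷ʳ_; ⊆-refl)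
open import Data.List.Relation.Binary.Sublist.Propositional.Properties using (All-resp-⊆)
open import Data.Vec.Base as Vec using (Vec; []; _∷_; lookup)
open import Data.Vec.Properties
  using (≡-dec; ∷-injective; lookup-map; lookup∘tabulate; lookup-allFin; map-∘; map-cong; map-id; tabulate∘lookup; tabulate-cong)
open import Data.Vec.Relation.Binary.Pointwise.Inductive as Pointwise using ([]; _∷_)
open import Data.Product using (∃-syntax; _×_; _,_; proj₁; proj₂)
open import Data.Sum using (_⊎_; inj₁; inj₂; [_,_]′)
open import Algebra.Properties.CommutativeSemigroup +-commutativeSemigroup using (interchange)
open import Function.Base using (_∘_; id)
open import Function.Bundles using (mk⇔)
open import Relation.Binary.Definitions using (DecidableEquality; Symmetric)
open import Relation.Binary.PropositionalEquality
  using (_≡_; _≢_; refl; sym; trans; cong; cong₂; subst; subst₂)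
open import Relation.Nullary using (¬_; Dec; yes; no; does; contradiction; _×-dec_; ¬?)
open import Relation.Nullary.Decidable using (decidable-stable; dec-true; dec-false)

-- Call |F| / ℓₙ(n) the density of F. A single pass of deletions would be too expensive: at density
-- k the guaranteed degrees are of order k n, so a deletion costs about log n / (k n) bits, and
-- descending from density 2 n + 1 to 2 with only the degrees guaranteed at the end would cost about
-- ℓₙ(n) log n bits. Hence a pass that ends at density k + 1 starts at density at most 2 a k. It
-- removes O(a k ℓₙ(n)) points at O(1 / (a² k)) bits each, so it costs O(ℓₙ(n) / a) bits whatever k
-- is. Since n < a³, three such passes reach density 2, and a finer one then reaches 1 + O(1/a). The
-- proportion O(1/n) comes from exchanging coordinates, which takes many coordinates where x and y
-- share the value that is raised elsewhere; this is why zeros and ones of y are counted. Points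
-- with few of them are exponentially rare and cost one bit each. The lower bound for ℓₙ(n) comes
-- from the chains themselves, 3ⁿ ≤ (2 n + 1) ℓₙ(n), which is ample against exponential decay. Since
-- all subsets of the middle layer are antichains, the error term is nonnegative and only its upper
-- bound needs this work.

private variable
  A B C : Set
  P Q : Set
  n : ℕ

-- A decomposition into chains that all meet the middle layer

data Step : Set where
  up level down : Step

pattern 0F = Fin.zero
pattern 1F = Fin.suc Fin.zero
pattern 2F = Fin.suc (Fin.suc Fin.zero)

-- x lies on the chain with code c, with l points below it and r above.  A
-- chain p₀ < … < pₗ and a new coordinate form a grid, split into three chains:
--   up:    (0 , p₀) … (0 , pₗ) (1 , pₗ) (2 , pₗ)
--   level: (1 , p₀) … (1 , pₗ₋₁) (2 , pₗ₋₁)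
--   down:  (2 , p₀) … (2 , pₗ₋₂)
data OnChain : ∀ {n} → List Step → ℕ → ℕ → Point n → Set where
  nil : OnChain [] 0 0 []
  up₀ : ∀ {n c l r} {x : Point n} → OnChain c l r x → OnChain (up ∷ c) l (suc (suc r)) (0F ∷ x)
  up₁ : ∀ {n c l} {x : Point n} → OnChain c l 0 x → OnChain (up ∷ c) (suc l) 1 (1F ∷ x)
  up₂ : ∀ {n c l} {x : Point n} → OnChain c l 0 x → OnChain (up ∷ c) (suc (suc l)) 0 (2F ∷ x)
  level₁ : ∀ {n c l r} {x : Point n} → OnChain c l (suc r) x → OnChain (level ∷ c) l (suc r) (1F ∷ x)
  level₂ : ∀ {n c l} {x : Point n} → OnChain c l 1 x → OnChain (level ∷ c) (suc l) 0 (2F ∷ x)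
  down₂ : ∀ {n c l r} {x : Point n} → OnChain c l (suc (suc r)) x → OnChain (down ∷ c) l r (2F ∷ x)

chain-of : ∀ {n} (x : Point n) → ∃[ c ] ∃[ l ] ∃[ r ] OnChain c l r x
chain-of [] = _ , _ , _ , nil
chain-of (a ∷ x) with a | chain-of x
... | 0F | _ , _ , _ , o = _ , _ , _ , up₀ o
... | 1F | _ , _ , zero , o = _ , _ , _ , up₁ o
... | 1F | _ , _ , suc _ , o = _ , _ , _ , level₁ o
... | 2F | _ , _ , zero , o = _ , _ , _ , up₂ o
... | 2F | _ , _ , suc zero , o = _ , _ , _ , level₂ o
... | 2F | _ , _ , suc (suc _) , o = _ , _ , _ , down₂ o

-- Constructors with the same new coordinate require different values of `r` for the tail: zero or
-- positive for the coordinate 1; zero, one or at least two for the coordinate 2. This refutes the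
-- mixed cases and makes the chains disjoint.
chain-unique : ∀ {n c l r c′ l′ r′} {x : Point n} →
               OnChain c l r x → OnChain c′ l′ r′ x → (c , l , r) ≡ (c′ , l′ , r′)
chain-unique nil nil = refl
chain-unique (up₀ o) (up₀ o′) with refl ← chain-unique o o′ = refl
chain-unique (up₁ o) (up₁ o′) with refl ← chain-unique o o′ = refl
chain-unique (up₂ o) (up₂ o′) with refl ← chain-unique o o′ = refl
chain-unique (level₁ o) (level₁ o′) with refl ← chain-unique o o′ = refl
chain-unique (level₂ o) (level₂ o′) with refl ← chain-unique o o′ = refl
chain-unique (down₂ o) (down₂ o′) with refl ← chain-unique o o′ = refl
chain-unique (up₁ o) (level₁ o′) with () ← chain-unique o o′
chain-unique (level₁ o) (up₁ o′) with () ← chain-unique o o′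
chain-unique (up₂ o) (level₂ o′) with () ← chain-unique o o′
chain-unique (up₂ o) (down₂ o′) with () ← chain-unique o o′
chain-unique (level₂ o) (up₂ o′) with () ← chain-unique o o′
chain-unique (level₂ o) (down₂ o′) with () ← chain-unique o o′
chain-unique (down₂ o) (up₂ o′) with () ← chain-unique o o′
chain-unique (down₂ o) (level₂ o′) with () ← chain-unique o o′

-- Symmetry of the chain about weight `n`, without subtraction: weights rise by one along a chain,
-- so its ends have weights `weight x - l` and `weight x + r`, and these add up to `2 n`.
weight-position : ∀ {n c l r} {x : Point n} → OnChain c l r x → weight x + weight x + r ≡ n + n + l
weight-position nil = refl
weight-position (up₀ {n} {l = l} {r} {x} o) = begin-equality
  weight x + weight x + (2 + r)
    ≡⟨ solve 2 (λ w r → w :+ w :+ (con 2 :+ r) := con 2 :+ (w :+ w :+ r)) refl (weight x) r ⟩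
  2 + (weight x + weight x + r)
    ≡⟨ cong (2 +_) (weight-position o) ⟩
  2 + (n + n + l)
    ≡⟨ solve 2 (λ n l → con 2 :+ (n :+ n :+ l) := con 1 :+ n :+ (con 1 :+ n) :+ l) refl n l ⟩
  suc n + suc n + l ∎
  where
  open +-*-Solver using (solve; _:=_; _:+_; _:*_; _:^_; con)
  open ≤-Reasoning
weight-position (up₁ {n} {l = l} {x} o) = begin-equality
  suc (weight x) + suc (weight x) + 1
    ≡⟨ solve 1 (λ w → con 1 :+ w :+ (con 1 :+ w) :+ con 1 := con 3 :+ (w :+ w :+ con 0)) refl (weight x) ⟩
  3 + (weight x + weight x + 0)
    ≡⟨ cong (3 +_) (weight-position o) ⟩
  3 + (n + n + l)
    ≡⟨ solve 2 (λ n l → con 3 :+ (n :+ n :+ l) := con 1 :+ n :+ (con 1 :+ n) :+ (con 1 :+ l)) refl n l ⟩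
  suc n + suc n + suc l ∎
  where
  open +-*-Solver using (solve; _:=_; _:+_; _:*_; _:^_; con)
  open ≤-Reasoning
weight-position (up₂ {n} {l = l} {x} o) = begin-equality
  2 + weight x + (2 + weight x) + 0
    ≡⟨ solve 1 (λ w → con 2 :+ w :+ (con 2 :+ w) :+ con 0 := con 4 :+ (w :+ w :+ con 0)) refl (weight x) ⟩
  4 + (weight x + weight x + 0)
    ≡⟨ cong (4 +_) (weight-position o) ⟩
  4 + (n + n + l)
    ≡⟨ solve 2 (λ n l → con 4 :+ (n :+ n :+ l) := con 1 :+ n :+ (con 1 :+ n) :+ (con 2 :+ l)) refl n l ⟩
  suc n + suc n + (2 + l) ∎
  where
  open +-*-Solver using (solve; _:=_; _:+_; _:*_; _:^_; con)
  open ≤-Reasoning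
weight-position (level₁ {n} {l = l} {r} {x} o) = begin-equality
  suc (weight x) + suc (weight x) + suc r
    ≡⟨ solve 2 (λ w r → con 1 :+ w :+ (con 1 :+ w) :+ r := con 2 :+ (w :+ w :+ r)) refl (weight x) (suc r) ⟩
  2 + (weight x + weight x + suc r)
    ≡⟨ cong (2 +_) (weight-position o) ⟩
  2 + (n + n + l)
    ≡⟨ solve 2 (λ n l → con 2 :+ (n :+ n :+ l) := con 1 :+ n :+ (con 1 :+ n) :+ l) refl n l ⟩
  suc n + suc n + l ∎
  where
  open +-*-Solver using (solve; _:=_; _:+_; _:*_; _:^_; con)
  open ≤-Reasoning
weight-position (level₂ {n} {l = l} {x} o) = begin-equality
  2 + weight x + (2 + weight x) + 0
    ≡⟨ solve 1 (λ w → con 2 :+ w :+ (con 2 :+ w) :+ con 0 := con 3 :+ (w :+ w :+ con 1)) refl (weight x) ⟩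
  3 + (weight x + weight x + 1)
    ≡⟨ cong (3 +_) (weight-position o) ⟩
  3 + (n + n + l)
    ≡⟨ solve 2 (λ n l → con 3 :+ (n :+ n :+ l) := con 1 :+ n :+ (con 1 :+ n) :+ (con 1 :+ l)) refl n l ⟩
  suc n + suc n + suc l ∎
  where
  open +-*-Solver using (solve; _:=_; _:+_; _:*_; _:^_; con)
  open ≤-Reasoning
weight-position (down₂ {n} {l = l} {r} {x} o) = begin-equality
  2 + weight x + (2 + weight x) + r
    ≡⟨ solve 2 (λ w r → con 2 :+ w :+ (con 2 :+ w) :+ r := con 2 :+ (w :+ w :+ (con 2 :+ r))) refl (weight x) r ⟩
  2 + (weight x + weight x + (2 + r))
    ≡⟨ cong (2 +_) (weight-position o) ⟩
  2 + (n + n + l)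
    ≡⟨ solve 2 (λ n l → con 2 :+ (n :+ n :+ l) := con 1 :+ n :+ (con 1 :+ n) :+ l) refl n l ⟩
  suc n + suc n + l ∎
  where
  open +-*-Solver using (solve; _:=_; _:+_; _:*_; _:^_; con)
  open ≤-Reasoning

chain-mono : ∀ {n c l r l′ r′} {x y : Point n} →
             OnChain c l r x → OnChain c l′ r′ y → r′ ≤ r → x ≼ y
chain-mono nil nil _ = []
chain-mono (up₀ o) (up₀ o′) (s≤s (s≤s r′≤r)) = z≤n ∷ chain-mono o o′ r′≤r
chain-mono (up₀ o) (up₁ o′) _ = z≤n ∷ chain-mono o o′ z≤n
chain-mono (up₀ o) (up₂ o′) _ = z≤n ∷ chain-mono o o′ z≤n
chain-mono (up₁ o) (up₀ o′) (s≤s ())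
chain-mono (up₁ o) (up₁ o′) _ = s≤s z≤n ∷ chain-mono o o′ z≤n
chain-mono (up₁ o) (up₂ o′) _ = s≤s z≤n ∷ chain-mono o o′ z≤n
chain-mono (up₂ o) (up₀ o′) ()
chain-mono (up₂ o) (up₁ o′) ()
chain-mono (up₂ o) (up₂ o′) _ = s≤s (s≤s z≤n) ∷ chain-mono o o′ z≤n
chain-mono (level₁ o) (level₁ o′) r′≤r = s≤s z≤n ∷ chain-mono o o′ r′≤r
chain-mono (level₁ o) (level₂ o′) _ = s≤s z≤n ∷ chain-mono o o′ (s≤s z≤n)
chain-mono (level₂ o) (level₁ o′) ()
chain-mono (level₂ o) (level₂ o′) _ = s≤s (s≤s z≤n) ∷ chain-mono o o′ (s≤s z≤n)
chain-mono (down₂ o) (down₂ o′) r′≤r = s≤s (s≤s z≤n) ∷ chain-mono o o′ (s≤s (s≤s r′≤r))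

step-up : ∀ {n c l r} {x : Point n} → OnChain c l (suc r) x → ∃[ y ] OnChain {n} c (suc l) r y
step-up (up₀ {r = zero} o) = _ , up₁ o
step-up (up₀ {r = suc r} o) = _ , up₀ (proj₂ (step-up o))
step-up (up₁ o) = _ , up₂ o
step-up (level₁ {r = zero} o) = _ , level₂ o
step-up (level₁ {r = suc r} o) = _ , level₁ (proj₂ (step-up o))
step-up (down₂ o) = _ , down₂ (proj₂ (step-up o))

step-down : ∀ {n c l r} {x : Point n} → OnChain c (suc l) r x → ∃[ y ] OnChain {n} c l (suc r) y
step-down (up₀ o) = _ , up₀ (proj₂ (step-down o))
step-down (up₁ o) = _ , up₀ o
step-down (up₂ o) = _ , up₁ o
step-down (level₁ o) = _ , level₁ (proj₂ (step-down o))
step-down (level₂ o) = _ , level₁ o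
step-down (down₂ o) = _ , down₂ (proj₂ (step-down o))

bottom : ∀ {n c} l {r} {x : Point n} → OnChain c l r x → ∃[ y ] OnChain {n} c 0 (l + r) y
bottom zero o = _ , o
bottom {c = c} (suc l) {r} o with bottom l (proj₂ (step-down o))
... | y , o′ = y , subst (λ k → OnChain c 0 k y) (+-suc l r) o′

climb : ∀ {n c l} k {r} {x : Point n} → OnChain c l (k + r) x → ∃[ y ] OnChain {n} c (k + l) r y
climb zero o = _ , o
climb {c = c} {l} (suc k) {r} o with climb k (proj₂ (step-up o))
... | y , o′ = y , subst (λ j → OnChain c j r y) (+-suc k l) o′

-- Symmetry forces an odd number of points, hence a central one. The truncated subtraction in `h` is
-- exact by `w≤n+l`.
halve : ∀ {n c l r} {x : Point n} → OnChain c l r x → ∃[ h ] l + r ≡ h + h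
halve {n} {c} {l} {r} {x} o = h , +-cancelʳ-≡ (w + w) (l + r) (h + h) (begin-equality
  l + r + (w + w)         ≡⟨ solve 3 (λ l r w → l :+ r :+ (w :+ w) := l :+ (w :+ w :+ r)) refl l r w ⟩
  l + (w + w + r)         ≡⟨ cong (l +_) (weight-position o) ⟩
  l + (n + n + l)         ≡⟨ solve 2 (λ l n → l :+ (n :+ n :+ l) := n :+ l :+ (n :+ l)) refl l n ⟩
  n + l + (n + l)         ≡⟨ cong₂ _+_ h+w h+w ⟨
  h + w + (h + w)         ≡⟨ solve 2 (λ h w → h :+ w :+ (h :+ w) := h :+ h :+ (w :+ w)) refl h w ⟩
  h + h + (w + w)         ∎)
  where
  open +-*-Solver using (solve; _:=_; _:+_; _:*_; _:^_; con)
  open ≤-Reasoning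
  w = weight x
  h = (n + l) ∸ w
  w≤n+l : w ≤ n + l
  w≤n+l = ≮⇒≥ λ n+l<w → <⇒≱ (+-mono-< n+l<w n+l<w) (begin
    w + w             ≤⟨ m≤m+n (w + w) r ⟩
    w + w + r         ≡⟨ weight-position o ⟩
    n + n + l         ≤⟨ m≤m+n (n + n + l) l ⟩
    n + n + l + l     ≡⟨ solve 2 (λ n l → n :+ n :+ l :+ l := n :+ l :+ (n :+ l)) refl n l ⟩
    n + l + (n + l)   ∎)
  h+w : h + w ≡ n + l
  h+w = m∸n+n≡m w≤n+l

centre : ∀ {n c l r} {x : Point n} → OnChain c l r x → ∃[ h ] ∃[ y ] OnChain {n} c h h y
centre {c = c} {l} o with halve o | bottom l o
... | h , eq | y , o′ with climb h {h} (subst (λ k → OnChain c 0 k y) eq o′)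
...   | z , o″ = h , z , subst (λ k → OnChain c k h z) (+-identityʳ h) o″

record Central {n} (x : Point n) : Set where
  field
    {chain}        : List Step
    {half l r}     : ℕ
    point          : Point n
    point-on-chain : OnChain chain half half point
    x-on-chain     : OnChain chain l r x

central : ∀ {n} (x : Point n) → Central x
central x = from (chain-of x)
  where
  from : ∃[ c ] ∃[ l ] ∃[ r ] OnChain c l r x → Central x
  from (_ , _ , _ , o) = record 
    { point          = proj₁ (proj₂ (centre o))
    ; point-on-chain = proj₂ (proj₂ (centre o))
    ; x-on-chain     = o
    }

weight-centre : ∀ {n c h} {y : Point n} → OnChain c h h y → weight y ≡ n
weight-centre {h = h} o = double-injective (+-cancelʳ-≡ h _ _ (weight-position o))
  where
  double-injective : ∀ {a b} → a + a ≡ b + b → a ≡ b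
  double-injective {zero} {zero} _ = refl
  double-injective {suc a} {suc b} eq = cong suc (double-injective
    (suc-injective (trans (sym (+-suc a a)) (trans (suc-injective eq) (+-suc b b)))))

same-chain : ∀ {n c c′ h h′ l l′ r r′} {x y m m′ : Point n} → OnChain c h h m → OnChain c l r x →
             OnChain c′ h′ h′ m′ → OnChain c′ l′ r′ y → m ≡ m′ → x ≼ y ⊎ y ≼ x
same-chain {r = r} {r′} m x m′ y refl with refl ← chain-unique m m′ with ≤-total r′ r
... | inj₁ r′≤r = inj₁ (chain-mono x y r′≤r)
... | inj₂ r≤r′ = inj₂ (chain-mono y x r≤r′)

abstract
  -- The central point serves as the name of the chain through `x`, so the chains are indexed by the
  -- middle layer. Everything later rests on the two properties that follow.
  mid : ∀ {n} → Point n → Point n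
  mid x = Central.point (central x)

  weight-mid : ∀ {n} (x : Point n) → weight (mid x) ≡ n
  weight-mid x = weight-centre (Central.point-on-chain (central x))

  mid-comparable : ∀ {n} (x y : Point n) → mid x ≡ mid y → x ≼ y ⊎ y ≼ x
  mid-comparable x y = same-chain (Central.point-on-chain (central x)) (Central.x-on-chain (central x))
                                  (Central.point-on-chain (central y)) (Central.x-on-chain (central y))

-- Finite sums and the middle layer

𝟙[_] : Dec P → ℕ
𝟙[ p ] = if does p then 1 else 0

𝟙-true : (p : Dec P) → P → 𝟙[ p ] ≡ 1
𝟙-true (yes _) _ = refl
𝟙-true (no ¬p) p = contradiction p ¬p

𝟙-false : (p : Dec P) → ¬ P → 𝟙[ p ] ≡ 0
𝟙-false (yes p) ¬p = contradiction p ¬p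
𝟙-false (no _) _ = refl

𝟙≤1 : (p : Dec P) → 𝟙[ p ] ≤ 1
𝟙≤1 (yes _) = ≤-refl
𝟙≤1 (no _) = z≤n

𝟙-mono : (p : Dec P) (q : Dec Q) → (P → Q) → 𝟙[ p ] ≤ 𝟙[ q ]
𝟙-mono (yes p) q f = ≤-reflexive (sym (𝟙-true q (f p)))
𝟙-mono (no _) q f = z≤n

𝟙-× : (p : Dec P) (q : Dec Q) → 𝟙[ p ] * 𝟙[ q ] ≡ 𝟙[ p ×-dec q ]
𝟙-× (yes p) (yes q) = refl
𝟙-× (yes p) (no ¬q) = refl
𝟙-× (no ¬p) q = refl

𝟙-*-mono : ∀ (p : Dec P) {a b} → (P → a ≤ b) → 𝟙[ p ] * a ≤ 𝟙[ p ] * b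
𝟙-*-mono (yes p) f = *-monoʳ-≤ 1 (f p)
𝟙-*-mono (no _)  f = z≤n

∑ : List A → (A → ℕ) → ℕ
∑ []       f = 0
∑ (x ∷ xs) f = f x + ∑ xs f

syntax ∑ xs (λ x → e) = ∑[ x ∈ xs ] e

∑-mono-∈ : ∀ (xs : List A) {f g : A → ℕ} → (∀ {x} → x ∈ xs → f x ≤ g x) → ∑ xs f ≤ ∑ xs g
∑-mono-∈ []       h = z≤n
∑-mono-∈ (x ∷ xs) h = +-mono-≤ (h (here refl)) (∑-mono-∈ xs λ i → h (there i))

∑-mono : ∀ (xs : List A) {f g : A → ℕ} → (∀ x → f x ≤ g x) → ∑ xs f ≤ ∑ xs g
∑-mono xs h = ∑-mono-∈ xs λ {x} _ → h x

∑-cong : ∀ (xs : List A) {f g : A → ℕ} → (∀ x → f x ≡ g x) → ∑ xs f ≡ ∑ xs g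
∑-cong []       h = refl
∑-cong (x ∷ xs) h = cong₂ _+_ (h x) (∑-cong xs h)

∑-+ : ∀ (xs : List A) (f g : A → ℕ) → ∑[ x ∈ xs ] (f x + g x) ≡ ∑ xs f + ∑ xs g
∑-+ []       f g = refl
∑-+ (x ∷ xs) f g = trans (cong (f x + g x +_) (∑-+ xs f g)) (interchange (f x) (g x) _ _)

∑-*ˡ : ∀ c (xs : List A) (f : A → ℕ) → ∑[ x ∈ xs ] (c * f x) ≡ c * ∑ xs f
∑-*ˡ c []       f = sym (*-zeroʳ c)
∑-*ˡ c (x ∷ xs) f = trans (cong (c * f x +_) (∑-*ˡ c xs f)) (sym (*-distribˡ-+ c (f x) _))

∑-*ʳ : ∀ (xs : List A) (f : A → ℕ) c → ∑[ x ∈ xs ] (f x * c) ≡ ∑ xs f * c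
∑-*ʳ xs f c = trans (∑-cong xs λ x → *-comm (f x) c) (trans (∑-*ˡ c xs f) (*-comm c _))

∑-const : ∀ (xs : List A) c → ∑[ x ∈ xs ] c ≡ length xs * c
∑-const []       c = refl
∑-const (x ∷ xs) c = cong (c +_) (∑-const xs c)

∑-swap : ∀ (xs : List A) (ys : List B) (f : A → B → ℕ) →
         ∑[ x ∈ xs ] ∑[ y ∈ ys ] f x y ≡ ∑[ y ∈ ys ] ∑[ x ∈ xs ] f x y
∑-swap []       ys f = sym (trans (∑-const ys 0) (*-zeroʳ (length ys)))
∑-swap (x ∷ xs) ys f = trans (cong (∑ ys (f x) +_) (∑-swap xs ys f)) (sym (∑-+ ys (f x) _))

∑-map : ∀ (g : A → B) (xs : List A) (f : B → ℕ) → ∑ (map g xs) f ≡ ∑[ x ∈ xs ] f (g x)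
∑-map g []       f = refl
∑-map g (x ∷ xs) f = cong (f (g x) +_) (∑-map g xs f)

length-filter-∑ : ∀ {P : A → Set} (P? : ∀ x → Dec (P x)) xs → length (filter P? xs) ≡ ∑[ x ∈ xs ] 𝟙[ P? x ]
length-filter-∑ P? []       = refl
length-filter-∑ P? (x ∷ xs) with does (P? x)
... | true  = cong suc (length-filter-∑ P? xs)
... | false = length-filter-∑ P? xs

∈⇒≤∑ : ∀ {xs : List A} {x} (f : A → ℕ) → x ∈ xs → f x ≤ ∑ xs f
∈⇒≤∑ f (here refl) = m≤m+n _ _
∈⇒≤∑ f (there i)   = ≤-trans (∈⇒≤∑ f i) (m≤n+m _ _)

∑-zero : ∀ (xs : List A) {f : A → ℕ} → (∀ {x} → x ∈ xs → f x ≡ 0) → ∑ xs f ≡ 0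
∑-zero []       h = refl
∑-zero (x ∷ xs) h = cong₂ _+_ (h (here refl)) (∑-zero xs λ i → h (there i))

∑-exclusive : ∀ {xs : List A} {P : A → Set} (P? : ∀ x → Dec (P x)) → Unique xs →
              (∀ {x y} → x ∈ xs → y ∈ xs → P x → P y → x ≡ y) → ∑[ x ∈ xs ] 𝟙[ P? x ] ≤ 1
∑-exclusive P? [] excl = z≤n
∑-exclusive {xs = x ∷ xs} P? (x∉ ∷ u) excl with P? x
... | no _  = ∑-exclusive P? u λ i j → excl (there i) (there j)
... | yes p = s≤s (≤-reflexive (∑-zero xs λ {y} i →
                𝟙-false (P? y) λ q → All.lookup x∉ i (excl (here refl) (there i) p q)))

∑-δ : (_≟_ : DecidableEquality A) → ∀ {xs : List A} {c} → Unique xs → c ∈ xs → ∑[ x ∈ xs ] 𝟙[ c ≟ x ] ≡ 1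
∑-δ _≟_ {c = c} u i = ≤-antisym (∑-exclusive (c ≟_) u λ _ _ p q → trans (sym p) q)
  (≤-trans (≤-reflexive (sym (𝟙-true (c ≟ c) refl))) (∈⇒≤∑ (λ x → 𝟙[ c ≟ x ]) i))

-- Double counting of the pairs with `σ x ≡ y`, a symmetric relation because `σ` is an involution.
-- Transpositions of coordinates are the intended case.
∑-involution : DecidableEquality A → ∀ {xs : List A} → Unique xs → (∀ x → x ∈ xs) →
               (σ : A → A) → (∀ x → σ (σ x) ≡ x) → ∀ f → ∑[ x ∈ xs ] f (σ x) ≡ ∑ xs f
∑-involution _≟_ {xs} u complete σ σσ f = begin-equality
  ∑[ x ∈ xs ] f (σ x)
    ≡⟨ (∑-cong xs λ x → sym (trans (cong (_* f (σ x)) (∑-δ _≟_ u (complete (σ x)))) (*-identityˡ _))) ⟩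
  ∑[ x ∈ xs ] (∑[ y ∈ xs ] 𝟙[ σ x ≟ y ] * f (σ x))
    ≡⟨ (∑-cong xs λ x → trans (sym (∑-*ʳ xs (λ y → 𝟙[ σ x ≟ y ]) (f (σ x)))) (∑-cong xs (flip-δ x))) ⟩
  ∑[ x ∈ xs ] ∑[ y ∈ xs ] (𝟙[ σ y ≟ x ] * f y)
    ≡⟨ ∑-swap xs xs (λ x y → 𝟙[ σ y ≟ x ] * f y) ⟩
  ∑[ y ∈ xs ] ∑[ x ∈ xs ] (𝟙[ σ y ≟ x ] * f y)
    ≡⟨ (∑-cong xs λ y → trans (∑-*ʳ xs (λ x → 𝟙[ σ y ≟ x ]) (f y))
         (trans (cong (_* f y) (∑-δ _≟_ u (complete (σ y)))) (*-identityˡ _))) ⟩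
  ∑ xs f ∎
  where
  open ≤-Reasoning
  flip-δ : ∀ x y → 𝟙[ σ x ≟ y ] * f (σ x) ≡ 𝟙[ σ y ≟ x ] * f y
  flip-δ x y with σ x ≟ y | σ y ≟ x
  ... | yes refl | yes _ = refl
  ... | yes refl | no ≢  = contradiction (σσ x) ≢
  ... | no ≢ | yes refl  = contradiction (σσ y) ≢
  ... | no _ | no _      = refl

-- The list of all points and its middle layer.

tuples : ∀ k n → List (Vec (Fin k) n)
tuples k zero    = [] ∷ []
tuples k (suc n) = cartesianProductWith _∷_ (allFin k) (tuples k n)

tuples-complete : ∀ {k n} (x : Vec (Fin k) n) → x ∈ tuples k n
tuples-complete []      = here refl
tuples-complete (a ∷ x) = ∈-cartesianProductWith⁺ _∷_ (∈-allFin a) (tuples-complete x)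

tuples-unique : ∀ k n → Unique (tuples k n)
tuples-unique k zero    = [] ∷ []
tuples-unique k (suc n) = Unique.cartesianProductWith⁺ _∷_ ∷-injective (Unique.allFin⁺ k) (tuples-unique k n)

points≡tuples : ∀ n → points n ≡ tuples 3 n
points≡tuples zero    = refl
points≡tuples (suc n) = cong (cartesianProductWith _∷_ (allFin 3)) (points≡tuples n)

points-complete : ∀ {n} (x : Point n) → x ∈ points n
points-complete {n} x = subst (x ∈_) (sym (points≡tuples n)) (tuples-complete x)

points-unique : ∀ n → Unique (points n)
points-unique n = subst Unique (sym (points≡tuples n)) (tuples-unique 3 n)

infix 4 _≟ᵖ_
_≟ᵖ_ : ∀ {k n} → DecidableEquality (Vec (Fin k) n)
_≟ᵖ_ = ≡-dec Fin._≟_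

middle-layer : ∀ n → List (Point n)
middle-layer n = filter (λ x → weight x ≟ n) (points n)

mid∈middle-layer : ∀ {n} (x : Point n) → mid x ∈ middle-layer n
mid∈middle-layer x = ∈-filter⁺ _ (points-complete (mid x)) (weight-mid x)

middle-layer-unique : ∀ n → Unique (middle-layer n)
middle-layer-unique n = Unique.filter⁺ _ (points-unique n)

weight-≤ : ∀ {n} (x : Point n) → weight x ≤ n + n
weight-≤ []      = z≤n
weight-≤ {suc n} (a ∷ x) = begin
  toℕ a + weight x ≤⟨ +-mono-≤ (s≤s⁻¹ (Fin.toℕ<n a)) (weight-≤ x) ⟩
  2 + (n + n)      ≡⟨ cong suc (+-suc n n) ⟨
  suc n + suc n    ∎
  where open ≤-Reasoning

weight-mono : ∀ {n} {x y : Point n} → x ≼ y → weight x ≤ weight y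
weight-mono []      = z≤n
weight-mono (p ∷ q) = +-mono-≤ p (weight-mono q)

weight-strict : ∀ {n} {x y : Point n} → x ≼ y → weight x ≡ weight y → x ≡ y
weight-strict [] _ = refl
weight-strict {x = a ∷ x} {b ∷ y} (p ∷ q) eq = cong₂ _∷_
  (Fin.toℕ-injective (≤-antisym p (+-cancelʳ-≤ (weight y) (toℕ b) (toℕ a)
    (≤-trans (≤-reflexive (sym eq)) (+-monoʳ-≤ (toℕ a) (weight-mono q))))))
  (weight-strict q (≤-antisym (weight-mono q) (+-cancelˡ-≤ (toℕ b) (weight y) (weight x)
    (≤-trans (≤-reflexive (sym eq)) (+-monoˡ-≤ (weight x) p)))))

mid-weight-injective : ∀ {n} {x y : Point n} → mid x ≡ mid y → weight x ≡ weight y → x ≡ y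
mid-weight-injective {x = x} {y} m≡ w≡ with mid-comparable x y m≡
... | inj₁ x≼y = weight-strict x≼y w≡
... | inj₂ y≼x = sym (weight-strict y≼x (sym w≡))

-- A point is determined by its chain and its weight, and there are at most `ℓ n n` chains and
-- `2 n + 1` weights. Read backwards, this is the lower bound `3 ^ n / (2 n + 1)` for `ℓ n n`.
length-points : ∀ n → length (points n) ≤ suc (n + n) * ℓ n n
length-points n = begin
  length (points n)
    ≡⟨ trans (∑-const (points n) 1) (*-identityʳ _) ⟨
  ∑[ x ∈ points n ] 1
    ≤⟨ ∑-mono (points n) (λ x → ≤-trans (≤-reflexive (sym (𝟙-true (cell? x (mid x) (weight x)) (refl , refl))))
         (≤-trans (∈⇒≤∑ (λ w → 𝟙[ cell? x (mid x) w ]) (∈-upTo⁺ (s≤s (weight-≤ x))))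
           (∈⇒≤∑ (λ c → ∑[ w ∈ upTo (suc (n + n)) ] 𝟙[ cell? x c w ]) (mid∈middle-layer x)))) ⟩
  ∑[ x ∈ points n ] ∑[ c ∈ middle-layer n ] ∑[ w ∈ upTo (suc (n + n)) ] 𝟙[ cell? x c w ]
    ≡⟨ ∑-swap (points n) (middle-layer n) _ ⟩
  ∑[ c ∈ middle-layer n ] ∑[ x ∈ points n ] ∑[ w ∈ upTo (suc (n + n)) ] 𝟙[ cell? x c w ]
    ≡⟨ (∑-cong (middle-layer n) λ c → ∑-swap (points n) (upTo (suc (n + n))) _) ⟩
  ∑[ c ∈ middle-layer n ] ∑[ w ∈ upTo (suc (n + n)) ] ∑[ x ∈ points n ] 𝟙[ cell? x c w ]
    ≤⟨ (∑-mono (middle-layer n) λ c → ∑-mono (upTo (suc (n + n))) λ w →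
         ∑-exclusive (λ x → cell? x c w) (points-unique n) λ _ _ (m , v) (m′ , v′) →
           mid-weight-injective (trans m (sym m′)) (trans v (sym v′))) ⟩
  ∑[ c ∈ middle-layer n ] ∑[ w ∈ upTo (suc (n + n)) ] 1
    ≡⟨ ∑-const (middle-layer n) _ ⟩
  ℓ n n * (∑[ w ∈ upTo (suc (n + n)) ] 1)
    ≡⟨ cong (ℓ n n *_) (trans (∑-const (upTo (suc (n + n))) 1) (trans (*-identityʳ _) (length-upTo (suc (n + n))))) ⟩
  ℓ n n * suc (n + n)
    ≡⟨ *-comm (ℓ n n) _ ⟩
  suc (n + n) * ℓ n n ∎
  where
  open ≤-Reasoning
  cell? : ∀ x c w → Dec (mid x ≡ c × weight x ≡ w)
  cell? x c w = (mid x ≟ᵖ c) ×-dec (weight x ≟ w)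

-- Supersaturation

infixl 8 _⟨_⟩

_⟨_⟩ : ∀ {m} → Vec A n → Vec (Fin n) m → Vec A m
x ⟨ g ⟩ = Vec.map (lookup x) g

permute : (Fin n → Fin n) → Vec A n → Vec A n
permute τ x = Vec.tabulate (lookup x ∘ τ)

permute-⟨⟩ : ∀ {m} (τ : Fin n → Fin n) (x : Vec A n) (g : Vec (Fin n) m) →
             permute τ x ⟨ g ⟩ ≡ x ⟨ Vec.map τ g ⟩
permute-⟨⟩ τ x g = trans (map-cong (lookup∘tabulate (lookup x ∘ τ)) g) (map-∘ (lookup x) τ g)

-- Onto vectors are the permutations of the coordinates.
Onto : Vec (Fin n) n → Set
Onto g = ∀ i → ∃[ j ] lookup g j ≡ i

onto? : (g : Vec (Fin n) n) → Dec (Onto g)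
onto? g = Fin.all? λ i → Fin.any? λ j → lookup g j Fin.≟ i

onto-map : (τ : Fin n → Fin n) → (∀ i → τ (τ i) ≡ i) → (g : Vec (Fin n) n) → Onto g → Onto (Vec.map τ g)
onto-map τ ττ g onto i with onto (τ i)
... | j , eq = j , trans (lookup-map j τ g) (trans (cong τ eq) (ττ i))

≼-intro : {x y : Point n} → (∀ i → lookup x i Fin.≤ lookup y i) → x ≼ y
≼-intro {x = []}    {[]}    h = []
≼-intro {x = _ ∷ _} {_ ∷ _} h = h zero ∷ ≼-intro (λ i → h (suc i))

≼-⟨⟩⁻ : {x y : Point n} {g : Vec (Fin n) n} → Onto g → x ⟨ g ⟩ ≼ y ⟨ g ⟩ → x ≼ y
≼-⟨⟩⁻ {x = x} {y} {g} onto x≼y = ≼-intro λ i → let j , eq = onto i in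
  subst (λ i → lookup x i Fin.≤ lookup y i) eq
    (subst₂ Fin._≤_ (lookup-map j (lookup x) g) (lookup-map j (lookup y) g) (Pointwise.lookup x≼y j))

-- This is n factorial. It normalises the averages over permutations and cancels in the end, so its
-- positivity is what matters.
#onto : ℕ → ℕ
#onto n = ∑[ g ∈ tuples n n ] 𝟙[ onto? g ]

0<#onto : ∀ n → 0 < #onto n
0<#onto n = ≤-trans (≤-reflexive (sym (𝟙-true (onto? (Vec.allFin n)) λ i → i , lookup-allFin i)))
  (∈⇒≤∑ (λ g → 𝟙[ onto? g ]) (tuples-complete (Vec.allFin n)))

-- Each permutation `g` transports the fixed decomposition to another one; the relation is that of
-- sharing a chain of the transported decomposition.
SameChain : Vec (Fin n) n → Point n → Point n → Set
SameChain g x y = Onto g × mid (x ⟨ g ⟩) ≡ mid (y ⟨ g ⟩)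

sameChain? : ∀ g (x y : Point n) → Dec (SameChain g x y)
sameChain? g x y = onto? g ×-dec (mid (x ⟨ g ⟩) ≟ᵖ mid (y ⟨ g ⟩))

sameChain-comparable : ∀ g (x y : Point n) → SameChain g x y → x ≼ y ⊎ y ≼ x
sameChain-comparable g x y (onto , eq) with mid-comparable (x ⟨ g ⟩) (y ⟨ g ⟩) eq
... | inj₁ p = inj₁ (≼-⟨⟩⁻ onto p)
... | inj₂ p = inj₂ (≼-⟨⟩⁻ onto p)

agree : Point n → Point n → ℕ
agree {n} x y = ∑[ g ∈ tuples n n ] 𝟙[ sameChain? g x y ]

-- Composition with `τ` permutes the coordinate permutations, so reindexing the sum moves `τ` from
-- `g` to the points.
agree-permute : (τ : Fin n → Fin n) → (∀ i → τ (τ i) ≡ i) → ∀ x y →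
                agree x y ≤ agree (permute τ x) (permute τ y)
agree-permute {n} τ ττ x y = begin
  ∑[ g ∈ tuples n n ] 𝟙[ sameChain? g x y ]
    ≡⟨ ∑-involution _≟ᵖ_ (tuples-unique n n) tuples-complete (Vec.map τ)
         (λ g → trans (sym (map-∘ τ τ g)) (trans (map-cong ττ g) (map-id g))) _ ⟨
  ∑[ g ∈ tuples n n ] 𝟙[ sameChain? (Vec.map τ g) x y ]
    ≤⟨ (∑-mono (tuples n n) λ g → 𝟙-mono (sameChain? (Vec.map τ g) x y) (sameChain? g (permute τ x) (permute τ y))
         λ (onto , eq) → subst Onto (trans (sym (map-∘ τ τ g)) (trans (map-cong ττ g) (map-id g)))
                           (onto-map τ ττ (Vec.map τ g) onto) ,
           trans (cong mid (permute-⟨⟩ τ x g)) (trans eq (sym (cong mid (permute-⟨⟩ τ y g))))) ⟩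
  ∑[ g ∈ tuples n n ] 𝟙[ sameChain? g (permute τ x) (permute τ y) ] ∎
  where open ≤-Reasoning

transpose-left : (i j : Fin n) → transpose i j i ≡ j
transpose-left i j rewrite dec-true (i Fin.≟ i) refl = refl

transpose-other : (i j k : Fin n) → k ≢ i → k ≢ j → transpose i j k ≡ k
transpose-other i j k k≢i k≢j rewrite dec-false (k Fin.≟ i) k≢i | dec-false (k Fin.≟ j) k≢j = refl

transpose-comm : (i j k : Fin n) → transpose i j k ≡ transpose j i k
transpose-comm i j k = by-cases (k Fin.≟ i) (k Fin.≟ j)
  where
  by-cases : Dec (k ≡ i) → Dec (k ≡ j) → transpose i j k ≡ transpose j i k
  by-cases (yes k≡i) (yes k≡j)
    rewrite dec-true (k Fin.≟ i) k≡i | dec-true (k Fin.≟ j) k≡j = trans (sym k≡j) k≡i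
  by-cases (yes k≡i) (no k≢j)
    rewrite dec-true (k Fin.≟ i) k≡i | dec-false (k Fin.≟ j) k≢j | dec-true (k Fin.≟ i) k≡i = refl
  by-cases (no k≢i) (yes k≡j)
    rewrite dec-false (k Fin.≟ i) k≢i | dec-true (k Fin.≟ j) k≡j = refl
  by-cases (no k≢i) (no k≢j)
    rewrite dec-false (k Fin.≟ i) k≢i | dec-false (k Fin.≟ j) k≢j | dec-false (k Fin.≟ i) k≢i = refl

transpose-involutive : (i j k : Fin n) → transpose i j (transpose i j k) ≡ k
transpose-involutive i j k = trans (cong (transpose i j) (transpose-comm i j k)) (transpose-inverse i j)

permute-transpose : (i j : Fin n) (x : Vec A n) → lookup x i ≡ lookup x j → permute (transpose i j) x ≡ x
permute-transpose i j x eq = trans (tabulate-cong same) (tabulate∘lookup x)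
  where
  same : ∀ k → lookup x (transpose i j k) ≡ lookup x k
  same k = by-cases (k Fin.≟ i) (k Fin.≟ j)
    where
    by-cases : Dec (k ≡ i) → Dec (k ≡ j) → lookup x (transpose i j k) ≡ lookup x k
    by-cases (yes refl) _ rewrite transpose-left i j = sym eq
    by-cases (no _) (yes refl) rewrite transpose-comm i j j | transpose-left j i = eq
    by-cases (no k≢i) (no k≢j) rewrite transpose-other i j k k≢i k≢j = refl

fixed? : (c : Fin 3) (x y : Point n) (i : Fin n) → Dec (lookup x i ≡ c × lookup y i ≡ c)
fixed? c x y i = (lookup x i Fin.≟ c) ×-dec (lookup y i Fin.≟ c)

-- Exchanging coordinate j, raised from x to y, with coordinates i at which
-- x and y both have the value x j fixes x and moves y to pairwise
-- incomparable points, at most one of which lies on any given chain.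
orbit : (x y : Point n) (j : Fin n) → lookup x j Fin.< lookup y j →
        (∑[ i ∈ allFin n ] 𝟙[ fixed? (lookup x j) x y i ]) * agree x y ≤ #onto n
orbit {n} x y j xⱼ<yⱼ = begin
  (∑[ i ∈ allFin n ] 𝟙[ fix i ]) * agree x y
    ≡⟨ ∑-*ʳ (allFin n) (λ i → 𝟙[ fix i ]) (agree x y) ⟨
  ∑[ i ∈ allFin n ] (𝟙[ fix i ] * agree x y)
    ≤⟨ ∑-mono (allFin n) moved ⟩
  ∑[ i ∈ allFin n ] (𝟙[ fix i ] * agree x (move i))
    ≡⟨ (∑-cong (allFin n) λ i → trans (sym (∑-*ˡ 𝟙[ fix i ] (tuples n n) _))
         (∑-cong (tuples n n) λ g → 𝟙-× (fix i) (sameChain? g x (move i)))) ⟩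
  ∑[ i ∈ allFin n ] ∑[ g ∈ tuples n n ] 𝟙[ fix i ×-dec sameChain? g x (move i) ]
    ≡⟨ ∑-swap (allFin n) (tuples n n) _ ⟩
  ∑[ g ∈ tuples n n ] ∑[ i ∈ allFin n ] 𝟙[ fix i ×-dec sameChain? g x (move i) ]
    ≤⟨ ∑-mono (tuples n n) one ⟩
  #onto n ∎
  where
  open ≤-Reasoning
  fix : ∀ i → Dec (lookup x i ≡ lookup x j × lookup y i ≡ lookup x j)
  fix = fixed? (lookup x j) x y
  move : Fin n → Point n
  move i = permute (transpose i j) y

  moved : ∀ i → 𝟙[ fix i ] * agree x y ≤ 𝟙[ fix i ] * agree x (move i)
  moved i = 𝟙-*-mono (fix i) λ (xᵢ , _) →
    subst (λ z → agree x y ≤ agree z (move i)) (permute-transpose i j x xᵢ)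
      (agree-permute (transpose i j) (transpose-involutive i j) x y)

  move-self : ∀ i → lookup (move i) i ≡ lookup y j
  move-self i = trans (lookup∘tabulate _ i) (cong (lookup y) (transpose-left i j))

  move-other : ∀ i k → k ≢ i → lookup y k ≡ lookup x j → lookup (move i) k ≡ lookup x j
  move-other i k k≢i yₖ with k Fin.≟ j
  ... | yes refl = contradiction (subst (lookup x j Fin.<_) yₖ xⱼ<yⱼ) (<-irrefl refl)
  ... | no k≢j = trans (lookup∘tabulate _ k) (trans (cong (lookup y) (transpose-other i j k k≢i k≢j)) yₖ)

  no-≼ : ∀ {i k} → i ≢ k → lookup y i ≡ lookup x j → ¬ (move i ≼ move k)
  no-≼ {i} {k} i≢k yᵢ le = <⇒≱ xⱼ<yⱼ
    (subst₂ Fin._≤_ (move-self i) (move-other k i i≢k yᵢ) (Pointwise.lookup le i))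

  exclusive : ∀ g {i k} → (lookup x i ≡ lookup x j × lookup y i ≡ lookup x j) × SameChain g x (move i) →
              (lookup x k ≡ lookup x j × lookup y k ≡ lookup x j) × SameChain g x (move k) → i ≡ k
  exclusive g {i} {k} ((_ , yᵢ) , onto , eq) ((_ , yₖ) , _ , eq′) = decidable-stable (i Fin.≟ k) λ i≢k →
    [ no-≼ i≢k yᵢ , no-≼ (i≢k ∘ sym) yₖ ]′
      (sameChain-comparable g (move i) (move k) (onto , trans (sym eq) eq′))

  one : ∀ g → ∑[ i ∈ allFin n ] 𝟙[ fix i ×-dec sameChain? g x (move i) ] ≤ 𝟙[ onto? g ]
  one g = by-cases (onto? g)
    where
    by-cases : (d : Dec (Onto g)) →
               ∑[ i ∈ allFin n ] 𝟙[ fix i ×-dec sameChain? g x (move i) ] ≤ 𝟙[ d ]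
    by-cases (yes _) = ∑-exclusive (λ i → fix i ×-dec sameChain? g x (move i)) (Unique.allFin⁺ n) λ _ _ → exclusive g
    by-cases (no ¬onto) = ≤-reflexive (∑-zero (allFin n) λ {i} _ →
      𝟙-false (fix i ×-dec sameChain? g x (move i)) λ (_ , onto , _) → ¬onto onto)

occurrences : Fin 3 → Point n → ℕ
occurrences {n} a y = ∑[ i ∈ allFin n ] 𝟙[ lookup y i Fin.≟ a ]

-- Enough coordinates for the exchanges in `orbit`. Twos are left out because no coordinate is
-- raised from 2.
Typical : ℕ → Point n → Set
Typical m y = m ≤ occurrences 0F y × m ≤ occurrences 1F y

typical? : ∀ m (y : Point n) → Dec (Typical m y)
typical? m y = (m ≤? occurrences 0F y) ×-dec (m ≤? occurrences 1F y)

infix 4 _≺_ _≺?_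

_≺_ : Point n → Point n → Set
x ≺ y = x ≼ y × x ≢ y

_≺?_ : (x y : Point n) → Dec (x ≺ y)
x ≺? y = (x ≼? y) ×-dec ¬? (x ≟ᵖ y)

≺-raised : {x y : Point n} → x ≺ y → ∃[ j ] lookup x j Fin.< lookup y j
≺-raised {x = x} {y} (x≼y , x≢y) with Fin.any? (λ j → lookup x j Fin.<? lookup y j)
... | yes raised = raised
... | no ¬raised = contradiction (trans (sym (tabulate∘lookup x)) (trans (tabulate-cong same) (tabulate∘lookup y))) x≢y
  where
  same : ∀ j → lookup x j ≡ lookup y j
  same j = Fin.toℕ-injective (≤-antisym (Pointwise.lookup x≼y j) (≮⇒≥ λ lt → ¬raised (j , lt)))

-- If some coordinate is raised from 0, the zeros of `y` can be exchanged with it, since `x` is 0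
-- there too. Otherwise some coordinate is raised from 1, and the ones of `y` serve: a zero of `x`
-- at such a place would be a coordinate raised from 0.
agree-≺ : ∀ m {x y : Point n} → x ≺ y → Typical m y → m * agree x y ≤ #onto n
agree-≺ {n} m {x} {y} (x≼y , x≢y) (zeros , ones)
  with Fin.any? (λ j → (lookup x j Fin.≟ 0F) ×-dec (lookup x j Fin.<? lookup y j))
... | yes (j , xⱼ , lt) = ≤-trans (*-monoˡ-≤ (agree x y) (≤-trans zeros
        (∑-mono (allFin n) λ i → 𝟙-mono (lookup y i Fin.≟ 0F) (fixed? (lookup x j) x y i) λ yᵢ →
          trans (least {lookup x i} (subst (lookup x i Fin.≤_) yᵢ (Pointwise.lookup x≼y i))) (sym xⱼ) , trans yᵢ (sym xⱼ))))
      (orbit x y j lt)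
  where
  least : ∀ {a : Fin 3} → toℕ a ≤ 0 → a ≡ 0F
  least {0F} _ = refl
... | no ¬zero with ≺-raised (x≼y , x≢y)
...   | j , lt = ≤-trans (*-monoˡ-≤ (agree x y) (≤-trans ones
        (∑-mono (allFin n) λ i → 𝟙-mono (lookup y i Fin.≟ 1F) (fixed? (lookup x j) x y i) λ yᵢ →
          trans (one-below {a = lookup x i} (subst (lookup x i Fin.≤_) yᵢ (Pointwise.lookup x≼y i)) (λ xᵢ → ¬zero (i , xᵢ ,
            subst₂ Fin._<_ (sym xᵢ) (sym yᵢ) (s≤s z≤n)))) (sym xⱼ) , trans yᵢ (sym xⱼ))))
      (orbit x y j lt)
  where
  one-below : ∀ {a : Fin 3} → toℕ a ≤ 1 → a ≢ 0F → a ≡ 1F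
  one-below {0F} _ a≢0 = contradiction refl a≢0
  one-below {1F} _ _ = refl
  one-below {2F} (s≤s ())
  is-one : ∀ {a b : Fin 3} → a Fin.< b → a ≢ 0F → a ≡ 1F
  is-one {0F} _ a≢0 = contradiction refl a≢0
  is-one {1F} _ _ = refl
  is-one {2F} {0F} ()
  is-one {2F} {1F} (s≤s ())
  is-one {2F} {2F} (s≤s (s≤s ()))
  xⱼ : lookup x j ≡ 1F
  xⱼ = is-one lt λ xⱼ≡0 → ¬zero (j , xⱼ≡0 , lt)

-- (X - k) (X - k - 1) ≥ 0, with the negative terms moved to the left.
chord : ∀ k X → suc (k + k) * X ≤ X * X + k * suc k
chord k X with ≤-total X k
... | inj₁ X≤k with d , refl ← m≤n⇒∃[o]m+o≡n X≤k = ≤-trans (m≤m+n _ (d * suc d)) (≤-reflexive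
  (solve 2 (λ X d → (con 1 :+ (X :+ d :+ (X :+ d))) :* X :+ d :* (con 1 :+ d)
                 := X :* X :+ (X :+ d) :* (con 1 :+ (X :+ d))) refl X d))
  where open +-*-Solver using (solve; _:=_; _:+_; _:*_; _:^_; con)
... | inj₂ k≤X with d , refl ← m≤n⇒∃[o]m+o≡n k≤X = above d
  where
  open +-*-Solver using (solve; _:=_; _:+_; _:*_; _:^_; con)
  above : ∀ d → suc (k + k) * (k + d) ≤ (k + d) * (k + d) + k * suc k
  above zero = ≤-reflexive (solve 1 (λ k → (con 1 :+ (k :+ k)) :* (k :+ con 0)
    := (k :+ con 0) :* (k :+ con 0) :+ k :* (con 1 :+ k)) refl k)
  above (suc d) = ≤-trans (m≤m+n _ (d * suc d)) (≤-reflexive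
    (solve 2 (λ k d → (con 1 :+ (k :+ k)) :* (k :+ (con 1 :+ d)) :+ d :* (con 1 :+ d)
                   := (k :+ (con 1 :+ d)) :* (k :+ (con 1 :+ d)) :+ k :* (con 1 :+ k)) refl k d))

pairs : (Point n → Point n) → List (Point n) → ℕ
pairs φ F = ∑[ x ∈ F ] ∑[ y ∈ F ] 𝟙[ φ x ≟ᵖ φ y ]

-- The sum of `chord` over the chains, where `X c` counts the points of `F` sent to `c`. The linear
-- lower bound for the squares is sharp when every chain holds `k` or `k + 1` points, so `k` is to
-- be matched to the density of `F`.
pairs-bound : ∀ k (F : List (Point n)) (φ : Point n → Point n) → (∀ x → φ x ∈ middle-layer n) →
              suc (k + k) * length F ≤ pairs φ F + k * suc k * ℓ n n
pairs-bound {n} k F φ φ∈ = begin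
  suc (k + k) * length F
    ≡⟨ cong (suc (k + k) *_) (trans (sym (*-identityʳ _)) (trans (sym (∑-const F 1))
         (∑-cong F λ x → sym (∑-δ _≟ᵖ_ (middle-layer-unique n) (φ∈ x))))) ⟩
  suc (k + k) * (∑[ x ∈ F ] ∑[ c ∈ middle-layer n ] 𝟙[ φ x ≟ᵖ c ])
    ≡⟨ cong (suc (k + k) *_) (∑-swap F (middle-layer n) _) ⟩
  suc (k + k) * (∑[ c ∈ middle-layer n ] X c)
    ≡⟨ ∑-*ˡ (suc (k + k)) (middle-layer n) X ⟨
  ∑[ c ∈ middle-layer n ] (suc (k + k) * X c)
    ≤⟨ (∑-mono (middle-layer n) λ c → chord k (X c)) ⟩
  ∑[ c ∈ middle-layer n ] (X c * X c + k * suc k)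
    ≡⟨ ∑-+ (middle-layer n) (λ c → X c * X c) _ ⟩
  ∑[ c ∈ middle-layer n ] (X c * X c) + ∑[ c ∈ middle-layer n ] (k * suc k)
    ≡⟨ cong₂ _+_ (∑-cong (middle-layer n) square) (trans (∑-const (middle-layer n) _) (*-comm (ℓ n n) _)) ⟩
  ∑[ c ∈ middle-layer n ] ∑[ x ∈ F ] ∑[ y ∈ F ] 𝟙[ (φ x ≟ᵖ c) ×-dec (φ y ≟ᵖ c) ] + k * suc k * ℓ n n
    ≡⟨ cong (_+ k * suc k * ℓ n n) (trans (∑-swap (middle-layer n) F _)
         (∑-cong F λ x → ∑-swap (middle-layer n) F _)) ⟩
  ∑[ x ∈ F ] ∑[ y ∈ F ] ∑[ c ∈ middle-layer n ] 𝟙[ (φ x ≟ᵖ c) ×-dec (φ y ≟ᵖ c) ] + k * suc k * ℓ n n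
    ≤⟨ +-monoˡ-≤ _ (∑-mono F λ x → ∑-mono F λ y → meet x y) ⟩
  pairs φ F + k * suc k * ℓ n n ∎
  where
  open ≤-Reasoning
  X : Point n → ℕ
  X c = ∑[ x ∈ F ] 𝟙[ φ x ≟ᵖ c ]
  square : ∀ c → X c * X c ≡ ∑[ x ∈ F ] ∑[ y ∈ F ] 𝟙[ (φ x ≟ᵖ c) ×-dec (φ y ≟ᵖ c) ]
  square c = trans (sym (∑-*ʳ F _ (X c))) (∑-cong F λ x → trans (sym (∑-*ˡ 𝟙[ φ x ≟ᵖ c ] F _))
    (∑-cong F λ y → 𝟙-× (φ x ≟ᵖ c) (φ y ≟ᵖ c)))
  meet : ∀ x y → ∑[ c ∈ middle-layer n ] 𝟙[ (φ x ≟ᵖ c) ×-dec (φ y ≟ᵖ c) ] ≤ 𝟙[ φ x ≟ᵖ φ y ]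
  meet x y with φ x ≟ᵖ φ y
  ... | yes _ = ∑-exclusive (λ c → (φ x ≟ᵖ c) ×-dec (φ y ≟ᵖ c)) (middle-layer-unique n)
                  λ _ _ (p , _) (q , _) → trans (sym p) q
  ... | no φx≢φy = ≤-reflexive (∑-zero (middle-layer n) λ {c} _ →
                  𝟙-false ((φ x ≟ᵖ c) ×-dec (φ y ≟ᵖ c)) λ (p , q) → φx≢φy (trans p (sym q)))

up-degree : Point n → List (Point n) → ℕ
up-degree x F = ∑[ y ∈ F ] 𝟙[ x ≺? y ]

-- Equal points share a chain under every permutation, incomparable ones under none, and `agree-≺`
-- covers the rest. Both points are typical since either may be the upper one.
agree-bound : ∀ m {x y : Point n} → Typical m x → Typical m y →
              m * agree x y ≤ #onto n * (m * 𝟙[ x ≟ᵖ y ] + (𝟙[ x ≺? y ] + 𝟙[ y ≺? x ]))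
agree-bound {n} m {x} {y} tx ty = by-cases (x ≟ᵖ y) (y ≟ᵖ x) (x ≼? y) (y ≼? x)
  where
  open ≤-Reasoning
  agree-sym : ∀ x y → agree x y ≤ agree y x
  agree-sym x y = ∑-mono (tuples n n) λ g → 𝟙-mono (sameChain? g x y) (sameChain? g y x) λ (o , e) → o , sym e
  one : ∀ {a} → 1 ≤ a → #onto n ≤ #onto n * a
  one 1≤a = ≤-trans (≤-reflexive (sym (*-identityʳ _))) (*-monoʳ-≤ (#onto n) 1≤a)
  by-cases : (e : Dec (x ≡ y)) (e′ : Dec (y ≡ x)) (p : Dec (x ≼ y)) (q : Dec (y ≼ x)) →
             m * agree x y ≤ #onto n * (m * 𝟙[ e ] + (𝟙[ p ×-dec ¬? e ] + 𝟙[ q ×-dec ¬? e′ ]))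
  by-cases (yes x≡y) _ _ _ = begin
    m * agree x y     ≤⟨ *-monoʳ-≤ m (∑-mono (tuples n n) λ g → 𝟙-mono (sameChain? g x y) (onto? g) proj₁) ⟩
    m * #onto n       ≡⟨ trans (*-comm m _) (cong (#onto n *_) (sym (*-identityʳ m))) ⟩
    #onto n * (m * 1) ≤⟨ *-monoʳ-≤ (#onto n) (m≤m+n (m * 1) _) ⟩
    _ ∎
  by-cases (no x≢y) e′ (yes x≼y) q = ≤-trans (agree-≺ m (x≼y , x≢y) ty)
    (one (≤-trans (m≤m+n 1 _) (m≤n+m _ (m * 0))))
  by-cases (no x≢y) e′ (no _) (yes y≼x) = ≤-trans (*-monoʳ-≤ m (agree-sym x y))
    (≤-trans (agree-≺ m (y≼x , x≢y ∘ sym) tx)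
    (one (≤-trans (≤-reflexive (sym (𝟙-true (yes y≼x ×-dec ¬? e′) (y≼x , x≢y ∘ sym)))) (m≤n+m _ (m * 0)))))
  by-cases (no x≢y) e′ (no x⋠y) (no y⋠x) = ≤-trans (≤-reflexive (trans (cong (m *_) none) (*-zeroʳ m))) z≤n
    where
    none : agree x y ≡ 0
    none = ∑-zero (tuples n n) λ {g} _ → 𝟙-false (sameChain? g x y) λ s →
      [ x⋠y , y⋠x ]′ (sameChain-comparable g x y s)

-- The number of ordered pairs of `F` sharing a chain, averaged over the permutations, is bounded
-- below by `pairs-bound` and above by `agree-bound`. The factor 2 is there because `up-degree` sees
-- each comparable pair in one order only.
supersaturation : ∀ m k (F : List (Point n)) → Unique F → All (Typical m) F →
                  m * ((k + k) * length F) ≤ 2 * (∑[ x ∈ F ] up-degree x F) + m * (k * suc k * ℓ n n)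
supersaturation {n} m k F unique typical =
  -- The pairs with `x ≡ y` contribute `#onto n * (m * f)`. They cancel against the 1 in
  -- `suc (k + k)`, so that only strict comparabilities remain.
  *-cancelˡ-≤ (#onto n) (+-cancelʳ-≤ (#onto n * (m * length F)) _ _ (begin
    #onto n * (m * ((k + k) * f)) + #onto n * (m * f)
      ≡⟨ solve 4 (λ N m k f → N :* (m :* ((k :+ k) :* f)) :+ N :* (m :* f)
                           := m :* (N :* ((con 1 :+ (k :+ k)) :* f))) refl (#onto n) m k f ⟩
    m * (#onto n * (suc (k + k) * f))
      ≤⟨ *-monoʳ-≤ m averaged ⟩
    m * (agreement + #onto n * (k * suc k * ℓ n n))
      ≡⟨ *-distribˡ-+ m agreement _ ⟩
    m * agreement + m * (#onto n * (k * suc k * ℓ n n))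
      ≤⟨ +-monoˡ-≤ _ agreement-bound ⟩
    #onto n * (m * f + (U + U)) + m * (#onto n * (k * suc k * ℓ n n))
      ≡⟨ solve 5 (λ N m f U K → N :* (m :* f :+ (U :+ U)) :+ m :* (N :* K)
                             := N :* (con 2 :* U :+ m :* K) :+ N :* (m :* f)) refl (#onto n) m f U (k * suc k * ℓ n n) ⟩
    #onto n * (2 * U + m * (k * suc k * ℓ n n)) + #onto n * (m * f) ∎))
  where
  open ≤-Reasoning
  open +-*-Solver using (solve; _:=_; _:+_; _:*_; _:^_; con)
  instance _ = >-nonZero (0<#onto n)
  f U agreement : ℕ
  f = length F
  U = ∑[ x ∈ F ] up-degree x F
  agreement = ∑[ x ∈ F ] ∑[ y ∈ F ] agree x y

  averaged : #onto n * (suc (k + k) * f) ≤ agreement + #onto n * (k * suc k * ℓ n n)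
  averaged = begin
    #onto n * (suc (k + k) * f)
      ≡⟨ ∑-*ʳ (tuples n n) (λ g → 𝟙[ onto? g ]) _ ⟨
    ∑[ g ∈ tuples n n ] (𝟙[ onto? g ] * (suc (k + k) * f))
      ≤⟨ (∑-mono (tuples n n) λ g → *-monoʳ-≤ 𝟙[ onto? g ]
           (pairs-bound k F (λ x → mid (x ⟨ g ⟩)) λ x → mid∈middle-layer (x ⟨ g ⟩))) ⟩
    ∑[ g ∈ tuples n n ] (𝟙[ onto? g ] * (pairs (λ x → mid (x ⟨ g ⟩)) F + k * suc k * ℓ n n))
      ≡⟨ (∑-cong (tuples n n) λ g → *-distribˡ-+ 𝟙[ onto? g ] _ _) ⟩
    ∑[ g ∈ tuples n n ] (𝟙[ onto? g ] * pairs (λ x → mid (x ⟨ g ⟩)) F + 𝟙[ onto? g ] * (k * suc k * ℓ n n))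
      ≡⟨ ∑-+ (tuples n n) _ _ ⟩
    ∑[ g ∈ tuples n n ] (𝟙[ onto? g ] * pairs (λ x → mid (x ⟨ g ⟩)) F) + ∑[ g ∈ tuples n n ] (𝟙[ onto? g ] * (k * suc k * ℓ n n))
      ≡⟨ cong₂ _+_ (∑-cong (tuples n n) distribute) (∑-*ʳ (tuples n n) (λ g → 𝟙[ onto? g ]) _) ⟩
    ∑[ g ∈ tuples n n ] ∑[ x ∈ F ] ∑[ y ∈ F ] 𝟙[ sameChain? g x y ] + #onto n * (k * suc k * ℓ n n)
      ≡⟨ cong (_+ #onto n * (k * suc k * ℓ n n)) (trans (∑-swap (tuples n n) F _)
           (∑-cong F λ x → ∑-swap (tuples n n) F _)) ⟩
    agreement + #onto n * (k * suc k * ℓ n n) ∎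
    where
    distribute : ∀ g → 𝟙[ onto? g ] * pairs (λ x → mid (x ⟨ g ⟩)) F ≡ ∑[ x ∈ F ] ∑[ y ∈ F ] 𝟙[ sameChain? g x y ]
    distribute g = trans (sym (∑-*ˡ 𝟙[ onto? g ] F _)) (∑-cong F λ x → trans (sym (∑-*ˡ 𝟙[ onto? g ] F _))
      (∑-cong F λ y → 𝟙-× (onto? g) (mid (x ⟨ g ⟩) ≟ᵖ mid (y ⟨ g ⟩))))

  agreement-bound : m * agreement ≤ #onto n * (m * f + (U + U))
  agreement-bound = begin
    m * agreement
      ≡⟨ trans (sym (∑-*ˡ m F _)) (∑-cong F λ x → sym (∑-*ˡ m F _)) ⟩
    ∑[ x ∈ F ] ∑[ y ∈ F ] (m * agree x y)
      ≤⟨ (∑-mono-∈ F λ {x} i → ∑-mono-∈ F λ {y} j → agree-bound m {x} {y} (All.lookup typical i) (All.lookup typical j)) ⟩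
    ∑[ x ∈ F ] ∑[ y ∈ F ] (#onto n * (m * 𝟙[ x ≟ᵖ y ] + (𝟙[ x ≺? y ] + 𝟙[ y ≺? x ])))
      ≡⟨ trans (∑-cong F λ x → ∑-*ˡ (#onto n) F _) (∑-*ˡ (#onto n) F _) ⟩
    #onto n * (∑[ x ∈ F ] ∑[ y ∈ F ] (m * 𝟙[ x ≟ᵖ y ] + (𝟙[ x ≺? y ] + 𝟙[ y ≺? x ])))
      ≡⟨ cong (#onto n *_) (trans (∑-cong F λ x → ∑-+ F _ _) (∑-+ F _ _)) ⟩
    #onto n * (∑[ x ∈ F ] ∑[ y ∈ F ] (m * 𝟙[ x ≟ᵖ y ]) + ∑[ x ∈ F ] ∑[ y ∈ F ] (𝟙[ x ≺? y ] + 𝟙[ y ≺? x ]))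
      ≤⟨ *-monoʳ-≤ (#onto n) (+-mono-≤
           (≤-trans (∑-mono-∈ F λ {x} i → ≤-reflexive (trans (∑-*ˡ m F _)
             (trans (cong (m *_) (∑-δ _≟ᵖ_ unique i)) (*-identityʳ m))))
             (≤-reflexive (trans (∑-const F m) (*-comm f m))))
           (≤-reflexive (trans (trans (∑-cong F λ x → ∑-+ F _ _) (∑-+ F _ _))
             (cong (U +_) (∑-swap F F λ x y → 𝟙[ y ≺? x ]))))) ⟩
    #onto n * (m * f + (U + U)) ∎

-- Counting antichains by deleting points

∑-++ : ∀ (xs : List A) {ys} (f : A → ℕ) → ∑ (xs ++ ys) f ≡ ∑ xs f + ∑ ys f
∑-++ []       f = refl
∑-++ (x ∷ xs) f = trans (cong (f x +_) (∑-++ xs f)) (sym (+-assoc (f x) _ _))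

∑-↭ : ∀ {xs ys : List A} (f : A → ℕ) → xs ↭ ys → ∑ xs f ≡ ∑ ys f
∑-↭ f ↭.refl = refl
∑-↭ f (↭.prep x p) = cong (f x +_) (∑-↭ f p)
∑-↭ {xs = _ ∷ _ ∷ xs} f (↭.swap x y p) = trans (cong (λ s → f x + (f y + s)) (∑-↭ f p))
  (solve 3 (λ a b c → a :+ (b :+ c) := b :+ (a :+ c)) refl (f x) (f y) _)
  where open +-*-Solver using (solve; _:=_; _:+_; _:*_; _:^_; con)
∑-↭ f (↭.trans p q) = trans (∑-↭ f p) (∑-↭ f q)

∑-subsets : ∀ x (xs : List A) (h : List A → ℕ) →
            ∑ (subsets (x ∷ xs)) h ≡ ∑ (subsets xs) h + ∑[ S ∈ subsets xs ] h (x ∷ S)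
∑-subsets x xs h = trans (∑-++ (subsets xs) h) (cong (∑ (subsets xs) h +_) (∑-map (x ∷_) (subsets xs) h))

∑-subsets-↭ : ∀ {xs ys : List A} (h : List A → ℕ) → (∀ {S T} → S ↭ T → h S ≡ h T) →
              xs ↭ ys → ∑ (subsets xs) h ≡ ∑ (subsets ys) h
∑-subsets-↭ h resp ↭.refl = refl
∑-subsets-↭ h resp (↭.prep {xs} {ys} x p) = trans (∑-subsets x xs h)
  (trans (cong₂ _+_ (∑-subsets-↭ h resp p) (∑-subsets-↭ (h ∘ (x ∷_)) (resp ∘ ↭.prep x) p)) (sym (∑-subsets x ys h)))
∑-subsets-↭ h resp (↭.swap {xs} {ys} x y p) = begin-equality
  ∑ (subsets (x ∷ y ∷ xs)) h
    ≡⟨ expand x y xs ⟩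
  ∑ (subsets xs) h + ∑ (subsets xs) (h ∘ (y ∷_)) + (∑ (subsets xs) (h ∘ (x ∷_)) + ∑[ S ∈ subsets xs ] h (x ∷ y ∷ S))
    ≡⟨ interchange (∑ (subsets xs) h) _ _ _ ⟩
  ∑ (subsets xs) h + ∑ (subsets xs) (h ∘ (x ∷_)) + (∑ (subsets xs) (h ∘ (y ∷_)) + ∑[ S ∈ subsets xs ] h (x ∷ y ∷ S))
    ≡⟨ cong₂ _+_ (cong₂ _+_ (∑-subsets-↭ h resp p) (∑-subsets-↭ (h ∘ (x ∷_)) (resp ∘ ↭.prep x) p))
         (cong₂ _+_ (∑-subsets-↭ (h ∘ (y ∷_)) (resp ∘ ↭.prep y) p)
           (trans (∑-cong (subsets xs) λ S → resp (↭.swap x y ↭.refl))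
             (∑-subsets-↭ (λ S → h (y ∷ x ∷ S)) (resp ∘ ↭.prep y ∘ ↭.prep x) p))) ⟩
  ∑ (subsets ys) h + ∑ (subsets ys) (h ∘ (x ∷_)) + (∑ (subsets ys) (h ∘ (y ∷_)) + ∑[ S ∈ subsets ys ] h (y ∷ x ∷ S))
    ≡⟨ expand y x ys ⟨
  ∑ (subsets (y ∷ x ∷ ys)) h ∎
  where
  open ≤-Reasoning
  expand : ∀ x y zs → ∑ (subsets (x ∷ y ∷ zs)) h ≡
    ∑ (subsets zs) h + ∑ (subsets zs) (h ∘ (y ∷_)) + (∑ (subsets zs) (h ∘ (x ∷_)) + ∑[ S ∈ subsets zs ] h (x ∷ y ∷ S))
  expand x y zs = trans (∑-subsets x (y ∷ zs) h) (cong₂ _+_ (∑-subsets y zs h) (∑-subsets y zs (h ∘ (x ∷_))))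
∑-subsets-↭ h resp (↭.trans p q) = trans (∑-subsets-↭ h resp p) (∑-subsets-↭ h resp q)

module _ {P : A → Set} (P? : ∀ x → Dec (P x)) where

  ∑-subsets-filter : ∀ xs (h : List A → ℕ) →
    ∑[ S ∈ subsets xs ] (𝟙[ All.all? P? S ] * h S) ≡ ∑ (subsets (filter P? xs)) h
  ∑-subsets-filter [] h = cong (_+ 0) (*-identityˡ (h []))
  ∑-subsets-filter (x ∷ xs) h = trans (∑-subsets x xs _) (rest (P? x) refl)
    where
    rest : (d : Dec (P x)) → P? x ≡ d → ∑[ S ∈ subsets xs ] (𝟙[ All.all? P? S ] * h S)
             + ∑[ S ∈ subsets xs ] (𝟙[ All.all? P? (x ∷ S) ] * h (x ∷ S)) ≡ ∑ (subsets (filter P? (x ∷ xs))) h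
    rest (yes p) eq rewrite eq = trans (cong₂ _+_ (∑-subsets-filter xs h) (∑-subsets-filter xs (h ∘ (x ∷_))))
      (sym (∑-subsets x (filter P? xs) h))
    rest (no _) eq rewrite eq = trans (cong (∑[ S ∈ subsets xs ] (𝟙[ All.all? P? S ] * h S) +_) (∑-zero (subsets xs) λ _ → refl))
      (trans (+-identityʳ _) (∑-subsets-filter xs h))

  -- Adjoining an element cannot increase `h`, so each element outside `P` costs a factor of at most
  -- 2. This is how the atypical points are discarded.
  ∑-subsets-outside : ∀ xs (h : List A → ℕ) → (∀ {S T} → S ⊆ T → h T ≤ h S) →
    ∑ (subsets xs) h ≤ 2 ^ (length xs ∸ length (filter P? xs)) * ∑ (subsets (filter P? xs)) h
  ∑-subsets-outside [] h anti = ≤-reflexive (sym (*-identityˡ (h [] + 0)))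
  ∑-subsets-outside (x ∷ xs) h anti with P? x
  ... | yes _ = begin
    ∑ (subsets (x ∷ xs)) h
      ≡⟨ ∑-subsets x xs h ⟩
    ∑ (subsets xs) h + ∑ (subsets xs) (h ∘ (x ∷_))
      ≤⟨ +-mono-≤ (∑-subsets-outside xs h anti) (∑-subsets-outside xs (h ∘ (x ∷_)) λ p → anti (refl ∷ p)) ⟩
    c * ∑ (subsets ys) h + c * ∑ (subsets ys) (h ∘ (x ∷_))
      ≡⟨ *-distribˡ-+ c _ _ ⟨
    c * (∑ (subsets ys) h + ∑ (subsets ys) (h ∘ (x ∷_)))
      ≡⟨ cong (c *_) (∑-subsets x ys h) ⟨
    c * ∑ (subsets (x ∷ ys)) h ∎
    where
    open ≤-Reasoning
    ys = filter P? xs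
    c = 2 ^ (length xs ∸ length ys)
  ... | no _ = begin
    ∑ (subsets (x ∷ xs)) h
      ≡⟨ ∑-subsets x xs h ⟩
    ∑ (subsets xs) h + ∑ (subsets xs) (h ∘ (x ∷_))
      ≤⟨ +-monoʳ-≤ _ (∑-mono (subsets xs) λ S → anti (x ∷ʳ ⊆-refl)) ⟩
    ∑ (subsets xs) h + ∑ (subsets xs) h
      ≤⟨ +-mono-≤ (∑-subsets-outside xs h anti) (∑-subsets-outside xs h anti) ⟩
    c * s + c * s
      ≡⟨ solve 2 (λ c s → c :* s :+ c :* s := con 2 :* c :* s) refl c s ⟩
    2 * c * s
      ≡⟨ cong (λ e → 2 ^ e * s) (+-∸-assoc 1 (length-filter P? xs)) ⟨
    2 ^ (suc (length xs) ∸ length ys) * s ∎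
    where
    open ≤-Reasoning
    open +-*-Solver using (solve; _:=_; _:+_; _:*_; _:^_; con)
    ys = filter P? xs
    c = 2 ^ (length xs ∸ length ys)
    s = ∑ (subsets ys) h

∑-subsets-1 : ∀ (xs : List A) → ∑[ S ∈ subsets xs ] 1 ≡ 2 ^ length xs
∑-subsets-1 [] = refl
∑-subsets-1 (x ∷ xs) = trans (∑-subsets x xs λ _ → 1)
  (cong₂ _+_ (∑-subsets-1 xs) (trans (∑-subsets-1 xs) (sym (+-identityʳ _))))

subsets-⊆ : ∀ {S : List A} xs → S ∈ subsets xs → S ⊆ xs
subsets-⊆ [] (here refl) = []
subsets-⊆ (x ∷ xs) i with ∈-++⁻ (subsets xs) i
... | inj₁ j = x ∷ʳ subsets-⊆ xs j
... | inj₂ j with T , k , refl ← ∈-map⁻ (x ∷_) j = refl ∷ subsets-⊆ xs k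

AllPairs-resp-⊆ : ∀ {R : A → A → Set} {xs ys} → xs ⊆ ys → AllPairs R ys → AllPairs R xs
AllPairs-resp-⊆ []         []       = []
AllPairs-resp-⊆ (_ ∷ʳ p)   (_ ∷ rs) = AllPairs-resp-⊆ p rs
AllPairs-resp-⊆ (refl ∷ p) (r ∷ rs) = All-resp-⊆ p r ∷ AllPairs-resp-⊆ p rs

AllPairs-resp-↭ : ∀ {R : A → A → Set} → Symmetric R → ∀ {xs ys} → xs ↭ ys → AllPairs R xs → AllPairs R ys
AllPairs-resp-↭ s ↭.refl rs = rs
AllPairs-resp-↭ s (↭.prep x p) (r ∷ rs) = All-resp-↭ p r ∷ AllPairs-resp-↭ s p rs
AllPairs-resp-↭ s (↭.swap x y p) ((r ∷ rx) ∷ ry ∷ rs) =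
  (s r ∷ All-resp-↭ p ry) ∷ All-resp-↭ p rx ∷ AllPairs-resp-↭ s p rs
AllPairs-resp-↭ s (↭.trans p q) rs = AllPairs-resp-↭ s q (AllPairs-resp-↭ s p rs)

Antichain : List (Point n) → Set
Antichain = AllPairs Incomparable

antichain? : (S : List (Point n)) → Dec (Antichain S)
antichain? = allPairs? incomparable?

incomparable-sym : Symmetric (Incomparable {n})
incomparable-sym (p , q) = q , p

count : List (Point n) → ℕ
count F = ∑[ S ∈ subsets F ] 𝟙[ antichain? S ]

#antichains≡count : ∀ n → #antichains n ≡ count (points n)
#antichains≡count n = length-filter-∑ antichain? (subsets (points n))

count-↭ : {F G : List (Point n)} → F ↭ G → count F ≡ count G
count-↭ = ∑-subsets-↭ _ λ {S} {T} p → ≤-antisym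
  (𝟙-mono (antichain? S) (antichain? T) (AllPairs-resp-↭ incomparable-sym p))
  (𝟙-mono (antichain? T) (antichain? S) (AllPairs-resp-↭ incomparable-sym (↭-sym p)))

count-∷ : (x : Point n) (F : List (Point n)) → count (x ∷ F) ≤ count F + count (filter (incomparable? x) F)
count-∷ x F = begin
  count (x ∷ F)
    ≡⟨ ∑-subsets x F _ ⟩
  count F + ∑[ S ∈ subsets F ] 𝟙[ antichain? (x ∷ S) ]
    ≤⟨ +-monoʳ-≤ (count F) (∑-mono (subsets F) λ S → ≤-trans
         (𝟙-mono (antichain? (x ∷ S)) (All.all? (incomparable? x) S ×-dec antichain? S) AllPairs.uncons)
         (≤-reflexive (sym (𝟙-× (All.all? (incomparable? x) S) (antichain? S))))) ⟩
  count F + ∑[ S ∈ subsets F ] (𝟙[ All.all? (incomparable? x) S ] * 𝟙[ antichain? S ])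
    ≡⟨ cong (count F +_) (∑-subsets-filter (incomparable? x) F _) ⟩
  count F + count (filter (incomparable? x) F) ∎
  where open ≤-Reasoning

count≤2^ : (F : List (Point n)) → count F ≤ 2 ^ length F
count≤2^ F = ≤-trans (∑-mono (subsets F) λ S → 𝟙≤1 (antichain? S)) (≤-reflexive (∑-subsets-1 F))

-- Comparable points of equal weight coincide, so every subset of the middle layer is an antichain.
2^ℓ≤count : ∀ n → 2 ^ ℓ n n ≤ count (points n)
2^ℓ≤count n = begin
  2 ^ ℓ n n
    ≡⟨ ∑-subsets-1 (middle-layer n) ⟨
  ∑[ S ∈ subsets (middle-layer n) ] 1
    ≡⟨ ∑-subsets-filter central? (points n) (λ _ → 1) ⟨
  ∑[ S ∈ subsets (points n) ] (𝟙[ All.all? central? S ] * 1)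
    ≤⟨ (∑-mono-∈ (subsets (points n)) λ {S} i → ≤-trans (≤-reflexive (*-identityʳ _))
         (antichain S (AllPairs-resp-⊆ (subsets-⊆ (points n) i) (points-unique n)))) ⟩
  count (points n) ∎
  where
  open ≤-Reasoning
  central? : (x : Point n) → Dec (weight x ≡ n)
  central? x = weight x ≟ n
  layer : ∀ {S} → Unique S → All (λ x → weight x ≡ n) S → Antichain S
  layer [] [] = []
  layer (x∉ ∷ u) (w ∷ ws) = All.zipWith (λ (x≢y , v) →
      (λ x≼y → x≢y (weight-strict x≼y (trans w (sym v)))) ,
      (λ y≼x → x≢y (sym (weight-strict y≼x (trans v (sym w)))))) (x∉ , ws) ∷ layer u ws
  antichain : ∀ S → Unique S → 𝟙[ All.all? central? S ] ≤ 𝟙[ antichain? S ]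
  antichain S u = 𝟙-mono (All.all? central? S) (antichain? S) (layer u)

-- Growth of the count under repeated deletion.

Good : ℕ → List (Point n) → Set
Good m F = Unique F × All (Typical m) F

^-distribʳ-* : ∀ a b k → (a * b) ^ k ≡ a ^ k * b ^ k
^-distribʳ-* a b zero = refl
^-distribʳ-* a b (suc k) = trans (cong (a * b *_) (^-distribʳ-* a b k))
  (solve 4 (λ a b c d → a :* b :* (c :* d) := a :* c :* (b :* d)) refl a b (a ^ k) (b ^ k))
  where open +-*-Solver using (solve; _:=_; _:+_; _:*_; _:^_; con)

-- The counterpart of `bernoulli`, with the derivative of the power taken at the right end of the
-- interval.
bernoulli-upper : ∀ a k → suc a ^ suc k ≤ a ^ suc k + suc k * suc a ^ k
bernoulli-upper a zero = ≤-reflexive (solve 1 (λ a → (con 1 :+ a) :* con 1 := a :* con 1 :+ con 1) refl a)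
  where open +-*-Solver using (solve; _:=_; _:+_; _:*_; _:^_; con)
bernoulli-upper a (suc k) = begin
  b + a * b
    ≤⟨ +-monoʳ-≤ b (*-monoʳ-≤ a (bernoulli-upper a k)) ⟩
  b + a * (a ^ suc k + suc k * suc a ^ k)
    ≤⟨ m≤m+n _ (suc k * suc a ^ k) ⟩
  b + a * (a ^ suc k + suc k * suc a ^ k) + suc k * suc a ^ k
    ≡⟨ solve 4 (λ a k c e → (con 1 :+ a) :* e :+ a :* (c :+ (con 1 :+ k) :* e) :+ (con 1 :+ k) :* e
                         := a :* c :+ (con 2 :+ k) :* ((con 1 :+ a) :* e)) refl a k (a ^ suc k) (suc a ^ k) ⟩
  a * a ^ suc k + suc (suc k) * b ∎
  where
  open +-*-Solver using (solve; _:=_; _:+_; _:*_; _:^_; con)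
  open ≤-Reasoning
  b = suc a ^ suc k

-- (1 + 1/t) ^ s ≤ 2 for t = 2 s - 1.
double-upper : ∀ s → let t = suc (s + s) in suc t ^ suc s ≤ 2 * t ^ suc s
double-upper s = +-cancelˡ-≤ (suc t ^ suc s) _ _ (begin
  suc t ^ suc s + suc t ^ suc s
    ≤⟨ +-mono-≤ (bernoulli-upper t s) (bernoulli-upper t s) ⟩
  t ^ suc s + suc s * suc t ^ s + (t ^ suc s + suc s * suc t ^ s)
    ≡⟨ solve 3 (λ s c e → c :+ (con 1 :+ s) :* e :+ (c :+ (con 1 :+ s) :* e)
                       := (con 2 :+ (s :+ s)) :* e :+ con 2 :* c) refl s (t ^ suc s) (suc t ^ s) ⟩
  suc t ^ suc s + 2 * t ^ suc s ∎)
  where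
  open +-*-Solver using (solve; _:=_; _:+_; _:*_; _:^_; con)
  open ≤-Reasoning
  t = suc (s + s)

-- By `amplify`, `(1 + 1/t) ^ (t + 1)` exceeds 2, so `E` such blocks of factors make up for the
-- extra `t`. Here the logarithm enters the degree that a deletion requires.
^-dominates : ∀ t E → t ≤ 2 ^ E → t ^ suc (suc t * E) ≤ suc t ^ (suc t * E)
^-dominates t E t≤2^E = begin
  t * t ^ (suc t * E)
    ≤⟨ *-monoˡ-≤ _ t≤2^E ⟩
  2 ^ E * t ^ (suc t * E)
    ≡⟨ cong (2 ^ E *_) (^-*-assoc t (suc t) E) ⟨
  2 ^ E * (t ^ suc t) ^ E
    ≡⟨ ^-distribʳ-* 2 (t ^ suc t) E ⟨
  (2 * t ^ suc t) ^ E
    ≤⟨ ^-monoˡ-≤ E (<⇒≤ (amplify (n<1+n t))) ⟩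
  (suc t ^ suc t) ^ E
    ≡⟨ ^-*-assoc (suc t) (suc t) E ⟩
  suc t ^ (suc t * E) ∎
  where
  open ≤-Reasoning

-- While F has more than N₀ elements, delete a point v of up-degree at least
-- Δ: either v is in the antichain, and the points above v go as well, or it
-- is not.  So count F grows at most by the factor 1 + 1/t per point.
module Stage (m t Δ N₀ B : ℕ) (dominates : t ^ suc Δ ≤ suc t ^ Δ)
  (base : (F : List (Point n)) → Good m F → length F ≤ N₀ → count F ≤ B)
  (rich : (F : List (Point n)) → Good m F → N₀ < length F → ∃[ v ] v ∈ F × Δ ≤ up-degree v F) where

  -- The bound `B * (1 + 1/t) ^ length F` with its denominator cleared. The recursion visits both
  -- `G` and its sublist `H`, so it runs on a bound `k` for the length.
  growth : ∀ k (F : List (Point n)) → Good m F → length F ≤ k → count F * t ^ length F ≤ B * suc t ^ length F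
  growth k F good F≤k with length F ≤? N₀
  ... | yes small = *-mono-≤ (base F good small) (^-monoˡ-≤ (length F) (n≤1+n t))
  ... | no large with rich F good (≰⇒> large)
  ...   | v , v∈F , Δ≤ with ∈-∃++ v∈F
  ...     | us , vs , refl with k | ↭-length (shift v us vs)
  ...       | zero  | eq = contradiction (≤-trans (≤-reflexive (sym eq)) F≤k) λ ()
  ...       | suc k | eq = subst₂ _≤_ (cong₂ (λ c l → c * t ^ l) (sym (count-↭ p)) (sym eq)) (cong (λ l → B * suc t ^ l) (sym eq)) (begin
    count (v ∷ G) * t ^ suc j
      ≤⟨ *-monoˡ-≤ (t ^ suc j) (count-∷ v G) ⟩
    (count G + count H) * t ^ suc j
      ≡⟨ *-distribʳ-+ (t ^ suc j) (count G) (count H) ⟩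
    count G * (t * t ^ j) + count H * t ^ suc j
      ≤⟨ +-mono-≤ (≤-trans (≤-reflexive (xyz (count G) t (t ^ j))) (*-monoʳ-≤ t (growth k G goodG G≤k))) with-v ⟩
    t * (B * suc t ^ j) + B * suc t ^ j
      ≡⟨ solve 3 (λ t B e → t :* (B :* e) :+ B :* e := B :* ((con 1 :+ t) :* e)) refl t B (suc t ^ j) ⟩
    B * suc t ^ suc j ∎)
    where
    open ≤-Reasoning
    open +-*-Solver using (solve; _:=_; _:+_; _:*_; _:^_; con)
    xyz : ∀ x y z → x * (y * z) ≡ y * (x * z)
    xyz = solve 3 (λ x y z → x :* (y :* z) := y :* (x :* z)) refl
    p = shift v us vs
    G = us ++ vs
    H = filter (incomparable? v) G
    j = length G
    i = length H
    goodG : Good m G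
    goodG = AllPairs.tail (AllPairs-resp-↭ (λ ne e → ne (sym e)) p (proj₁ good)) , All.tail (All-resp-↭ p (proj₂ good))
    goodH : Good m H
    goodH = Unique.filter⁺ (incomparable? v) (proj₁ goodG) , All.filter⁺ (incomparable? v) (proj₂ goodG)
    G≤k : j ≤ k
    G≤k = s≤s⁻¹ (≤-trans (≤-reflexive (sym eq)) F≤k)
    H≤k : i ≤ k
    H≤k = ≤-trans (length-filter (incomparable? v) G) G≤k
    -- No point is both incomparable to `v` and above it, and `v` itself adds nothing to its
    -- up-degree, so the `Δ` points lie in `G` outside `H`.
    i+Δ≤j : i + Δ ≤ j
    i+Δ≤j = begin
      i + Δ
        ≤⟨ +-monoʳ-≤ i (≤-trans Δ≤ (≤-reflexive (∑-↭ _ p))) ⟩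
      i + (𝟙[ v ≺? v ] + up-degree v G)
        ≡⟨ cong₂ (λ a b → a + (b + up-degree v G)) (length-filter-∑ (incomparable? v) G)
             (𝟙-false (v ≺? v) λ (_ , v≢v) → v≢v refl) ⟩
      ∑[ x ∈ G ] 𝟙[ incomparable? v x ] + up-degree v G
        ≡⟨ ∑-+ G _ _ ⟨
      ∑[ x ∈ G ] (𝟙[ incomparable? v x ] + 𝟙[ v ≺? x ])
        ≤⟨ ∑-mono G (λ x → either x) ⟩
      ∑[ x ∈ G ] 1
        ≡⟨ trans (∑-const G 1) (*-identityʳ j) ⟩
      j ∎
      where
      either : ∀ x → 𝟙[ incomparable? v x ] + 𝟙[ v ≺? x ] ≤ 1
      either x = by-cases (v ≺? x)
        where
        by-cases : (d : Dec (v ≺ x)) → 𝟙[ incomparable? v x ] + 𝟙[ d ] ≤ 1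
        by-cases (yes (v≼x , _)) = ≤-reflexive (cong (_+ 1) (𝟙-false (incomparable? v x) λ (v⋠x , _) → v⋠x v≼x))
        by-cases (no _) = ≤-trans (≤-reflexive (+-identityʳ _)) (𝟙≤1 (incomparable? v x))
    with-v : count H * t ^ suc j ≤ B * suc t ^ j
    with-v with e , eq′ ← m≤n⇒∃[o]m+o≡n i+Δ≤j = begin
      count H * t ^ suc j
        ≡⟨ cong (λ j → count H * (t * t ^ j)) eq′ ⟨
      count H * (t * t ^ (i + Δ + e))
        ≡⟨ cong (λ s → count H * (t * s)) (split t) ⟩
      count H * (t * (t ^ i * t ^ Δ * t ^ e))
        ≡⟨ solve 5 (λ c t x y z → c :* (t :* (x :* y :* z)) := c :* x :* (t :* y :* z)) refl (count H) t (t ^ i) (t ^ Δ) (t ^ e) ⟩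
      count H * t ^ i * (t ^ suc Δ * t ^ e)
        ≤⟨ *-mono-≤ (growth k H goodH H≤k) (*-mono-≤ dominates (^-monoˡ-≤ e (n≤1+n t))) ⟩
      B * suc t ^ i * (suc t ^ Δ * suc t ^ e)
        ≡⟨ solve 4 (λ B x y z → B :* x :* (y :* z) := B :* (x :* y :* z)) refl B (suc t ^ i) (suc t ^ Δ) (suc t ^ e) ⟩
      B * (suc t ^ i * suc t ^ Δ * suc t ^ e)
        ≡⟨ cong (B *_) (split (suc t)) ⟨
      B * suc t ^ (i + Δ + e)
        ≡⟨ cong (λ j → B * suc t ^ j) eq′ ⟩
      B * suc t ^ j ∎
      where
      split : ∀ b → b ^ (i + Δ + e) ≡ b ^ i * b ^ Δ * b ^ e
      split b = trans (^-distribˡ-+-* b (i + Δ) e) (cong (_* b ^ e) (^-distribˡ-+-* b i Δ))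

-- With `t = 2 s - 1`, a block of `s` deletions costs at most one bit by `double-upper`, so `s * q`
-- of them cost at most `q` bits. A shorter `F` is padded by `e`.
stage : ∀ (m s E N₀ B q : ℕ) → .{{NonZero s}} → s + s ≤ 2 ^ E →
  ((F : List (Point n)) → Good m F → length F ≤ N₀ → count F ≤ B) →
  ((F : List (Point n)) → Good m F → N₀ < length F → ∃[ v ] v ∈ F × (s + s) * E ≤ up-degree v F) →
  (F : List (Point n)) → Good m F → length F ≤ s * q → count F ≤ B * 2 ^ q
stage {n} m s@(suc s′) E N₀ B q 2s≤2^E base rich F good F≤
  with e , eq ← m≤n⇒∃[o]m+o≡n F≤ = *-cancelʳ-≤ _ _ (t ^ (s * q)) (begin
    count F * t ^ (s * q)
      ≡⟨ cong (λ l → count F * t ^ l) eq ⟨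
    count F * t ^ (length F + e)
      ≡⟨ trans (cong (count F *_) (^-distribˡ-+-* t (length F) e)) (sym (*-assoc (count F) _ _)) ⟩
    count F * t ^ length F * t ^ e
      ≤⟨ *-mono-≤ (growth (length F) F good ≤-refl) (^-monoˡ-≤ e (n≤1+n t)) ⟩
    B * suc t ^ length F * suc t ^ e
      ≡⟨ trans (cong (B *_) (^-distribˡ-+-* (suc t) (length F) e)) (sym (*-assoc B _ _)) ⟨
    B * suc t ^ (length F + e)
      ≡⟨ cong (λ l → B * suc t ^ l) eq ⟩
    B * suc t ^ (s * q)
      ≡⟨ cong (B *_) (^-*-assoc (suc t) s q) ⟨
    B * (suc t ^ s) ^ q
      ≤⟨ *-monoʳ-≤ B (^-monoˡ-≤ q (double-upper s′)) ⟩
    B * (2 * t ^ s) ^ q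
      ≡⟨ cong (B *_) (^-distribʳ-* 2 (t ^ s) q) ⟩
    B * (2 ^ q * (t ^ s) ^ q)
      ≡⟨ cong (λ x → B * (2 ^ q * x)) (^-*-assoc t s q) ⟩
    B * (2 ^ q * t ^ (s * q))
      ≡⟨ *-assoc B (2 ^ q) _ ⟨
    B * 2 ^ q * t ^ (s * q) ∎)
  where
  open ≤-Reasoning
  t = suc (s′ + s′)
  1+t≡2s : suc t ≡ s + s
  1+t≡2s = cong suc (sym (+-suc s′ s′))
  instance _ = m^n≢0 t (s * q)
  t≤2^E : t ≤ 2 ^ E
  t≤2^E = ≤-trans (n≤1+n t) (≤-trans (≤-reflexive 1+t≡2s) 2s≤2^E)
  rich′ : (F : List (Point n)) → Good m F → N₀ < length F → ∃[ v ] v ∈ F × suc t * E ≤ up-degree v F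
  rich′ F good lt with rich F good lt
  ... | v , i , le = v , i , ≤-trans (≤-reflexive (cong (_* E) 1+t≡2s)) le
  open Stage m t (suc t * E) N₀ B
    (^-dominates t E t≤2^E) base rich′

-- Atypical points and the bound on the number of antichains

∑-cartesianProductWith : ∀ (f : A → B → C) xs ys (h : C → ℕ) →
                         ∑ (cartesianProductWith f xs ys) h ≡ ∑[ x ∈ xs ] ∑[ y ∈ ys ] h (f x y)
∑-cartesianProductWith f []       ys h = refl
∑-cartesianProductWith f (x ∷ xs) ys h = trans (∑-++ (map (f x) ys) h)
  (cong₂ _+_ (∑-map (f x) ys h) (∑-cartesianProductWith f xs ys h))

length-points≡3^ : ∀ n → length (points n) ≡ 3 ^ n
length-points≡3^ n = trans (sym (trans (∑-const (points n) 1) (*-identityʳ _))) (count-all n)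
  where
  count-all : ∀ n → ∑[ x ∈ points n ] 1 ≡ 3 ^ n
  count-all zero    = refl
  count-all (suc n) = trans (∑-cartesianProductWith _∷_ (allFin 3) (points n) (λ _ → 1))
    (trans (∑-const (allFin 3) (∑[ x ∈ points n ] 1)) (cong (3 *_) (count-all n)))

occurrences-∷ : ∀ a b (y : Point n) → occurrences a (b ∷ y) ≡ 𝟙[ b Fin.≟ a ] + occurrences a y
occurrences-∷ {n} a b y = cong (𝟙[ b Fin.≟ a ] +_) (trans
  (cong (λ is → ∑ is λ i → 𝟙[ lookup (b ∷ y) i Fin.≟ a ]) (sym (map-tabulate id suc)))
  (∑-map suc (allFin n) λ i → 𝟙[ lookup (b ∷ y) i Fin.≟ a ]))

-- An exponential moment: 2 to the number of coordinates other than `a`. Being a product over the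
-- coordinates, its sum over all points factors, each coordinate giving 1 + 2 + 2.
2^others : Fin 3 → Point n → ℕ
2^others a []      = 1
2^others a (b ∷ y) = 2 ^ (1 ∸ 𝟙[ b Fin.≟ a ]) * 2^others a y

2^others-occurrences : ∀ a (y : Point n) → 2^others a y * 2 ^ occurrences a y ≡ 2 ^ n
2^others-occurrences a [] = refl
2^others-occurrences {suc n} a (b ∷ y) = begin-equality
  2 ^ (1 ∸ d) * w * 2 ^ occurrences a (b ∷ y)
    ≡⟨ cong (λ k → 2 ^ (1 ∸ d) * w * 2 ^ k) (occurrences-∷ a b y) ⟩
  2 ^ (1 ∸ d) * w * 2 ^ (d + occurrences a y)
    ≡⟨ cong (2 ^ (1 ∸ d) * w *_) (^-distribˡ-+-* 2 d _) ⟩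
  2 ^ (1 ∸ d) * w * (2 ^ d * 2 ^ occurrences a y)
    ≡⟨ solve 4 (λ a b c d → a :* b :* (c :* d) := a :* c :* (b :* d)) refl (2 ^ (1 ∸ d)) w (2 ^ d) _ ⟩
  2 ^ (1 ∸ d) * 2 ^ d * (w * 2 ^ occurrences a y)
    ≡⟨ cong₂ _*_ (trans (sym (^-distribˡ-+-* 2 (1 ∸ d) d)) (cong (2 ^_) (m∸n+n≡m (𝟙≤1 (b Fin.≟ a)))))
         (2^others-occurrences a y) ⟩
  2 ^ suc n ∎
  where
  open ≤-Reasoning
  open +-*-Solver using (solve; _:=_; _:+_; _:*_; _:^_; con)
  d = 𝟙[ b Fin.≟ a ]
  w = 2^others a y

∑-2^others : ∀ a n → ∑ (points n) (2^others a) ≡ 5 ^ n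
∑-2^others a zero    = refl
∑-2^others a (suc n) = trans (∑-cartesianProductWith _∷_ (allFin 3) (points n) (2^others a))
  (trans (∑-cong (allFin 3) λ b → ∑-*ˡ (2 ^ (1 ∸ 𝟙[ b Fin.≟ a ])) (points n) (2^others a))
  (trans (∑-*ʳ (allFin 3) (λ b → 2 ^ (1 ∸ 𝟙[ b Fin.≟ a ])) (∑ (points n) (2^others a)))
  (cong₂ _*_ (five a) (∑-2^others a n))))
  where
  five : ∀ a → ∑[ b ∈ allFin 3 ] (2 ^ (1 ∸ 𝟙[ b Fin.≟ a ])) ≡ 5
  five 0F = refl
  five 1F = refl
  five 2F = refl

few : ℕ → Fin 3 → ℕ → ℕ
few n a m = ∑[ y ∈ points n ] 𝟙[ occurrences a y <? m ]

-- Markov: 2^others has the sum 5ⁿ and is at least 2ⁿ⁻ᵐ where a occurs less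
-- than m times; and 5⁸ 2² ≤ 6⁸.
few-bound : ∀ a m → m * 8 ≤ n → few n a m * 2 ^ m ≤ 3 ^ n
few-bound {n} a m 8m≤n = *-cancelʳ-≤ _ _ (2 ^ n) (begin
  few n a m * 2 ^ m * 2 ^ n
    ≡⟨ solve 3 (λ a b c → a :* b :* c := a :* c :* b) refl (few n a m) (2 ^ m) (2 ^ n) ⟩
  few n a m * 2 ^ n * 2 ^ m
    ≤⟨ *-monoˡ-≤ (2 ^ m) markov ⟩
  5 ^ n * 2 ^ m * 2 ^ m
    ≤⟨ five-six ⟩
  6 ^ n
    ≡⟨ ^-distribʳ-* 3 2 n ⟩
  3 ^ n * 2 ^ n ∎)
  where
  open ≤-Reasoning
  open +-*-Solver using (solve; _:=_; _:+_; _:*_; _:^_; con)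
  instance _ = m^n≢0 2 n
  markov : few n a m * 2 ^ n ≤ 5 ^ n * 2 ^ m
  markov = begin
    few n a m * 2 ^ n
      ≡⟨ ∑-*ʳ (points n) _ (2 ^ n) ⟨
    ∑[ y ∈ points n ] (𝟙[ occurrences a y <? m ] * 2 ^ n)
      ≤⟨ ∑-mono (points n) pointwise ⟩
    ∑[ y ∈ points n ] (2^others a y * 2 ^ m)
      ≡⟨ trans (∑-*ʳ (points n) (2^others a) (2 ^ m)) (cong (_* 2 ^ m) (∑-2^others a n)) ⟩
    5 ^ n * 2 ^ m ∎
    where
    pointwise : ∀ y → 𝟙[ occurrences a y <? m ] * 2 ^ n ≤ 2^others a y * 2 ^ m
    pointwise y = by-cases (occurrences a y <? m)
      where
      by-cases : (d : Dec (occurrences a y < m)) → 𝟙[ d ] * 2 ^ n ≤ 2^others a y * 2 ^ m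
      by-cases (no _)   = z≤n
      by-cases (yes lt) = begin
        1 * 2 ^ n
          ≡⟨ trans (*-identityˡ _) (sym (2^others-occurrences a y)) ⟩
        2^others a y * 2 ^ occurrences a y
          ≤⟨ *-monoʳ-≤ (2^others a y) (^-monoʳ-≤ 2 (<⇒≤ lt)) ⟩
        2^others a y * 2 ^ m ∎
  -- 8 is the least exponent for which `6/5` reaches 4, which is the origin of `m * 8 ≤ n`. One
  -- factor 2 pays for Markov's threshold, the other is the decay obtained; 117116 is the exact
  -- difference.
  5⁸·4≤6⁸ : 5 ^ 8 * 2 * 2 ≤ 6 ^ 8
  5⁸·4≤6⁸ = m≤m+n (5 ^ 8 * 2 * 2) 117116
  five-six : 5 ^ n * 2 ^ m * 2 ^ m ≤ 6 ^ n
  five-six with v , refl ← m≤n⇒∃[o]m+o≡n 8m≤n = begin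
    5 ^ (m * 8 + v) * 2 ^ m * 2 ^ m
      ≡⟨ cong (λ x → x * 2 ^ m * 2 ^ m) (split 5) ⟩
    (5 ^ 8) ^ m * 5 ^ v * 2 ^ m * 2 ^ m
      ≡⟨ solve 3 (λ a b c → a :* b :* c :* c := a :* c :* c :* b) refl ((5 ^ 8) ^ m) (5 ^ v) (2 ^ m) ⟩
    (5 ^ 8) ^ m * 2 ^ m * 2 ^ m * 5 ^ v
      ≡⟨ cong (_* 5 ^ v) (trans (cong (_* 2 ^ m) (sym (^-distribʳ-* (5 ^ 8) 2 m))) (sym (^-distribʳ-* (5 ^ 8 * 2) 2 m))) ⟩
    (5 ^ 8 * 2 * 2) ^ m * 5 ^ v
      ≤⟨ *-mono-≤ (^-monoˡ-≤ m 5⁸·4≤6⁸) (^-monoˡ-≤ v (n≤1+n 5)) ⟩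
    (6 ^ 8) ^ m * 6 ^ v
      ≡⟨ split 6 ⟨
    6 ^ (m * 8 + v) ∎
    where
    split : ∀ b → b ^ (m * 8 + v) ≡ (b ^ 8) ^ m * b ^ v
    split b = trans (^-distribˡ-+-* b (m * 8) v)
      (cong (_* b ^ v) (trans (cong (b ^_) (*-comm m 8)) (sym (^-*-assoc b 8 m))))

atypical : ℕ → ℕ → ℕ
atypical n m = length (points n) ∸ length (filter (typical? m) (points n))

atypical-bound : ∀ m → m * 8 ≤ n → atypical n m * 2 ^ m ≤ 2 * 3 ^ n
atypical-bound {n} m 8m≤n = begin
  atypical n m * 2 ^ m
    ≤⟨ *-monoˡ-≤ (2 ^ m) (m≤n+o⇒m∸n≤o (length (points n)) (length (filter (typical? m) (points n))) {few n 0F m + few n 1F m} covered) ⟩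
  (few n 0F m + few n 1F m) * 2 ^ m
    ≡⟨ *-distribʳ-+ (2 ^ m) (few n 0F m) _ ⟩
  few n 0F m * 2 ^ m + few n 1F m * 2 ^ m
    ≤⟨ +-mono-≤ (few-bound 0F m 8m≤n) (few-bound 1F m 8m≤n) ⟩
  3 ^ n + 3 ^ n
    ≡⟨ cong (3 ^ n +_) (+-identityʳ _) ⟨
  2 * 3 ^ n ∎
  where
  open ≤-Reasoning
  classify : ∀ y → 1 ≤ 𝟙[ typical? m y ] + (𝟙[ occurrences 0F y <? m ] + 𝟙[ occurrences 1F y <? m ])
  classify y = by-cases (m ≤? occurrences 0F y) (m ≤? occurrences 1F y)
    where
    by-cases : (p : Dec (m ≤ occurrences 0F y)) (q : Dec (m ≤ occurrences 1F y)) →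
               1 ≤ 𝟙[ p ×-dec q ] + (𝟙[ occurrences 0F y <? m ] + 𝟙[ occurrences 1F y <? m ])
    by-cases (no m≰) _ = ≤-trans (≤-trans (≤-reflexive (sym (𝟙-true (occurrences 0F y <? m) (≰⇒> m≰)))) (m≤m+n _ _)) (m≤n+m _ 0)
    by-cases (yes _) (no m≰) = ≤-trans (≤-reflexive (sym (𝟙-true (occurrences 1F y <? m) (≰⇒> m≰)))) (m≤n+m _ _)
    by-cases (yes _) (yes _) = m≤m+n 1 _
  covered : length (points n) ≤ length (filter (typical? m) (points n)) + (few n 0F m + few n 1F m)
  covered = begin
    length (points n)
      ≡⟨ trans (∑-const (points n) 1) (*-identityʳ _) ⟨
    ∑[ y ∈ points n ] 1
      ≤⟨ ∑-mono (points n) classify ⟩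
    ∑[ y ∈ points n ] (𝟙[ typical? m y ] + (𝟙[ occurrences 0F y <? m ] + 𝟙[ occurrences 1F y <? m ]))
      ≡⟨ trans (∑-+ (points n) _ _) (cong (∑ (points n) (λ y → 𝟙[ typical? m y ]) +_) (∑-+ (points n) _ _)) ⟩
    ∑[ y ∈ points n ] 𝟙[ typical? m y ] + (few n 0F m + few n 1F m)
      ≡⟨ cong (_+ (few n 0F m + few n 1F m)) (length-filter-∑ (typical? m) (points n)) ⟨
    length (filter (typical? m) (points n)) + (few n 0F m + few n 1F m) ∎

-- Points of large up-degree, and the successive stages.

rich⊎sparse : ∀ Δ (F : List (Point n)) →
              (∃[ v ] v ∈ F × Δ ≤ up-degree v F) ⊎ ∑[ x ∈ F ] up-degree x F ≤ length F * Δ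
rich⊎sparse Δ F with any? (λ v → Δ ≤? up-degree v F) F
... | yes p = inj₁ (find p)
... | no ¬p = inj₂ (≤-trans (∑-mono-∈ F λ i → <⇒≤ (≰⇒> λ le → ¬p (lose i le))) (≤-reflexive (∑-const F Δ)))

-- If all up-degrees were small, the comparabilities would account for at most half of `2 m k f` in
-- `supersaturation`. The other half would then give `f ≤ (k + 1) ℓ`.
rich-coarse : ∀ m k Δ .{{_ : NonZero (m * k)}} → 2 * Δ ≤ m * k → (F : List (Point n)) → Good m F →
              suc k * ℓ n n < length F → ∃[ v ] v ∈ F × Δ ≤ up-degree v F
rich-coarse {n} m k Δ 2Δ≤mk F (unique , typical) large with rich⊎sparse Δ F
... | inj₁ found = found
... | inj₂ sparse = contradiction (*-cancelˡ-≤ (m * k) (+-cancelʳ-≤ (m * k * f) _ _ (begin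
  m * k * f + m * k * f
    ≡⟨ solve 3 (λ m k f → m :* k :* f :+ m :* k :* f := m :* ((k :+ k) :* f)) refl m k f ⟩
  m * ((k + k) * f)
    ≤⟨ supersaturation m k F unique typical ⟩
  2 * (∑[ x ∈ F ] up-degree x F) + m * (k * suc k * ℓ n n)
    ≤⟨ +-monoˡ-≤ _ (*-monoʳ-≤ 2 sparse) ⟩
  2 * (f * Δ) + m * (k * suc k * ℓ n n)
    ≡⟨ solve 5 (λ f D m k l → con 2 :* (f :* D) :+ m :* (k :* (con 1 :+ k) :* l)
                           := con 2 :* D :* f :+ m :* k :* ((con 1 :+ k) :* l)) refl f Δ m k (ℓ n n) ⟩
  2 * Δ * f + m * k * (suc k * ℓ n n)
    ≤⟨ +-monoˡ-≤ _ (*-monoˡ-≤ f 2Δ≤mk) ⟩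
  m * k * f + m * k * (suc k * ℓ n n)
    ≡⟨ +-comm (m * k * f) _ ⟩
  m * k * (suc k * ℓ n n) + m * k * f ∎))) (<⇒≱ large)
  where
  open ≤-Reasoning
  open +-*-Solver using (solve; _:=_; _:+_; _:*_; _:^_; con)
  f = length F

-- With `k = 1`, small up-degrees would give `a (f - ℓ) ≤ f`, that is `(a - 1) f ≤ a ℓ`. This fails
-- once the excess of `f` over `ℓ` is larger than `2 ℓ / a`.
rich-fine : ∀ m a q Δ .{{_ : NonZero m}} → 2 ≤ a → 2 * ℓ n n ≤ a * q → a * Δ ≤ m →
            (F : List (Point n)) → Good m F →
            ℓ n n + q < length F → ∃[ v ] v ∈ F × Δ ≤ up-degree v F
rich-fine {n} m a@(suc b) q Δ (s≤s 1≤b) 2ℓ≤aq aΔ≤m F (unique , typical) large with rich⊎sparse Δ F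
... | inj₁ found = found
... | inj₂ sparse = contradiction (begin-strict
  2 * l             ≤⟨ 2ℓ≤aq ⟩
  a * q             <⟨ *-monoʳ-< a (n<1+n q) ⟩
  -- `2 ≤ a` in the form `a ≤ 2 (a - 1)`.
  a * suc q         ≤⟨ *-monoˡ-≤ (suc q) (+-monoˡ-≤ b 1≤b) ⟩
  (b + b) * suc q   ≡⟨ solve 2 (λ b q → (b :+ b) :* q := con 2 :* (b :* q)) refl b (suc q) ⟩
  2 * (b * suc q)   ≤⟨ *-monoʳ-≤ 2 b·[q+1]≤ℓ ⟩
  2 * l             ∎) (<-irrefl refl)
  where
  open ≤-Reasoning
  open +-*-Solver using (solve; _:=_; _:+_; _:*_; _:^_; con)
  f = length F
  l = ℓ n n
  a·f≤f+a·ℓ : a * f ≤ f + a * l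
  a·f≤f+a·ℓ = *-cancelˡ-≤ (2 * m) {{m*n≢0 2 m}} (begin
    2 * m * (a * f)
      ≡⟨ solve 3 (λ m a f → con 2 :* m :* (a :* f) := a :* (m :* (con 2 :* f))) refl m a f ⟩
    a * (m * (2 * f))
      ≤⟨ *-monoʳ-≤ a (supersaturation m 1 F unique typical) ⟩
    a * (2 * (∑[ x ∈ F ] up-degree x F) + m * (2 * l))
      ≤⟨ *-monoʳ-≤ a (+-monoˡ-≤ _ (*-monoʳ-≤ 2 sparse)) ⟩
    a * (2 * (f * Δ) + m * (2 * l))
      ≡⟨ solve 5 (λ a f D m l → a :* (con 2 :* (f :* D) :+ m :* (con 2 :* l))
                             := con 2 :* (a :* D) :* f :+ con 2 :* m :* (a :* l)) refl a f Δ m l ⟩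
    2 * (a * Δ) * f + 2 * m * (a * l)
      ≤⟨ +-monoˡ-≤ _ (*-monoˡ-≤ f (*-monoʳ-≤ 2 aΔ≤m)) ⟩
    2 * m * f + 2 * m * (a * l)
      ≡⟨ *-distribˡ-+ (2 * m) f _ ⟨
    2 * m * (f + a * l) ∎)
  b·[q+1]≤ℓ : b * suc q ≤ l
  b·[q+1]≤ℓ = +-cancelˡ-≤ (b * l) _ _ (begin
    b * l + b * suc q   ≡⟨ *-distribˡ-+ b l (suc q) ⟨
    b * (l + suc q)     ≤⟨ *-monoʳ-≤ b (≤-trans (≤-reflexive (+-suc l q)) large) ⟩
    b * f               ≤⟨ +-cancelˡ-≤ f _ _ a·f≤f+a·ℓ ⟩
    a * l               ≡⟨ +-comm l (b * l) ⟩
    b * l + l           ∎)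

-- The coarse stages take `s = a² k` and `E = 4 L`. Then `16a²L≤m` is the degree condition of
-- `rich-coarse` divided by `k`, `2a⁴≤` is `s + s ≤ 2 ^ E` for the largest `k = a²`, `1+2n≤2a³` lets
-- the whole poset enter the stage with `k = a²`, and `a·[1+2n]≤2ᵐ` keeps the atypical points within
-- `q`.
module Bound (n m L a : ℕ) (8m≤n : m * 8 ≤ n) (16a²L≤m : 16 * (a * a) * L ≤ m)
  (2≤a : 2 ≤ a) (1≤L : 1 ≤ L) (2a⁴≤ : a * a * (a * a) + a * a * (a * a) ≤ 2 ^ (4 * L))
  (1+2n≤2a³ : suc (n + n) ≤ 2 * (a * a * a)) (a·[1+2n]≤2ᵐ : a * suc (n + n) ≤ 2 ^ m) where

  open ≤-Reasoning
  open +-*-Solver using (solve; _:=_; _:+_; _:*_; _:^_; con)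

  private
    instance
      a≢0 : NonZero a
      a≢0 = >-nonZero (≤-trans (s≤s z≤n) 2≤a)
      aa≢0 : NonZero (a * a)
      aa≢0 = m*n≢0 a a
      m≢0 : NonZero m
      m≢0 = >-nonZero (≤-trans (*-mono-≤ (*-mono-≤ (s≤s (z≤n {15})) (*-mono-≤ 1≤a 1≤a)) 1≤L) 16a²L≤m)
        where
        1≤a : 1 ≤ a
        1≤a = ≤-trans (s≤s z≤n) 2≤a

    l = ℓ n n

    1≤a : 1 ≤ a
    1≤a = ≤-trans (s≤s z≤n) 2≤a

    a≤aa : a ≤ a * a
    a≤aa = m≤m*n a a

    3ⁿ≤ : 3 ^ n ≤ suc (n + n) * l
    3ⁿ≤ = ≤-trans (≤-reflexive (sym (length-points≡3^ n))) (length-points n)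

    m≤n : m ≤ n
    m≤n = ≤-trans (m≤m*n m 8) 8m≤n

    a≤ℓ : a ≤ l
    a≤ℓ = *-cancelʳ-≤ a l (suc (n + n)) (begin
      a * suc (n + n)   ≤⟨ a·[1+2n]≤2ᵐ ⟩
      2 ^ m             ≤⟨ ^-monoʳ-≤ 2 m≤n ⟩
      2 ^ n             ≤⟨ ^-monoˡ-≤ n (n≤1+n 2) ⟩
      3 ^ n             ≤⟨ 3ⁿ≤ ⟩
      suc (n + n) * l   ≡⟨ *-comm (suc (n + n)) l ⟩
      l * suc (n + n)   ∎)

  -- The number of bits that each stage may cost. The `suc` secures `2 ℓ ≤ a q`, and `a≤ℓ` bounds
  -- the rounding, so `a q ≤ 3 ℓ`.
  q : ℕ
  q = suc (2 * l / a)

  aq≤3ℓ : a * q ≤ 3 * l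
  aq≤3ℓ = begin
    a * suc (2 * l / a)    ≡⟨ trans (*-suc a _) (cong (a +_) (*-comm a _)) ⟩
    a + 2 * l / a * a      ≤⟨ +-mono-≤ a≤ℓ (m/n*n≤m (2 * l) a) ⟩
    l + 2 * l              ∎

  private
    2ℓ≤aq : 2 * l ≤ a * q
    2ℓ≤aq = begin
      2 * l                           ≡⟨ m≡m%n+[m/n]*n (2 * l) a ⟩
      2 * l % a + 2 * l / a * a       ≤⟨ +-monoˡ-≤ _ (<⇒≤ (m%n<n (2 * l) a)) ⟩
      a + 2 * l / a * a               ≡⟨ trans (*-suc a _) (cong (a +_) (*-comm a _)) ⟨
      a * q                           ∎

    level≤ : ∀ k K → 1 ≤ k → K ≤ 2 * (k * a) → K * l ≤ a * a * k * q
    level≤ k K 1≤k K≤ = begin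
      K * l                ≤⟨ *-monoˡ-≤ l K≤ ⟩
      2 * (k * a) * l      ≡⟨ solve 3 (λ k a l → con 2 :* (k :* a) :* l := k :* a :* (con 2 :* l)) refl k a l ⟩
      k * a * (2 * l)      ≤⟨ *-monoʳ-≤ (k * a) 2ℓ≤aq ⟩
      k * a * (a * q)      ≡⟨ solve 3 (λ k a q → k :* a :* (a :* q) := a :* a :* k :* q) refl k a q ⟩
      a * a * k * q        ∎

    size≤ : ∀ s → s ≤ a * a * (a * a) → s + s ≤ 2 ^ (4 * L)
    size≤ s s≤ = ≤-trans (+-mono-≤ s≤ s≤) 2a⁴≤

    -- One stage ending at `(k + 1) ℓ` points. It may start from `a² k q` points, which is at least
    -- `2 a k ℓ`; so the final size for each of `k = a², a` is an admissible initial size for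
    -- `k = a, 1`.
    coarse : ∀ k B .{{_ : NonZero k}} → k ≤ a * a →
      ((F : List (Point n)) → Good m F → length F ≤ suc k * l → count F ≤ B) →
      (F : List (Point n)) → Good m F → length F ≤ a * a * k * q → count F ≤ B * 2 ^ q
    coarse k B k≤ base = stage m (a * a * k) (4 * L) (suc k * l) B q {{m*n≢0 (a * a) k}}
      (size≤ (a * a * k) (*-monoʳ-≤ (a * a) k≤)) base
      (rich-coarse m k _ {{m*n≢0 m k}} (begin
        2 * ((a * a * k + a * a * k) * (4 * L))
          ≡⟨ solve 3 (λ s k L → con 2 :* ((s :* k :+ s :* k) :* (con 4 :* L)) := con 16 :* s :* L :* k) refl (a * a) k L ⟩
        16 * (a * a) * L * k
          ≤⟨ *-monoˡ-≤ k 16a²L≤m ⟩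
        m * k ∎))

    stage₀ : (F : List (Point n)) → Good m F → length F ≤ l + q → count F ≤ 2 ^ (l + q)
    stage₀ F _ F≤ = ≤-trans (count≤2^ F) (^-monoʳ-≤ 2 F≤)

    stage₁ : (F : List (Point n)) → Good m F → length F ≤ 2 * l → count F ≤ 2 ^ (l + q) * 2 ^ q
    stage₁ F good F≤ = stage m a (4 * L) (l + q) (2 ^ (l + q)) q
      (size≤ a (≤-trans a≤aa (m≤m*n (a * a) (a * a)))) stage₀
      (rich-fine m a q _ 2≤a 2ℓ≤aq (begin
        a * ((a + a) * (4 * L))
          ≡⟨ solve 2 (λ a L → a :* ((a :+ a) :* (con 4 :* L)) := con 8 :* (a :* a) :* L) refl a L ⟩
        8 * (a * a) * L
          ≤⟨ *-monoˡ-≤ L (*-monoˡ-≤ (a * a) (m≤m+n 8 8)) ⟩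
        16 * (a * a) * L
          ≤⟨ 16a²L≤m ⟩
        m ∎))
      F good (≤-trans F≤ 2ℓ≤aq)

    stage₂ : (F : List (Point n)) → Good m F → length F ≤ suc a * l → count F ≤ 2 ^ (l + q) * 2 ^ q * 2 ^ q
    stage₂ F good F≤ = coarse 1 _ (≤-trans 1≤a a≤aa) stage₁ F good
      (≤-trans F≤ (level≤ 1 (suc a) ≤-refl (≤-trans (+-monoˡ-≤ a 1≤a)
        (≤-reflexive (solve 1 (λ a → a :+ a := con 2 :* (con 1 :* a)) refl a)))))

    stage₃ : (F : List (Point n)) → Good m F → length F ≤ suc (a * a) * l → count F ≤ 2 ^ (l + q) * 2 ^ q * 2 ^ q * 2 ^ q
    stage₃ F good F≤ = coarse a _ a≤aa stage₂ F good
      (≤-trans F≤ (level≤ a (suc (a * a)) 1≤a (≤-trans (+-monoˡ-≤ (a * a) (≤-trans 1≤a a≤aa))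
        (≤-reflexive (solve 1 (λ a → a :* a :+ a :* a := con 2 :* (a :* a)) refl a)))))

    stage₄ : (F : List (Point n)) → Good m F → length F ≤ suc (n + n) * l →
             count F ≤ 2 ^ (l + q) * 2 ^ q * 2 ^ q * 2 ^ q * 2 ^ q
    stage₄ F good F≤ = coarse (a * a) _ ≤-refl stage₃ F good
      (≤-trans F≤ (level≤ (a * a) (suc (n + n)) (≤-trans 1≤a a≤aa) 1+2n≤2a³))

    atypical≤q : atypical n m ≤ q
    atypical≤q = *-cancelˡ-≤ a (*-cancelʳ-≤ _ _ (2 ^ m) {{m^n≢0 2 m}} (begin
      a * atypical n m * 2 ^ m
        ≡⟨ *-assoc a (atypical n m) (2 ^ m) ⟩
      a * (atypical n m * 2 ^ m)
        ≤⟨ *-monoʳ-≤ a (atypical-bound m 8m≤n) ⟩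
      a * (2 * 3 ^ n)
        ≤⟨ *-monoʳ-≤ a (*-monoʳ-≤ 2 3ⁿ≤) ⟩
      a * (2 * (suc (n + n) * l))
        ≡⟨ solve 3 (λ a N l → a :* (con 2 :* (N :* l)) := con 2 :* l :* (a :* N)) refl a (suc (n + n)) l ⟩
      2 * l * (a * suc (n + n))
        ≤⟨ *-mono-≤ 2ℓ≤aq a·[1+2n]≤2ᵐ ⟩
      a * q * 2 ^ m ∎))

  -- One `q` is for the atypical points, one for the `l + q` points left at the end, and four are
  -- for the stages in between.
  count-bound : count (points n) ≤ 2 ^ (l + 6 * q)
  count-bound = begin
    count (points n)
      ≤⟨ ∑-subsets-outside (typical? m) (points n) (λ S → 𝟙[ antichain? S ])
           (λ {S} {T} p → 𝟙-mono (antichain? T) (antichain? S) (AllPairs-resp-⊆ p)) ⟩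
    2 ^ atypical n m * count T
      ≤⟨ *-mono-≤ (^-monoʳ-≤ 2 atypical≤q) (stage₄ T
           (Unique.filter⁺ (typical? m) (points-unique n) , All.all-filter (typical? m) (points n))
           (≤-trans (length-filter (typical? m) (points n)) (length-points n))) ⟩
    2 ^ q * (2 ^ (l + q) * 2 ^ q * 2 ^ q * 2 ^ q * 2 ^ q)
      ≡⟨ cong (λ x → 2 ^ q * (x * 2 ^ q * 2 ^ q * 2 ^ q * 2 ^ q)) (^-distribˡ-+-* 2 l q) ⟩
    2 ^ q * (2 ^ l * 2 ^ q * 2 ^ q * 2 ^ q * 2 ^ q * 2 ^ q)
      ≡⟨ solve 2 (λ x y → y :* (x :* y :* y :* y :* y :* y) := x :* y :^ 6) refl (2 ^ l) (2 ^ q) ⟩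
    2 ^ l * (2 ^ q) ^ 6
      ≡⟨ cong (2 ^ l *_) (trans (^-*-assoc 2 q 6) (cong (2 ^_) (*-comm q 6))) ⟩
    2 ^ l * 2 ^ (6 * q)
      ≡⟨ ^-distribˡ-+-* 2 l (6 * q) ⟨
    2 ^ (l + 6 * q) ∎
    where T = filter (typical? m) (points n)

-- Choice of the parameters

-- Supplies both the integer logarithm and the integer root. The condition `a ≤ f a` ends the search
-- within `suc m` steps.
crossing : (f : ℕ → ℕ) → (∀ a → a ≤ f a) → ∀ {m} → f 0 ≤ m → ∃[ a ] f a ≤ m × m < f (suc a)
crossing f a≤fa {m} f0≤m = search (suc m) 0 f0≤m (s≤s (m≤m+n m 0))
  where
  search : ∀ k a → f a ≤ m → m < k + a → ∃[ b ] f b ≤ m × m < f (suc b)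
  search zero    a fa≤m m<a = contradiction (≤-trans (a≤fa a) fa≤m) (<⇒≱ m<a)
  search (suc k) a fa≤m m<k+a with f (suc a) ≤? m
  ... | yes le = search k (suc a) le (≤-trans m<k+a (≤-reflexive (sym (+-suc k a))))
  ... | no  ≰m = a , fa≤m , ≰⇒> ≰m

cube : ℕ → ℕ
cube x = x * x * x

-- At 4 this is 125 ≤ 128, and it fails at 3. The added polynomial is the difference of the two
-- sides.
cube-double : ∀ {x} → 4 ≤ x → cube (suc x) ≤ 2 * cube x
cube-double 4≤x with y , refl ← m≤n⇒∃[o]m+o≡n 4≤x = ≤-trans (m≤m+n _ (3 + 21 * y + 9 * (y * y) + y * y * y))
  (≤-reflexive (solve 1 (λ y → (con 5 :+ y) :* (con 5 :+ y) :* (con 5 :+ y)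
      :+ (con 3 :+ con 21 :* y :+ con 9 :* (y :* y) :+ y :* y :* y)
    := con 2 :* ((con 4 :+ y) :* (con 4 :+ y) :* (con 4 :+ y))) refl y))
  where open +-*-Solver using (solve; _:=_; _:+_; _:*_; con)

cube≤2^ : ∀ c k → 3 ≤ k → c * cube (suc k) ≤ 2 ^ k → ∀ d → c * cube (suc (k + d)) ≤ 2 ^ (k + d)
cube≤2^ c k 3≤k base zero = subst (λ j → c * cube (suc j) ≤ 2 ^ j) (sym (+-identityʳ k)) base
cube≤2^ c k 3≤k base (suc d) = subst (λ j → c * cube (suc j) ≤ 2 ^ j) (sym (+-suc k d)) (begin
  c * cube (suc (suc (k + d)))      ≤⟨ *-monoʳ-≤ c (cube-double (s≤s (≤-trans 3≤k (m≤m+n k d)))) ⟩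
  c * (2 * cube (suc (k + d)))      ≡⟨ solve 2 (λ c x → c :* (con 2 :* x) := con 2 :* (c :* x)) refl c (cube (suc (k + d))) ⟩
  2 * (c * cube (suc (k + d)))      ≤⟨ *-monoʳ-≤ 2 (cube≤2^ c k 3≤k base d) ⟩
  2 * 2 ^ (k + d)                   ∎)
  where
  open ≤-Reasoning
  open +-*-Solver using (solve; _:=_; _:+_; _:*_; con)

-- If `a` were smaller, `n` would lie below `w u² (K + 1)³`, a cubic in its own logarithm, which
-- `2 ^ K` dominates from `k` on.
root-large : ∀ w u k K a n → 3 ≤ k → w * (u * u) * cube (suc k) ≤ 2 ^ k → k ≤ K → 2 ^ K ≤ n →
             n < w * (suc a * suc a) * suc K → u * suc K ≤ a
root-large w u k K a n 3≤k base k≤K 2ᴷ≤n n< = ≮⇒≥ λ a<uL → <-irrefl refl (begin-strict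
  n                               <⟨ n< ⟩
  w * (suc a * suc a) * L         ≤⟨ *-monoˡ-≤ L (*-monoʳ-≤ w (*-mono-≤ a<uL a<uL)) ⟩
  w * (u * L * (u * L)) * L       ≡⟨ solve 3 (λ w u L → w :* (u :* L :* (u :* L)) :* L := w :* (u :* u) :* (L :* L :* L)) refl w u L ⟩
  w * (u * u) * cube L            ≤⟨ subst (λ j → w * (u * u) * cube (suc j) ≤ 2 ^ j) (m+[n∸m]≡n k≤K)
                                       (cube≤2^ (w * (u * u)) k 3≤k base (K ∸ k)) ⟩
  2 ^ K                           ≤⟨ 2ᴷ≤n ⟩
  n                               ∎)
  where
  open ≤-Reasoning
  open +-*-Solver using (solve; _:=_; _:+_; _:*_; con)
  L = suc K

quadruple : ∀ w a L → 1 ≤ a → w * (suc a * suc a) * L ≤ w * 4 * (a * a) * L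
quadruple w a L 1≤a = begin
  w * (suc a * suc a) * L         ≤⟨ *-monoˡ-≤ L (*-monoʳ-≤ w (*-mono-≤ 1+a≤a+a 1+a≤a+a)) ⟩
  w * ((a + a) * (a + a)) * L     ≡⟨ solve 3 (λ w a L → w :* ((a :+ a) :* (a :+ a)) :* L := w :* con 4 :* (a :* a) :* L) refl w a L ⟩
  w * 4 * (a * a) * L             ∎
  where
  open ≤-Reasoning
  open +-*-Solver using (solve; _:=_; _:+_; _:*_; con)
  1+a≤a+a : suc a ≤ a + a
  1+a≤a+a = +-monoˡ-≤ a 1≤a

cubic : ∀ u a L → u * L ≤ a → u * (a * a) * L ≤ a * a * a
cubic u a L uL≤a = ≤-trans (≤-reflexive (solve 3 (λ u s L → u :* s :* L := s :* (u :* L)) refl u (a * a) L))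
  (*-monoʳ-≤ (a * a) uL≤a)
  where open +-*-Solver using (solve; _:=_; _:+_; _:*_; con)

module Parameters (n : ℕ) (2⁶⁴≤n : 2 ^ 64 ≤ n) where

  open ≤-Reasoning
  open +-*-Solver using (solve; _:=_; _:+_; _:*_; con)

  private
    1≤n : 1 ≤ n
    1≤n = ≤-trans (m^n>0 2 64) 2⁶⁴≤n

    log : ∃[ K ] 2 ^ K ≤ n × n < 2 ^ suc K
    log = crossing (2 ^_) (λ a → <⇒≤ (n<2^n a)) 1≤n

  K : ℕ
  K = proj₁ log

  2ᴷ≤n : 2 ^ K ≤ n
  2ᴷ≤n = proj₁ (proj₂ log)

  private
    L m : ℕ
    L = suc K
    m = n / 8

    n<2ᴸ : n < 2 ^ L
    n<2ᴸ = proj₂ (proj₂ log)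

  64≤K : 64 ≤ K
  64≤K = ≮⇒≥ λ K<64 → <⇒≱ n<2ᴸ (≤-trans (^-monoʳ-≤ 2 K<64) 2⁶⁴≤n)

  private
    root : ∃[ a ] 16 * (a * a) * L ≤ m × m < 16 * (suc a * suc a) * L
    root = crossing (λ a → 16 * (a * a) * L) below z≤n
      where
      below : ∀ a → a ≤ 16 * (a * a) * L
      below zero      = z≤n
      below a@(suc _) = ≤-trans (≤-trans (m≤m*n a a) (m≤n*m (a * a) 16)) (m≤m*n _ L)

  a : ℕ
  a = proj₁ root

  private
    16a²L≤m : 16 * (a * a) * L ≤ m
    16a²L≤m = proj₁ (proj₂ root)

    8m≤n : m * 8 ≤ n
    8m≤n = m/n*n≤m n 8

    n<128[1+a]²L : n < 128 * (suc a * suc a) * L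
    n<128[1+a]²L = begin-strict
      n                                   ≡⟨ m≡m%n+[m/n]*n n 8 ⟩
      n % 8 + m * 8                       <⟨ +-monoˡ-< (m * 8) (m%n<n n 8) ⟩
      8 + m * 8                           ≤⟨ *-monoˡ-≤ 8 (proj₂ (proj₂ root)) ⟩
      16 * (suc a * suc a) * L * 8        ≡⟨ *-comm (16 * (suc a * suc a) * L) 8 ⟩
      8 * (16 * (suc a * suc a) * L)      ≡⟨ trans (cong (_* L) (*-assoc 8 16 (suc a * suc a))) (*-assoc 8 (16 * (suc a * suc a)) L) ⟨
      128 * (suc a * suc a) * L           ∎

    -- The threshold `2 ^ 64` is a generous choice for the numerical premise here. The constant 512
    -- is the one in `n<512a²L`, so that this bound turns it into `n < a³`.
    512L≤a : 128 * 4 * L ≤ a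
    512L≤a = root-large 128 (128 * 4) 64 K a n (m≤m+n 3 61)
      (≤ᵇ⇒≤ (128 * (128 * 4 * (128 * 4)) * cube 65) (2 ^ 64) _) 64≤K 2ᴷ≤n n<128[1+a]²L

    2≤a : 2 ≤ a
    2≤a = ≤-trans (≤-trans (m≤m+n 2 510) (m≤m*n (128 * 4) L)) 512L≤a

  1≤a : 1 ≤ a
  1≤a = ≤-trans (s≤s z≤n) 2≤a

  n<512a²L : n < 128 * 4 * (a * a) * suc K
  n<512a²L = <-≤-trans n<128[1+a]²L (quadruple 128 a L 1≤a)

  private
    instance
      a≢0 : NonZero a
      a≢0 = >-nonZero 1≤a
      aa≢0 : NonZero (a * a)
      aa≢0 = m*n≢0 a a

    n<a³ : n < a * a * a
    n<a³ = <-≤-trans n<512a²L (cubic (128 * 4) a L 512L≤a)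

    1+2n≤ : ∀ {N} → n < N → suc (n + n) ≤ 2 * N
    1+2n≤ {N} n<N = ≤-trans (+-mono-≤ n<N (<⇒≤ n<N)) (≤-reflexive (cong (N +_) (sym (+-identityʳ N))))

    16aa≤m : 16 * (a * a) ≤ m
    16aa≤m = ≤-trans (m≤m*n _ L) 16a²L≤m

    aa≤2ᴸ : a * a ≤ 2 ^ L
    aa≤2ᴸ = ≤-trans (≤-trans (m≤n*m (a * a) 16) 16aa≤m) (≤-trans (m/n≤m n 8) (<⇒≤ n<2ᴸ))

    2^[1+2L] : 2 ^ L * (2 * 2 ^ L) ≡ 2 ^ suc (L + L)
    2^[1+2L] = trans (solve 1 (λ x → x :* (con 2 :* x) := con 2 :* (x :* x)) refl (2 ^ L))
      (cong (2 *_) (sym (^-distribˡ-+-* 2 L L)))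

    1+2L≤4L : suc (L + L) ≤ 4 * L
    1+2L≤4L = ≤-trans (+-monoˡ-≤ (L + L) (s≤s z≤n)) (≤-trans (+-monoʳ-≤ L (m≤m+n (L + L) L))
      (≤-reflexive (solve 1 (λ L → L :+ (L :+ L :+ L) := con 4 :* L) refl L)))

    2a⁴≤ : a * a * (a * a) + a * a * (a * a) ≤ 2 ^ (4 * L)
    2a⁴≤ = begin
      a * a * (a * a) + a * a * (a * a)   ≤⟨ +-mono-≤ (*-mono-≤ aa≤2ᴸ aa≤2ᴸ) (*-mono-≤ aa≤2ᴸ aa≤2ᴸ) ⟩
      2 ^ L * 2 ^ L + 2 ^ L * 2 ^ L       ≡⟨ solve 1 (λ x → x :* x :+ x :* x := x :* (con 2 :* x)) refl (2 ^ L) ⟩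
      2 ^ L * (2 * 2 ^ L)                 ≡⟨ 2^[1+2L] ⟩
      2 ^ suc (L + L)                     ≤⟨ ^-monoʳ-≤ 2 1+2L≤4L ⟩
      2 ^ (4 * L)                         ∎

    a·[1+2n]≤2ᵐ : a * suc (n + n) ≤ 2 ^ m
    a·[1+2n]≤2ᵐ = begin
      a * suc (n + n)       ≤⟨ *-mono-≤ (≤-trans (m≤m*n a a) aa≤2ᴸ) (1+2n≤ n<2ᴸ) ⟩
      2 ^ L * (2 * 2 ^ L)   ≡⟨ 2^[1+2L] ⟩
      2 ^ suc (L + L)       ≤⟨ ^-monoʳ-≤ 2 (≤-trans 1+2L≤4L (≤-trans (*-monoˡ-≤ L 4≤16aa) 16a²L≤m)) ⟩
      2 ^ m                 ∎
      where
      4≤16aa : 4 ≤ 16 * (a * a)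
      4≤16aa = ≤-trans (m≤m+n 4 12) (m≤m*n 16 (a * a))

  open Bound n m L a 8m≤n 16a²L≤m 2≤a (s≤s z≤n) 2a⁴≤ (1+2n≤ n<a³) a·[1+2n]≤2ᵐ public

-- Real exponents

ι : ℕ → ℚᵘ
ι k = ℤ.+ k ℚ./ 1

ι-+ : ∀ j k → ι (j + k) ≃ ι j ℚ.+ ι k
ι-+ j k = *≡* (cong₂ ℤ._*_ (trans (ℤ.pos-+ j k) (sym (cong₂ ℤ._+_ (ℤ.*-identityʳ (ℤ.+ j)) (ℤ.*-identityʳ (ℤ.+ k))))) refl)

ι-* : ∀ j k → ι (j * k) ≃ ι j ℚ.* ι k
ι-* j k = *≡* (cong (ℤ._* ℤ.+ 1) (ℤ.pos-* j k))

ι-mono-≤ : ∀ {j k} → j ≤ k → ι j ℚ.≤ ι k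
ι-mono-≤ {j} {k} j≤k = *≤* (subst₂ ℤ._≤_ (sym (ℤ.*-identityʳ (ℤ.+ j))) (sym (ℤ.*-identityʳ (ℤ.+ k))) (ℤ.+≤+ j≤k))

ι-mono-< : ∀ {j k} → j < k → ι j ℚ.< ι k
ι-mono-< {j} {k} j<k = *<* (subst₂ ℤ._<_ (sym (ℤ.*-identityʳ (ℤ.+ j))) (sym (ℤ.*-identityʳ (ℤ.+ k))) (ℤ.+<+ j<k))

instance
  ι-nonNeg : ∀ {k} → ℚ.NonNegative (ι k)
  ι-nonNeg {k} = ℚ.nonNegative (ι-mono-≤ {0} {k} z≤n)

2^<ℕ-intro : ∀ k N .{{_ : NonZero N}} x → 2 ^ k ≤ N → x ℚ.< ι k → 2^ x <ℕ N
2^<ℕ-intro k N (mkℚᵘ (ℤ.+ p) d) 2ᵏ≤N x<k = begin-strict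
  2 ^ p               <⟨ ^-monoʳ-< 2 (s≤s (s≤s z≤n)) (≤-<-trans (≤-reflexive (sym (*-identityʳ p))) (+/+<+/+ x<k)) ⟩
  2 ^ (k * suc d)     ≡⟨ ^-*-assoc 2 k (suc d) ⟨
  (2 ^ k) ^ suc d     ≤⟨ ^-monoˡ-≤ (suc d) 2ᵏ≤N ⟩
  N ^ suc d           ∎
  where open ≤-Reasoning
2^<ℕ-intro k N (mkℚᵘ ℤ.-[1+ p ] d) _ _ = *-mono-≤ (m^n>0 N (suc d)) (^-monoʳ-≤ 2 {1} {suc p} (s≤s z≤n))

2^<ℕ-elim : ∀ k N x → N ≤ 2 ^ k → 2^ x <ℕ N → x ℚ.< ι k
2^<ℕ-elim k N (mkℚᵘ (ℤ.+ p) d) N≤2ᵏ lt = mk+/+< (≤-<-trans (≤-reflexive (*-identityʳ p))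
  (≰⇒> λ kd≤p → <⇒≱ lt (begin
    N ^ suc d           ≤⟨ ^-monoˡ-≤ (suc d) N≤2ᵏ ⟩
    (2 ^ k) ^ suc d     ≡⟨ ^-*-assoc 2 k (suc d) ⟩
    2 ^ (k * suc d)     ≤⟨ ^-monoʳ-≤ 2 kd≤p ⟩
    2 ^ p               ∎)))
  where open ≤-Reasoning
2^<ℕ-elim k N (mkℚᵘ ℤ.-[1+ p ] d) _ _ = *<* (subst (ℤ.-[1+ p ] ℤ.* ℤ.+ 1 ℤ.<_) (ℤ.pos-* k (suc d)) ℤ.-<+)

-- True by definition, but `_÷ℕ_` unfolds only at a successor.
÷ℕ-lower : ∀ x k .{{_ : NonZero k}} q → Lower x (ι k ℚ.* q) → Lower (x ÷ℕ k) q
÷ℕ-lower x (suc k) q l = l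

÷ℕ-lower⁻ : ∀ x k .{{_ : NonZero k}} q → Lower (x ÷ℕ k) q → Lower x (ι k ℚ.* q)
÷ℕ-lower⁻ x (suc k) q l = l

abstract
  -- The equation `N = 2 ^ (k (1 + ε))` solved for `ε`, which makes exactness a matter of rational
  -- algebra and leaves the content to the estimates.
  excess : (N k : ℕ) .{{_ : NonZero N}} .{{_ : NonZero k}} → ℝ
  excess N k = (ℚ.- 1ℚᵘ) ⊕ (log₂ N ÷ℕ k)

  excess-exact : ∀ N k .{{_ : NonZero N}} .{{_ : NonZero k}} → N =2^ (k · (1ℚᵘ ⊕ excess N k))
  excess-exact N (suc k) q =
    mk⇔ (ℝ.lower-resp-≃ (log₂ N) z≃q) (ℝ.lower-resp-≃ (log₂ N) (ℚ.≃-sym z≃q)) ,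
    mk⇔ (ℝ.upper-resp-≃ (log₂ N) z≃q) (ℝ.upper-resp-≃ (log₂ N) (ℚ.≃-sym z≃q))
    where
    c c⁻¹ : ℚᵘ
    c   = ι (suc k)
    c⁻¹ = ℤ.+ 1 ℚ./ suc k
    z≃q : c ℚ.* ((c⁻¹ ℚ.* q ℚ.- 1ℚᵘ) ℚ.- (ℚ.- 1ℚᵘ)) ≃ q
    z≃q = ℚ.≃-trans
      (solve 3 (λ c d q → c :* ((d :* q :- con 1ℚᵘ) :- (:- con 1ℚᵘ)) := (c :* d) :* q) ℚ.≃-refl c c⁻¹ q)
      (ℚ.≃-trans (ℚ.*-congʳ {q} (ℚ.*-inverseʳ c)) (ℚ.*-identityˡ q))
      where open ℚ-Solver

  excess-lower : ∀ N k .{{_ : NonZero N}} .{{_ : NonZero k}} q →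
                 Lower (log₂ N) (ι k ℚ.* (q ℚ.- (ℚ.- 1ℚᵘ))) → Lower (excess N k) q
  excess-lower N k q = ÷ℕ-lower (log₂ N) k (q ℚ.- (ℚ.- 1ℚᵘ))

  excess-lower⁻ : ∀ N k .{{_ : NonZero N}} .{{_ : NonZero k}} q →
                  Lower (excess N k) q → Lower (log₂ N) (ι k ℚ.* (q ℚ.- (ℚ.- 1ℚᵘ)))
  excess-lower⁻ N k q = ÷ℕ-lower⁻ (log₂ N) k (q ℚ.- (ℚ.- 1ℚᵘ))

-- The error term and its bounds.

ℓ-nonZero : ∀ n → NonZero (ℓ n n)
ℓ-nonZero n = m*n≢0⇒n≢0 (suc (n + n)) {{>-nonZero (≤-trans (m^n>0 3 n)
  (≤-trans (≤-reflexive (sym (length-points≡3^ n))) (length-points n)))}}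

2^ℓ≤#antichains : ∀ n → 2 ^ ℓ n n ≤ #antichains n
2^ℓ≤#antichains n = ≤-trans (2^ℓ≤count n) (≤-reflexive (sym (#antichains≡count n)))

#antichains-nonZero : ∀ n → NonZero (#antichains n)
#antichains-nonZero n = >-nonZero (≤-trans (m^n>0 2 (ℓ n n)) (2^ℓ≤#antichains n))

ε : ℕ → ℝ
ε n = excess (#antichains n) (ℓ n n) {{#antichains-nonZero n}} {{ℓ-nonZero n}}

ε-nonNegative : ∀ n q → q ℚ.< 0ℚᵘ → Lower (ε n) q
ε-nonNegative n q q<0 = excess-lower N l q (2^<ℕ-intro l N _ (2^ℓ≤#antichains n)
  (ℚ.<-respʳ-≃ (ℚ.*-identityʳ (ι l)) (ℚ.*-monoʳ-<-pos (ι l) (ℚ.+-monoˡ-< 1ℚᵘ q<0))))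
  where
  N l : ℕ
  N = #antichains n
  l = ℓ n n
  instance
    N≢0 : NonZero N
    N≢0 = #antichains-nonZero n
    l≢0 : NonZero l
    l≢0 = ℓ-nonZero n
    l-pos : ℚ.Positive (ι l)
    l-pos = ℚ.positive (ι-mono-< {0} {l} (>-nonZero⁻¹ l))

cancel-+ʳ : ∀ {p q} r → p ℚ.+ r ℚ.< q ℚ.+ r → p ℚ.< q
cancel-+ʳ {p} {q} r lt = ℚ.<-respˡ-≃ (undo p) (ℚ.<-respʳ-≃ (undo q) (ℚ.+-monoˡ-< (ℚ.- r) lt))
  where
  open ℚ-Solver
  undo : ∀ p → (p ℚ.+ r) ℚ.- r ≃ p
  undo p = solve 2 (λ p r → (p :+ r) :- r := p) ℚ.≃-refl p r

-- Turns an exponent bound `l + e` into `ε ≤ v / a`: from `l (1 + q) < l + e` follows `l q < e`.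
scaled-bound : ∀ l e a v q .{{_ : NonZero l}} → a * e ≤ v * l →
               ι l ℚ.* (q ℚ.- (ℚ.- 1ℚᵘ)) ℚ.< ι (l + e) → ι a ℚ.* q ℚ.≤ ι v
scaled-bound l e a v q ae≤vl lt = ℚ.*-cancelˡ-≤-pos (ι l) (begin
  ι l ℚ.* (ι a ℚ.* q)   ≃⟨ solve 3 (λ l a q → l :* (a :* q) := a :* (l :* q)) ℚ.≃-refl (ι l) (ι a) q ⟩
  ι a ℚ.* (ι l ℚ.* q)   ≤⟨ ℚ.*-monoʳ-≤-nonNeg (ι a) (ℚ.<⇒≤ lq<e) ⟩
  ι a ℚ.* ι e           ≃⟨ ι-* a e ⟨
  ι (a * e)             ≤⟨ ι-mono-≤ ae≤vl ⟩
  ι (v * l)             ≃⟨ ι-* v l ⟩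
  ι v ℚ.* ι l           ≃⟨ ℚ.*-comm (ι v) (ι l) ⟩
  ι l ℚ.* ι v           ∎)
  where
  open ℚ.≤-Reasoning
  open ℚ-Solver using (solve; _:=_; _:+_; _:*_; _:-_; :-_; con)
  instance
    l-pos : ℚ.Positive (ι l)
    l-pos = ℚ.positive (ι-mono-< {0} {l} (>-nonZero⁻¹ l))
  lq<e : ι l ℚ.* q ℚ.< ι e
  lq<e = cancel-+ʳ (ι l) (begin-strict
    ι l ℚ.* q ℚ.+ ι l               ≃⟨ solve 2 (λ l q → l :* q :+ l := l :* (q :- (:- con 1ℚᵘ))) ℚ.≃-refl (ι l) q ⟩
    ι l ℚ.* (q ℚ.- (ℚ.- 1ℚᵘ))       <⟨ lt ⟩
    ι (l + e)                       ≃⟨ ι-+ l e ⟩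
    ι l ℚ.+ ι e                     ≃⟨ ℚ.+-comm (ι l) (ι e) ⟩
    ι e ℚ.+ ι l                     ∎)

-- Eliminates `a`: `C² n x²` is at most `w K (a C x)²`, hence at most `w v² K`. Strictness is kept
-- for the open lower cut of the square root.
square-bound : ∀ n w a K v C x → n ≤ w * (a * a) * K → w * (v * v) * K < C * C * K →
               0ℚᵘ ℚ.≤ x → ι a ℚ.* (ι C ℚ.* x) ℚ.≤ ι v → ι n ℚ.* (x ℚ.* x) ℚ.< ι K
square-bound n w a K v C x n≤ w< 0≤x ay≤v = ℚ.*-cancelˡ-<-nonNeg (ι (C * C)) (begin-strict
  ι (C * C) ℚ.* (ι n ℚ.* (x ℚ.* x))
    ≃⟨ ℚ.*-congʳ {ι n ℚ.* (x ℚ.* x)} (ι-* C C) ⟩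
  ι C ℚ.* ι C ℚ.* (ι n ℚ.* (x ℚ.* x))
    ≃⟨ solve 3 (λ C n x → C :* C :* (n :* (x :* x)) := n :* (C :* x :* (C :* x))) ℚ.≃-refl (ι C) (ι n) x ⟩
  ι n ℚ.* (y ℚ.* y)
    ≤⟨ ℚ.*-monoˡ-≤-nonNeg (y ℚ.* y) {{ℚ.nonNeg*nonNeg⇒nonNeg y y}} (ι-mono-≤ n≤) ⟩
  ι (w * (a * a) * K) ℚ.* (y ℚ.* y)
    ≃⟨ ℚ.*-congʳ {y ℚ.* y} (ℚ.≃-trans (ι-* (w * (a * a)) K) (ℚ.*-congʳ {ι K}
         (ℚ.≃-trans (ι-* w (a * a)) (ℚ.*-congˡ {ι w} (ι-* a a))))) ⟩
  ι w ℚ.* (ι a ℚ.* ι a) ℚ.* ι K ℚ.* (y ℚ.* y)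
    ≃⟨ solve 4 (λ w a K y → w :* (a :* a) :* K :* (y :* y) := w :* K :* (a :* y :* (a :* y))) ℚ.≃-refl (ι w) (ι a) (ι K) y ⟩
  ι w ℚ.* ι K ℚ.* (ι a ℚ.* y ℚ.* (ι a ℚ.* y))
    ≤⟨ ℚ.*-monoʳ-≤-nonNeg (ι w ℚ.* ι K) {{ℚ.nonNeg*nonNeg⇒nonNeg (ι w) (ι K)}}
         (ℚ.*-mono-≤-nonNeg {{ℚ.nonNeg*nonNeg⇒nonNeg (ι a) y}} {{ℚ.nonNeg*nonNeg⇒nonNeg (ι a) y}} ay≤v ay≤v) ⟩
  ι w ℚ.* ι K ℚ.* (ι v ℚ.* ι v)
    ≃⟨ solve 3 (λ w K v → w :* K :* (v :* v) := w :* (v :* v) :* K) ℚ.≃-refl (ι w) (ι K) (ι v) ⟩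
  ι w ℚ.* (ι v ℚ.* ι v) ℚ.* ι K
    ≃⟨ ℚ.≃-trans (ι-* (w * (v * v)) K) (ℚ.*-congʳ {ι K}
         (ℚ.≃-trans (ι-* w (v * v)) (ℚ.*-congˡ {ι w} (ι-* v v)))) ⟨
  ι (w * (v * v) * K)
    <⟨ ι-mono-< w< ⟩
  ι (C * C * K)
    ≃⟨ ι-* (C * C) K ⟩
  ι (C * C) ℚ.* ι K ∎)
  where
  open ℚ.≤-Reasoning
  open ℚ-Solver using (solve; _:=_; _:+_; _:*_; con)
  y : ℚᵘ
  y = ι C ℚ.* x
  instance
    x-nonNeg : ℚ.NonNegative x
    x-nonNeg = ℚ.nonNegative 0≤x
    y-nonNeg : ℚ.NonNegative y
    y-nonNeg = ℚ.nonNeg*nonNeg⇒nonNeg (ι C) x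

next≤double : ∀ u s {K} → 1 ≤ K → u * s * suc K ≤ u * 2 * s * K
next≤double u s {K} 1≤K = ≤-trans (*-monoʳ-≤ (u * s) (+-monoˡ-≤ K 1≤K))
  (≤-reflexive (solve 3 (λ u s K → u :* s :* (K :+ K) := u :* con 2 :* s :* K) refl u s K))
  where open +-*-Solver

ε-upper : ∀ n .{{_ : NonZero n}} → 2 ^ 64 ≤ n → ε n ≤ℝ 577 · √ (log₂ n ÷ℕ n)
ε-upper n 2⁶⁴≤n q q<ε with (ℤ.+ 1 ℚ./ 577) ℚ.* q ℚ.<? 0ℚᵘ
... | yes x<0 = inj₁ x<0
... | no  x≮0 = inj₂ (÷ℕ-lower (log₂ n) n (x ℚ.* x) (2^<ℕ-intro K n _ 2ᴷ≤n
    -- The factor 1024 is 512 doubled in passing from `K + 1` to `K`, and 18 is `6 * 3` from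
    -- `count-bound` and `aq≤3ℓ`. As 18 times the root of 1024 is 576, the constant 577 leaves
    -- strict room.
    (square-bound n (128 * 4 * 2) a K 18 577 x
      (≤-trans (<⇒≤ n<512a²L) (next≤double (128 * 4) (a * a) 1≤K))
      (*-monoˡ-< K (<ᵇ⇒< (128 * 4 * 2 * (18 * 18)) (577 * 577) _))
      (ℚ.≮⇒≥ x≮0)
      (ℚ.≤-respˡ-≃ (ℚ.*-congˡ {ι a} (ℚ.≃-sym 577x≃q))
        (scaled-bound l (6 * P.q) a 18 q a·6q≤18ℓ
          (2^<ℕ-elim (l + 6 * P.q) (#antichains n) _
            (≤-trans (≤-reflexive (#antichains≡count n)) count-bound)
            (excess-lower⁻ (#antichains n) l q q<ε)))))))
  where
  module P = Parameters n 2⁶⁴≤n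
  open P using (K; a; 2ᴷ≤n; n<512a²L; 64≤K; aq≤3ℓ; count-bound)
  x : ℚᵘ
  x = (ℤ.+ 1 ℚ./ 577) ℚ.* q
  l : ℕ
  l = ℓ n n
  1≤K : 1 ≤ K
  1≤K = ≤-trans (s≤s z≤n) 64≤K
  instance
    K≢0 : NonZero K
    K≢0 = >-nonZero 1≤K
    N≢0 : NonZero (#antichains n)
    N≢0 = #antichains-nonZero n
    l≢0 : NonZero l
    l≢0 = ℓ-nonZero n
  577x≃q : ι 577 ℚ.* x ≃ q
  577x≃q = ℚ.≃-trans (ℚ.≃-sym (ℚ.*-assoc (ι 577) (ℤ.+ 1 ℚ./ 577) q))
    (ℚ.≃-trans (ℚ.*-congʳ {q} (ℚ.*-inverseʳ (ι 577))) (ℚ.*-identityˡ q))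
  a·6q≤18ℓ : a * (6 * P.q) ≤ 18 * l
  a·6q≤18ℓ = begin
    a * (6 * P.q)   ≡⟨ solve 2 (λ a q → a :* (con 6 :* q) := con 6 :* (a :* q)) refl a P.q ⟩
    6 * (a * P.q)   ≤⟨ *-monoʳ-≤ 6 aq≤3ℓ ⟩
    6 * (3 * l)     ≡⟨ *-assoc 6 3 l ⟨
    18 * l          ∎
    where
    open ≤-Reasoning
    open +-*-Solver using (solve; _:=_; _:*_; con)

-- The upper cut of `√` contains positive rationals only, so a `q` in the lower cut on the left is
-- negative, and `ε-nonNegative` applies.
ε-lower : ∀ n .{{_ : NonZero n}} c → -ℝ (suc c · √ (log₂ n ÷ℕ n)) ≤ℝ ε n
ε-lower n c q (0<-q/c , _) = ε-nonNegative n q (ℚ.≰⇒> λ 0≤q → ℚ.<⇒≱ 0<-q/c (begin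
  (ℤ.+ 1 ℚ./ suc c) ℚ.* (ℚ.- q)   ≤⟨ ℚ.*-monoʳ-≤-nonNeg (ℤ.+ 1 ℚ./ suc c) (ℚ.neg-mono-≤ 0≤q) ⟩
  (ℤ.+ 1 ℚ./ suc c) ℚ.* 0ℚᵘ       ≃⟨ ℚ.*-zeroʳ (ℤ.+ 1 ℚ./ suc c) ⟩
  0ℚᵘ                           ∎))
  where open ℚ.≤-Reasoning

ε-exact : ∀ n → #antichains n =2^ (ℓ n n · (1ℚᵘ ⊕ ε n))
ε-exact n = excess-exact (#antichains n) (ℓ n n) {{#antichains-nonZero n}} {{ℓ-nonZero n}}

ε-O : ε =O λ n → √ (log₂ n ÷ℕ n)
ε-O = 577 , 2 ^ 64 , λ n 2⁶⁴≤n → ε-lower n 576 , ε-upper n 2⁶⁴≤n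

mainTheorem4 : ∃[ ε ] (∀ n → #antichains n =2^ (ℓ n n · (1ℚᵘ ⊕ ε n))) × (ε =O λ n → √ (log₂ n ÷ℕ n))
mainTheorem4 = ε , ε-exact , ε-O
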